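{- Let $\sigma(n)$ denote the sum of the positive divisors of $n$. Let $B=\{n\geq 1:\ \sigma(2n+1)\geq \sigma(2n)\}$ and let $B(x)=|\{n\in B:\ n\leq x\}|$. Then the natural density $\operatorname{dens} B=\lim_{x\to\infty}B(x)/x$ exists, and \[0.0539171 \leq \operatorname{dens} B \leq 0.0549445.\] -}

module Defs where

open import Data.Nat using (ℕ; suc; _*_; _+_; _≤?_)
open import Data.Nat.Divisibility using (_∣?_)
open import Data.List using (List; map; upTo; filter; length)
open import Data.Nat.ListAction using (sum)
open import Data.Integer using (+_)
open import Data.Rational using (ℚ; _/_)

oneTo : ℕ → List ℕ
oneTo n = map suc (upTo n)

-- σ n : sum of the positive divisors of n (intended for n ≥ 1)
σ : ℕ → ℕ
σ n = sum (filter (λ d → d ∣? n) (oneTo n))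

Bcount : ℕ → ℕ
Bcount x = length (filter (λ n → σ (2 * n) ≤? σ (2 * n + 1)) (oneTo x))

-- the sequence B(x)/x, indexed by k with x = k + 1
ratio : ℕ → ℚ
ratio k = (+ Bcount (suc k)) / suc k

lowerBound : ℚ
lowerBound = (+ 539171) / 10000000

upperBound : ℚ
upperBound = (+ 549445) / 10000000

{-# OPTIONS --safe #-}
-- Write h(m) = σ(m)/m for the sum of 1/e over the divisors e of m. Up to finitely many n, n ∈ B means that
-- h(2n+1) is at least h(2n), the factor (2n+1)/2n being negligible.
--
-- Existence of the density. Truncating h at divisors e ≤ Y gives a periodic function, and by Markov's inequality
-- the tails are small outside a set of density O(1/(δY)). So it suffices that |h(2n+1) - h(2n)| ≤ δ is rare. Take
-- the primes in (y, z]: the n for which none of them divides 2n+1 have density at most the product of the 1 - 1/p,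
-- which is small because the harmonic series diverges. If p divides 2n+1, exactly once, the p-free parts x of
-- h(2n+1) and w of h(2n) satisfy x (1 + 1/p) ≈ w, a condition independent of the residue of n mod p; among the n with
-- p dividing neither number it holds for at most one p, since the 1 + 1/p are separated.
-- Comparing densities, the n with such a p have density O(1/y).
--
-- Numerical bounds. Process the primes 2, 3, 5, ... one by one, and keep a lower bound for the contribution of
-- the processed primes to log (h(n₁)/h(n₂)) as an integer multiple of log (1 + 1/N). The residues modulo
-- different primes are independent, so the density of the failures h(n₁) < h(n₂) as a function of this integer obeys
-- a backward recursion, which is evaluated in fixed-point arithmetic rounded up. At the last prime, Markov's inequality
-- bounds the contribution of the remaining divisors by the sum of 1/e² over e > 1 free of processed primes.
-- With (n₁, n₂) = (2n+1, 2n) and (2n, 2n+1) this bounds the density from below and from above.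
module Submission where

open import Defs
open import Agda.Builtin.Strict using (primForce; primForceLemma)
open import Data.Bool using (Bool; true; false; not; _∧_; _∨_; T; if_then_else_)
open import Data.Empty using (⊥; ⊥-elim)
import Data.Integer as ℤ
import Data.Integer.Properties as ℤₚ
open import Data.List using (List; []; _∷_; _++_; applyUpTo; filter; length; map; replicate)
open import Data.List.Relation.Unary.All using ([]; _∷_)
open import Data.Nat as ℕ using (ℕ; zero; suc; _!)
open import Data.Nat.Coprimality as Cop using (Coprime; coprime?; coprime-divisor)
open import Data.Nat.DivMod using (_/_; _%_; m≡m%n+[m/n]*n; m%n<n; m/n*n≤m)
open import Data.Nat.Divisibility using (_∣_; _∣?_; divides; _∣0; 1∣_; ∣1⇒≡1; ∣⇒≤; ∣-refl; ∣-trans; ∣m∣n⇒∣m+n; ∣m+n∣m⇒∣n; m∣m*n; n∣m*n; ∣m⇒∣m*n; ∣n⇒∣m*n; *-cancelˡ-∣; *-monoʳ-∣; n∣m⇒m%n≡0; m≤n⇒m!∣n!)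
open import Data.Nat.ListAction using (sum; product)
open import Data.Nat.Primality using (Prime; prime?; prime[2]; prime⇒irreducible; prime⇒nonTrivial; prime⇒nonZero; euclidsLemma; _Rough_; 2-rough; ∤⇒rough-suc; rough∧square>⇒prime)
open import Data.Nat.Primality.Factorisation using (factorise)
import Data.Nat.Properties as ℕₚ
open import Data.Nat.Solver using () renaming (module +-*-Solver to ℕ-Solver)
open import Data.Product using (_×_; _,_; proj₁; proj₂; ∃-syntax)
open import Data.Rational as ℚ using (ℚ; mkℚ; 0ℚ; 1ℚ; _+_; _*_; _-_; -_; _≤_; _<_; _≤?_; _<?_; nonNegative)
import Data.Rational.Properties as ℚₚ
open import Data.Rational.Solver using (module +-*-Solver)
import Data.Rational.Unnormalised as ℚᵘ
import Data.Rational.Unnormalised.Properties as ℚᵘₚ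
open import Data.Sum using (_⊎_; inj₁; inj₂)
open import Data.Unit using (tt)
open import Function using (_∘_)
open import Relation.Binary.Definitions using (tri<; tri≈; tri>)
open import Relation.Binary.PropositionalEquality
open import Relation.Nullary using (¬_; Dec; yes; no)
open import Relation.Nullary.Decidable using (_×-dec_; ¬?)
open import Relation.Unary using (Decidable)
open +-*-Solver using (solve; _:+_; _:*_; _:-_; :-_; _:=_; con)
open ℕ-Solver using () renaming (solve to solveℕ; _:+_ to _⊕_; _:*_ to _⊗_; _:=_ to _≐_; con to #_)

-- Averages are almost always bounded from above only; a bound from below is obtained from the
-- complementary set. For the sieve to be small, the primes in (y, z] must have a large sum of 1/p,
-- so allowing each of them a density 1/p and adding up gives nothing. The gain has to come from the
-- uniqueness of the resonant prime, which lets the sum over p be taken before the average. In the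
-- numerical half no logarithm is ever formed: a contribution is an exponent of 1 + 1/N, justified
-- by an inequality between natural numbers. Only the difference of the exponents of the two numbers
-- matters, so one integer describes a state. Odd primes treat n₁ and n₂ alike; hence a single
-- table, sound for both orders of the pair, is computed, and only the prime 2, which always divides
-- 2n, tells the orders apart. Failures become rarer as the exponent of n₁ grows. Therefore every
-- contribution may be rounded against n₁, and a table may be cut on both sides: it is continued by
-- 1 on the left and by its last entry on the right.

≤-diff : ∀ {a b} d → 0ℚ ≤ d → a + d ≡ b → a ≤ b
≤-diff {a} d 0≤d refl = subst (_≤ a + d) (ℚₚ.+-identityʳ a) (ℚₚ.+-monoʳ-≤ a 0≤d)

<-diff : ∀ {a b} d → 0ℚ < d → a + d ≡ b → a < b
<-diff {a} d 0<d refl = subst (_< a + d) (ℚₚ.+-identityʳ a) (ℚₚ.+-monoʳ-< a 0<d)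

diff-≥0 : ∀ {a b} → a ≤ b → 0ℚ ≤ b - a
diff-≥0 {a} {b} a≤b = subst (_≤ b - a) (ℚₚ.+-inverseʳ a) (ℚₚ.+-monoˡ-≤ (- a) a≤b)

diff->0 : ∀ {a b} → a < b → 0ℚ < b - a
diff->0 {a} {b} a<b = subst (_< b - a) (ℚₚ.+-inverseʳ a) (ℚₚ.+-monoˡ-< (- a) a<b)

*-monoˡ : ∀ {c a b} → 0ℚ ≤ c → a ≤ b → c * a ≤ c * b
*-monoˡ {c} 0≤c = ℚₚ.*-monoˡ-≤-nonNeg c {{nonNegative 0≤c}}

*-monoʳ : ∀ {c a b} → 0ℚ ≤ c → a ≤ b → a * c ≤ b * c
*-monoʳ {c} 0≤c = ℚₚ.*-monoʳ-≤-nonNeg c {{nonNegative 0≤c}}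

*-mono : ∀ {a b c d} → 0ℚ ≤ a → 0ℚ ≤ d → a ≤ b → c ≤ d → a * c ≤ b * d
*-mono 0≤a 0≤d a≤b c≤d = ℚₚ.≤-trans (*-monoˡ 0≤a c≤d) (*-monoʳ 0≤d a≤b)

*-≥0 : ∀ {a b} → 0ℚ ≤ a → 0ℚ ≤ b → 0ℚ ≤ a * b
*-≥0 {a} {b} 0≤a 0≤b = subst (_≤ a * b) (ℚₚ.*-zeroʳ a) (*-monoˡ 0≤a 0≤b)

+-≥0 : ∀ {a b} → 0ℚ ≤ a → 0ℚ ≤ b → 0ℚ ≤ a + b
+-≥0 = ℚₚ.+-mono-≤

*-monoˡ-< : ∀ {c a b} → 0ℚ < c → a < b → c * a < c * b
*-monoˡ-< {c} 0<c = ℚₚ.*-monoʳ-<-pos c {{ℚ.positive 0<c}}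

*->0 : ∀ {a b} → 0ℚ < a → 0ℚ < b → 0ℚ < a * b
*->0 {a} {b} 0<a 0<b = subst (_< a * b) (ℚₚ.*-zeroʳ a) (*-monoˡ-< 0<a 0<b)

*-cancelˡ : ∀ {c a b} → 0ℚ < c → c * a ≤ c * b → a ≤ b
*-cancelˡ {c} 0<c = ℚₚ.*-cancelˡ-≤-pos c {{ℚ.positive 0<c}}

*-cancelˡ-< : ∀ {c a b} → 0ℚ ≤ c → c * a < c * b → a < b
*-cancelˡ-< {c} 0≤c = ℚₚ.*-cancelˡ-<-nonNeg c {{nonNegative 0≤c}}

0≤1 : 0ℚ ≤ 1ℚ
0≤1 = ℚₚ.<⇒≤ (ℚₚ.positive⁻¹ 1ℚ)

0<1 : 0ℚ < 1ℚ
0<1 = ℚₚ.positive⁻¹ 1ℚ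

-- Naturals and their reciprocals as rationals

opaque
  ι : ℕ → ℚ
  ι n = (ℤ.+ n) ℚ./ 1

  inv : ℕ → ℚ
  inv zero = 0ℚ
  inv (suc n) = (ℤ.+ 1) ℚ./ suc n

  ι-0 : ι 0 ≡ 0ℚ
  ι-0 = refl

  ι-1 : ι 1 ≡ 1ℚ
  ι-1 = refl

  ι-+ : ∀ m n → ι (m ℕ.+ n) ≡ ι m + ι n
  ι-+ m n = ℚₚ.toℚᵘ-injective (ℚᵘₚ.≃-trans (ℚₚ.toℚᵘ-fromℚᵘ (ℚᵘ.mkℚᵘ (ℤ.+ (m ℕ.+ n)) 0))
    (ℚᵘₚ.≃-sym (ℚᵘₚ.≃-trans (ℚₚ.toℚᵘ-homo-+ (ι m) (ι n))
      (ℚᵘₚ.≃-trans (ℚᵘₚ.+-cong (ℚₚ.toℚᵘ-fromℚᵘ (ℚᵘ.mkℚᵘ (ℤ.+ m) 0)) (ℚₚ.toℚᵘ-fromℚᵘ (ℚᵘ.mkℚᵘ (ℤ.+ n) 0)))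
        (ℚᵘ.*≡* (cong (ℤ._* ℤ.+ 1) (cong₂ ℤ._+_ (ℤₚ.*-identityʳ (ℤ.+ m)) (ℤₚ.*-identityʳ (ℤ.+ n)))))))))

  ι-* : ∀ m n → ι (m ℕ.* n) ≡ ι m * ι n
  ι-* m n = ℚₚ.toℚᵘ-injective (ℚᵘₚ.≃-trans (ℚₚ.toℚᵘ-fromℚᵘ (ℚᵘ.mkℚᵘ (ℤ.+ (m ℕ.* n)) 0))
    (ℚᵘₚ.≃-sym (ℚᵘₚ.≃-trans (ℚₚ.toℚᵘ-homo-* (ι m) (ι n))
      (ℚᵘₚ.≃-trans (ℚᵘₚ.*-cong (ℚₚ.toℚᵘ-fromℚᵘ (ℚᵘ.mkℚᵘ (ℤ.+ m) 0)) (ℚₚ.toℚᵘ-fromℚᵘ (ℚᵘ.mkℚᵘ (ℤ.+ n) 0)))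
        (ℚᵘ.*≡* (cong (ℤ._* ℤ.+ 1) (sym (ℤₚ.pos-* m n))))))))

  ι-mono : ∀ {m n} → m ℕ.≤ n → ι m ≤ ι n
  ι-mono {m} {n} m≤n = ℚₚ.toℚᵘ-cancel-≤
    (ℚᵘₚ.≤-respˡ-≃ (ℚᵘₚ.≃-sym (ℚₚ.toℚᵘ-fromℚᵘ (ℚᵘ.mkℚᵘ (ℤ.+ m) 0)))
    (ℚᵘₚ.≤-respʳ-≃ (ℚᵘₚ.≃-sym (ℚₚ.toℚᵘ-fromℚᵘ (ℚᵘ.mkℚᵘ (ℤ.+ n) 0)))
      (ℚᵘ.*≤* (ℤₚ.*-monoʳ-≤-nonNeg (ℤ.+ 1) (ℤ.+≤+ m≤n)))))

  ι-cancel : ∀ {m n} → ι m ≤ ι n → m ℕ.≤ n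
  ι-cancel {m} {n} p with ℚᵘₚ.≤-respˡ-≃ (ℚₚ.toℚᵘ-fromℚᵘ (ℚᵘ.mkℚᵘ (ℤ.+ m) 0))
    (ℚᵘₚ.≤-respʳ-≃ (ℚₚ.toℚᵘ-fromℚᵘ (ℚᵘ.mkℚᵘ (ℤ.+ n) 0)) (ℚₚ.toℚᵘ-mono-≤ p))
  ... | ℚᵘ.*≤* q = ℤₚ.drop‿+≤+ (ℤₚ.*-cancelʳ-≤-pos (ℤ.+ m) (ℤ.+ n) (ℤ.+ 1) q)

  /-ι : ∀ m n → (ℤ.+ m) ℚ./ suc n * ι (suc n) ≡ ι m
  /-ι m n = ℚₚ.toℚᵘ-injective (ℚᵘₚ.≃-trans (ℚₚ.toℚᵘ-homo-* ((ℤ.+ m) ℚ./ suc n) (ι (suc n)))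
      (ℚᵘₚ.≃-trans (ℚᵘₚ.*-cong (ℚₚ.toℚᵘ-fromℚᵘ (ℚᵘ.mkℚᵘ (ℤ.+ m) n)) (ℚₚ.toℚᵘ-fromℚᵘ (ℚᵘ.mkℚᵘ (ℤ.+ suc n) 0)))
      (ℚᵘₚ.≃-trans (ℚᵘ.*≡* (trans (ℤₚ.*-identityʳ _) (cong (ℤ.+ m ℤ.*_) (cong (λ k → ℤ.+ suc k) (sym (ℕₚ.*-identityʳ n))))))
        (ℚᵘₚ.≃-sym (ℚₚ.toℚᵘ-fromℚᵘ (ℚᵘ.mkℚᵘ (ℤ.+ m) 0))))))

  inv-ι : ∀ n → inv (suc n) * ι (suc n) ≡ 1ℚ
  inv-ι n = /-ι 1 n

  inv-≥0 : ∀ n → 0ℚ ≤ inv n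
  inv-≥0 zero = ℚₚ.≤-refl
  inv-≥0 (suc n) = ℚₚ.nonNegative⁻¹ _ {{ℚₚ.normalize-nonNeg 1 (suc n)}}

ι-≥0 : ∀ n → 0ℚ ≤ ι n
ι-≥0 n = subst (_≤ ι n) ι-0 (ι-mono {0} {n} ℕ.z≤n)

ι-suc : ∀ n → ι (suc n) ≡ 1ℚ + ι n
ι-suc n = trans (ι-+ 1 n) (cong (_+ ι n) ι-1)

ι->0 : ∀ n → 0ℚ < ι (suc n)
ι->0 n = ℚₚ.<-≤-trans 0<1 (subst (_≤ ι (suc n)) ι-1 (ι-mono ℕ.z<s))

inv-ι′ : ∀ {n} → 0 ℕ.< n → inv n * ι n ≡ 1ℚ
inv-ι′ {suc n} _ = inv-ι n

ι-pos : ∀ {n} → 0 ℕ.< n → 0ℚ < ι n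
ι-pos {suc n} _ = ι->0 n

inv-pos : ∀ {n} → 0 ℕ.< n → 0ℚ < inv n
inv-pos {suc n} _ = *-cancelˡ-< (ℚₚ.<⇒≤ (ι->0 n)) (subst₂ _<_ (sym (ℚₚ.*-zeroʳ (ι (suc n)))) (trans (sym (inv-ι n)) (ℚₚ.*-comm (inv (suc n)) (ι (suc n)))) 0<1)

≤-*inv : ∀ {n a b} → 0 ℕ.< n → ι n * a ≤ b → a ≤ b * inv n
≤-*inv {n} {a} {b} 0<n p = *-cancelˡ (ι-pos 0<n) (subst (ι n * a ≤_)
  (trans (sym (ℚₚ.*-identityʳ b)) (trans (cong (b *_) (sym (inv-ι′ 0<n))) (solve 3 (λ b i n → b :* (i :* n) := n :* (b :* i)) refl b (inv n) (ι n)))) p)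

*inv-≤ : ∀ {n a b} → 0 ℕ.< n → a ≤ ι n * b → a * inv n ≤ b
*inv-≤ {n} {a} {b} 0<n p = *-cancelˡ (ι-pos 0<n) (subst (_≤ ι n * b)
  (trans (sym (ℚₚ.*-identityʳ a)) (trans (cong (a *_) (sym (inv-ι′ 0<n))) (solve 3 (λ b i n → b :* (i :* n) := n :* (b :* i)) refl a (inv n) (ι n)))) p)

inv-unique : ∀ {n a} → 0 ℕ.< n → a * ι n ≡ 1ℚ → a ≡ inv n
inv-unique {n} {a} 0<n p = trans (sym (ℚₚ.*-identityʳ a)) (trans (cong (a *_) (sym (inv-ι′ 0<n)))
  (trans (solve 3 (λ a i n → a :* (i :* n) := (a :* n) :* i) refl a (inv n) (ι n)) (trans (cong (_* inv n) p) (ℚₚ.*-identityˡ _))))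

inv-* : ∀ {m n} → 0 ℕ.< m → 0 ℕ.< n → inv (m ℕ.* n) ≡ inv m * inv n
inv-* {m} {n} 0<m 0<n = sym (inv-unique (ℕₚ.*-mono-< 0<m 0<n) (trans (cong ((inv m * inv n) *_) (ι-* m n))
  (trans (solve 4 (λ a b c d → (a :* b) :* (c :* d) := (a :* c) :* (b :* d)) refl (inv m) (inv n) (ι m) (ι n))
   (trans (cong₂ _*_ (inv-ι′ 0<m) (inv-ι′ 0<n)) (ℚₚ.*-identityʳ 1ℚ)))))

inv-1 : inv 1 ≡ 1ℚ
inv-1 = sym (inv-unique ℕ.z<s (trans (ℚₚ.*-identityˡ _) ι-1))

inv-anti : ∀ {m n} → 0 ℕ.< m → m ℕ.≤ n → inv n ≤ inv m
inv-anti {m} {n} 0<m m≤n = *-cancelˡ (ι-pos 0<n) (subst (_≤ ι n * inv m) (trans (inv-ι′ 0<m) (trans (sym (inv-ι′ 0<n)) (ℚₚ.*-comm (inv n) (ι n))))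
  (subst (_≤ ι n * inv m) (ℚₚ.*-comm (ι m) (inv m)) (*-monoʳ (inv-≥0 m) (ι-mono m≤n))))
  where 0<n = ℕₚ.<-≤-trans 0<m m≤n

inv-≤1 : ∀ n → inv n ≤ 1ℚ
inv-≤1 zero = subst (_≤ 1ℚ) (sym inv0) 0≤1
  where opaque
          unfolding inv
          inv0 : inv 0 ≡ 0ℚ
          inv0 = refl
inv-≤1 (suc n) = subst (inv (suc n) ≤_) inv-1 (inv-anti ℕ.z<s ℕ.z<s)

opaque
  unfolding ι
  ceil : (q : ℚ) → ∃[ n ] q ≤ ι n
  ceil q@(mkℚ n d _) = ℤ.∣ n ∣ , ℚₚ.toℚᵘ-cancel-≤ (ℚᵘₚ.≤-respʳ-≃ (ℚᵘₚ.≃-sym (ℚₚ.toℚᵘ-fromℚᵘ (ℚᵘ.mkℚᵘ (ℤ.+ ℤ.∣ n ∣) 0)))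
      (ℚᵘ.*≤* (ℤₚ.≤-trans (ℤₚ.≤-reflexive (ℤₚ.*-identityʳ n)) (ℤₚ.≤-trans (i≤∣i∣ n)
        (subst (ℤ._≤ ℤ.+ ℤ.∣ n ∣ ℤ.* ℤ.+ suc d) (ℤₚ.*-identityʳ _) (ℤₚ.*-monoˡ-≤-nonNeg (ℤ.+ ℤ.∣ n ∣) (ℤ.+≤+ ℕ.z<s)))))))
      where
      i≤∣i∣ : ∀ i → i ℤ.≤ ℤ.+ ℤ.∣ i ∣
      i≤∣i∣ (ℤ.+ n) = ℤₚ.≤-refl
      i≤∣i∣ (ℤ.-[1+ n ]) = ℤ.-≤+

recip : (ε : ℚ) → 0ℚ < ε → ∃[ n ] (0 ℕ.< n × 1ℚ ≤ ι n * ε)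
recip ε 0<ε with ceil (ℚ.1/_ ε {{ℚ.>-nonZero 0<ε}})
... | n , p = suc n , ℕ.s≤s ℕ.z≤n , ℚₚ.≤-trans (subst (_≤ ι n * ε) (ℚₚ.*-inverseˡ ε {{ℚ.>-nonZero 0<ε}}) (*-monoʳ (ℚₚ.<⇒≤ 0<ε) p))
   (*-monoʳ (ℚₚ.<⇒≤ 0<ε) (ι-mono (ℕₚ.n≤1+n n)))

-- Finite sums

∑ : ℕ → (ℕ → ℚ) → ℚ
∑ zero f = 0ℚ
∑ (suc n) f = ∑ n f + f n

∑-cong : ∀ n {f g : ℕ → ℚ} → (∀ i → i ℕ.< n → f i ≡ g i) → ∑ n f ≡ ∑ n g
∑-cong zero eq = refl
∑-cong (suc n) eq = cong₂ _+_ (∑-cong n λ i i<n → eq i (ℕₚ.m<n⇒m<1+n i<n)) (eq n ℕₚ.≤-refl)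

∑-mono : ∀ n {f g : ℕ → ℚ} → (∀ i → i ℕ.< n → f i ≤ g i) → ∑ n f ≤ ∑ n g
∑-mono zero le = ℚₚ.≤-refl
∑-mono (suc n) le = ℚₚ.+-mono-≤ (∑-mono n λ i i<n → le i (ℕₚ.m<n⇒m<1+n i<n)) (le n ℕₚ.≤-refl)

∑-0 : ∀ n → ∑ n (λ _ → 0ℚ) ≡ 0ℚ
∑-0 zero = refl
∑-0 (suc n) = trans (ℚₚ.+-identityʳ _) (∑-0 n)

∑-≥0 : ∀ n {f : ℕ → ℚ} → (∀ i → i ℕ.< n → 0ℚ ≤ f i) → 0ℚ ≤ ∑ n f
∑-≥0 n {f} p = subst (_≤ ∑ n f) (∑-0 n) (∑-mono n p)

∑-+ : ∀ n (f g : ℕ → ℚ) → ∑ n (λ i → f i + g i) ≡ ∑ n f + ∑ n g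
∑-+ zero f g = refl
∑-+ (suc n) f g = trans (cong (_+ (f n + g n)) (∑-+ n f g))
  (solve 4 (λ a b c d → (a :+ b) :+ (c :+ d) := (a :+ c) :+ (b :+ d)) refl (∑ n f) (∑ n g) (f n) (g n))

∑-*ˡ : ∀ n c (f : ℕ → ℚ) → ∑ n (λ i → c * f i) ≡ c * ∑ n f
∑-*ˡ zero c f = sym (ℚₚ.*-zeroʳ c)
∑-*ˡ (suc n) c f = trans (cong (_+ c * f n) (∑-*ˡ n c f)) (sym (ℚₚ.*-distribˡ-+ c (∑ n f) (f n)))

∑-*ʳ : ∀ n c (f : ℕ → ℚ) → ∑ n (λ i → f i * c) ≡ ∑ n f * c
∑-*ʳ n c f = trans (∑-cong n λ i _ → ℚₚ.*-comm (f i) c) (trans (∑-*ˡ n c f) (ℚₚ.*-comm c _))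

∑-const : ∀ n c → ∑ n (λ _ → c) ≡ ι n * c
∑-const zero c = sym (trans (cong (_* c) ι-0) (ℚₚ.*-zeroˡ c))
∑-const (suc n) c = trans (cong (_+ c) (∑-const n c)) (sym (trans (cong (_* c) (ι-suc n))
  (solve 2 (λ n c → (con 1ℚ :+ n) :* c := n :* c :+ c) refl (ι n) c)))

∑-swap : ∀ m n (f : ℕ → ℕ → ℚ) → ∑ m (λ i → ∑ n (f i)) ≡ ∑ n (λ j → ∑ m (λ i → f i j))
∑-swap zero n f = sym (∑-0 n)
∑-swap (suc m) n f = trans (cong (_+ ∑ n (f m)) (∑-swap m n f)) (sym (∑-+ n (λ j → ∑ m (λ i → f i j)) (f m)))

∑-split : ∀ m n (f : ℕ → ℚ) → ∑ (m ℕ.+ n) f ≡ ∑ m f + ∑ n (λ i → f (m ℕ.+ i))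
∑-split m zero f = trans (cong (λ k → ∑ k f) (ℕₚ.+-identityʳ m)) (sym (ℚₚ.+-identityʳ _))
∑-split m (suc n) f = trans (cong (λ k → ∑ k f) (ℕₚ.+-suc m n)) (trans (cong (_+ f (m ℕ.+ n)) (∑-split m n f)) (ℚₚ.+-assoc (∑ m f) _ _))

∑-first : ∀ n (f : ℕ → ℚ) → ∑ (suc n) f ≡ f 0 + ∑ n (f ∘ suc)
∑-first n f = trans (∑-split 1 n f) (cong (_+ ∑ n (f ∘ suc)) (ℚₚ.+-identityˡ (f 0)))

∑-block : ∀ m n (f : ℕ → ℚ) → ∑ (m ℕ.* n) f ≡ ∑ m (λ j → ∑ n (λ i → f (j ℕ.* n ℕ.+ i)))
∑-block zero n f = refl
∑-block (suc m) n f = trans (cong (λ k → ∑ k f) (ℕₚ.+-comm n (m ℕ.* n)))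
  (trans (∑-split (m ℕ.* n) n f) (cong (_+ ∑ n (λ i → f (m ℕ.* n ℕ.+ i))) (∑-block m n f)))

∑-extend : ∀ {m n} {f : ℕ → ℚ} → m ℕ.≤ n → (∀ i → 0ℚ ≤ f i) → ∑ m f ≤ ∑ n f
∑-extend {m} {n} {f} m≤n f≥0 = subst (λ k → ∑ m f ≤ ∑ k f) (ℕₚ.m+[n∸m]≡n m≤n)
  (≤-diff (∑ (n ℕ.∸ m) (λ i → f (m ℕ.+ i))) (∑-≥0 (n ℕ.∸ m) (λ i _ → f≥0 _)) (sym (∑-split m (n ℕ.∸ m) f)))

∑-zero : ∀ n {f : ℕ → ℚ} → (∀ i → i ℕ.< n → f i ≡ 0ℚ) → ∑ n f ≡ 0ℚ
∑-zero n p = trans (∑-cong n p) (∑-0 n)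

∑-extend≡ : ∀ {m n} {f : ℕ → ℚ} → m ℕ.≤ n → (∀ i → m ℕ.≤ i → f i ≡ 0ℚ) → ∑ m f ≡ ∑ n f
∑-extend≡ {m} {n} {f} m≤n z = trans (sym (ℚₚ.+-identityʳ _)) (trans (cong (∑ m f +_) (sym (∑-zero (n ℕ.∸ m) (λ i _ → z _ (ℕₚ.m≤m+n m i)))))
  (trans (sym (∑-split m (n ℕ.∸ m) f)) (cong (λ k → ∑ k f) (ℕₚ.m+[n∸m]≡n m≤n))))

∑-single : ∀ n {f : ℕ → ℚ} k → k ℕ.< n → (∀ i → i ℕ.< n → i ≢ k → f i ≡ 0ℚ) → ∑ n f ≡ f k
∑-single (suc n) {f} k k<n z with k ℕₚ.≟ n
... | yes refl = trans (cong (_+ f n) (∑-zero n λ i i<n → z i (ℕₚ.m<n⇒m<1+n i<n) (ℕₚ.<⇒≢ i<n))) (ℚₚ.+-identityˡ (f n))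
... | no k≢n = trans (cong₂ _+_ (∑-single n k (ℕₚ.≤∧≢⇒< (ℕₚ.≤-pred k<n) k≢n) λ i i<n → z i (ℕₚ.m<n⇒m<1+n i<n)) (z n ℕₚ.≤-refl (k≢n ∘ sym))) (ℚₚ.+-identityʳ (f k))

-- Indicators and rearrangement of sums

𝟙 : ∀ {P : Set} → Dec P → ℚ
𝟙 (yes _) = 1ℚ
𝟙 (no _) = 0ℚ

𝟙-≥0 : ∀ {P : Set} → (d : Dec P) → 0ℚ ≤ 𝟙 d
𝟙-≥0 (yes _) = 0≤1
𝟙-≥0 (no _) = ℚₚ.≤-refl

𝟙-≤1 : ∀ {P : Set} → (d : Dec P) → 𝟙 d ≤ 1ℚ
𝟙-≤1 (yes _) = ℚₚ.≤-refl
𝟙-≤1 (no _) = 0≤1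

𝟙-yes : ∀ {P : Set} → (d : Dec P) → P → 𝟙 d ≡ 1ℚ
𝟙-yes (yes _) p = refl
𝟙-yes (no ¬p) p = ⊥-elim (¬p p)

𝟙-no : ∀ {P : Set} → (d : Dec P) → ¬ P → 𝟙 d ≡ 0ℚ
𝟙-no (yes p) ¬p = ⊥-elim (¬p p)
𝟙-no (no _) ¬p = refl

𝟙-mono : ∀ {P Q : Set} → (d : Dec P) (e : Dec Q) → (P → Q) → 𝟙 d ≤ 𝟙 e
𝟙-mono (yes p) e f = ℚₚ.≤-reflexive (sym (𝟙-yes e (f p)))
𝟙-mono (no _) e f = 𝟙-≥0 e

𝟙-cong : ∀ {P Q : Set} → (d : Dec P) (e : Dec Q) → (P → Q) → (Q → P) → 𝟙 d ≡ 𝟙 e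
𝟙-cong d e f g = ℚₚ.≤-antisym (𝟙-mono d e f) (𝟙-mono e d g)

𝟙-⊎ : ∀ {P Q R : Set} → (d : Dec P) (e : Dec Q) (f : Dec R) → (P → Q ⊎ R) → 𝟙 d ≤ 𝟙 e + 𝟙 f
𝟙-⊎ (no _) e f h = +-≥0 (𝟙-≥0 e) (𝟙-≥0 f)
𝟙-⊎ (yes p) e f h with h p
... | inj₁ q = subst₂ _≤_ (ℚₚ.+-identityʳ 1ℚ) (cong (_+ 𝟙 f) (sym (𝟙-yes e q))) (ℚₚ.+-monoʳ-≤ 1ℚ (𝟙-≥0 f))
... | inj₂ r = subst₂ _≤_ (ℚₚ.+-identityˡ 1ℚ) (cong (𝟙 e +_) (sym (𝟙-yes f r))) (ℚₚ.+-monoˡ-≤ 1ℚ (𝟙-≥0 e))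

𝟙-≤ : ∀ {P : Set} → (d : Dec P) {a : ℚ} → 0ℚ ≤ a → (P → 1ℚ ≤ a) → 𝟙 d ≤ a
𝟙-≤ (yes p) _ h = h p
𝟙-≤ (no _) 0≤a _ = 0≤a

∑-atMostOne : ∀ n {P : ℕ → Set} (P? : ∀ i → Dec (P i)) → (∀ i j → i ℕ.< n → j ℕ.< n → P i → P j → i ≡ j) → ∑ n (λ i → 𝟙 (P? i)) ≤ 1ℚ
∑-atMostOne zero P? u = 0≤1
∑-atMostOne (suc n) {P} P? u with P? n
... | no _ = subst (_≤ 1ℚ) (sym (ℚₚ.+-identityʳ _)) (∑-atMostOne n P? λ i j i<n j<n → u i j (ℕₚ.m<n⇒m<1+n i<n) (ℕₚ.m<n⇒m<1+n j<n))
... | yes pn = ℚₚ.≤-reflexive (trans (cong (_+ 1ℚ) (∑-zero n λ i i<n → 𝟙-no (P? i) λ pi → ℕₚ.<⇒≢ i<n (u i n (ℕₚ.m<n⇒m<1+n i<n) ℕₚ.≤-refl pi pn))) (ℚₚ.+-identityˡ 1ℚ))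

∑-𝟙≡ : ∀ n k (f : ℕ → ℚ) → k ℕ.< n → ∑ n (λ j → 𝟙 (k ℕₚ.≟ j) * f j) ≡ f k
∑-𝟙≡ n k f k<n = trans (∑-single n k k<n λ i _ i≢k → trans (cong (_* f i) (𝟙-no (k ℕₚ.≟ i) (i≢k ∘ sym))) (ℚₚ.*-zeroˡ (f i)))
  (trans (cong (_* f k) (𝟙-yes (k ℕₚ.≟ k) refl)) (ℚₚ.*-identityˡ (f k)))

-- Write g (φ i) as the sum over j of [φ i = j] g j and exchange the sums: each j is hit at most
-- once.
∑-inj-≤ : ∀ n (φ : ℕ → ℕ) → (∀ i → i ℕ.< n → φ i ℕ.< n) → (∀ i j → i ℕ.< n → j ℕ.< n → φ i ≡ φ j → i ≡ j) →
  (g : ℕ → ℚ) → (∀ i → 0ℚ ≤ g i) → ∑ n (g ∘ φ) ≤ ∑ n g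
∑-inj-≤ n φ bd inj g g≥0 = begin
  ∑ n (g ∘ φ) ≡⟨ ∑-cong n (λ i i<n → sym (∑-𝟙≡ n (φ i) g (bd i i<n))) ⟩
  ∑ n (λ i → ∑ n (λ j → 𝟙 (φ i ℕₚ.≟ j) * g j)) ≡⟨ ∑-swap n n _ ⟩
  ∑ n (λ j → ∑ n (λ i → 𝟙 (φ i ℕₚ.≟ j) * g j)) ≡⟨ ∑-cong n (λ j _ → ∑-*ʳ n (g j) _) ⟩
  ∑ n (λ j → ∑ n (λ i → 𝟙 (φ i ℕₚ.≟ j)) * g j) ≤⟨ ∑-mono n (λ j _ → *-monoʳ (g≥0 j) (∑-atMostOne n (λ i → φ i ℕₚ.≟ j) λ i i′ i< i′< p q → inj i i′ i< i′< (trans p (sym q)))) ⟩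
  ∑ n (λ j → 1ℚ * g j) ≡⟨ ∑-cong n (λ j _ → ℚₚ.*-identityˡ (g j)) ⟩
  ∑ n g ∎
  where open ℚₚ.≤-Reasoning

∑-neg : ∀ n (f : ℕ → ℚ) → ∑ n (λ i → 1ℚ - f i) ≡ ι n - ∑ n f
∑-neg n f = trans (∑-+ n (λ _ → 1ℚ) (λ i → - f i)) (cong₂ _+_ (trans (∑-const n 1ℚ) (ℚₚ.*-identityʳ (ι n)))
  (trans (∑-cong n λ i _ → solve 1 (λ x → :- x := con (- 1ℚ) :* x) refl (f i)) (trans (∑-*ˡ n (- 1ℚ) f) (solve 1 (λ x → con (- 1ℚ) :* x := :- x) refl (∑ n f)))))

-- The reverse inequality is `∑-inj-≤` for 1 - g, so surjectivity of φ never has to be shown.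
∑-inj-≡ : ∀ n (φ : ℕ → ℕ) → (∀ i → i ℕ.< n → φ i ℕ.< n) → (∀ i j → i ℕ.< n → j ℕ.< n → φ i ≡ φ j → i ≡ j) →
  (g : ℕ → ℚ) → (∀ i → 0ℚ ≤ g i) → (∀ i → g i ≤ 1ℚ) → ∑ n (g ∘ φ) ≡ ∑ n g
∑-inj-≡ n φ bd inj g g≥0 g≤1 = ℚₚ.≤-antisym (∑-inj-≤ n φ bd inj g g≥0)
  (≤-diff _ (diff-≥0 (∑-inj-≤ n φ bd inj (λ i → 1ℚ - g i) (λ i → diff-≥0 (g≤1 i))))
   (trans (cong (∑ n g +_) (cong₂ _-_ (∑-neg n g) (∑-neg n (g ∘ φ))))
     (solve 3 (λ a b c → a :+ ((b :- a) :- (b :- c)) := c) refl (∑ n g) (ι n) (∑ n (g ∘ φ)))))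

-- Multiples in arithmetic progressions

coprime-cancel : ∀ {e} β {i j} → Coprime e β → i ℕ.≤ j → j ℕ.< e → e ∣ β ℕ.* (j ℕ.∸ i) → i ≡ j
coprime-cancel {e} β {i} {j} cop i≤j j<e d with j ℕ.∸ i in eq
... | zero = ℕₚ.≤-antisym i≤j (ℕₚ.m∸n≡0⇒m≤n eq)
... | suc k = ⊥-elim (ℕₚ.<⇒≱ j<e (ℕₚ.≤-trans (∣⇒≤ (coprime-divisor cop d)) (subst (ℕ._≤ j) eq (ℕₚ.m∸n≤m j i))))

-- The summands s e and t e express a congruence mod e without subtraction.
progression-∣ : ∀ {e} α β {i j} → i ℕ.≤ j → ∀ s t → α ℕ.+ β ℕ.* i ℕ.+ s ℕ.* e ≡ α ℕ.+ β ℕ.* j ℕ.+ t ℕ.* e → e ∣ β ℕ.* (j ℕ.∸ i)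
progression-∣ {e} α β {i} {j} i≤j s t eq = ∣m+n∣m⇒∣n (subst (e ∣_) (trans eq′ (ℕₚ.+-comm _ (t ℕ.* e))) (n∣m*n s)) (n∣m*n t)
  where
  eq′ : s ℕ.* e ≡ β ℕ.* (j ℕ.∸ i) ℕ.+ t ℕ.* e
  eq′ = ℕₚ.+-cancelˡ-≡ (α ℕ.+ β ℕ.* i) _ _ (trans eq (trans (cong (λ k → α ℕ.+ β ℕ.* k ℕ.+ t ℕ.* e) (sym (ℕₚ.m+[n∸m]≡n i≤j)))
    (solveℕ 5 (λ a b i d t → a ⊕ b ⊗ (i ⊕ d) ⊕ t ≐ (a ⊕ b ⊗ i) ⊕ (b ⊗ d ⊕ t)) refl α β i (j ℕ.∸ i) (t ℕ.* e))))

progression-inj : ∀ {e} α β {i j} → Coprime e β → i ℕ.< e → j ℕ.< e → ∀ s t → α ℕ.+ β ℕ.* i ℕ.+ s ℕ.* e ≡ α ℕ.+ β ℕ.* j ℕ.+ t ℕ.* e → i ≡ j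
progression-inj {e} α β {i} {j} cop i<e j<e s t eq with ℕₚ.≤-total i j
... | inj₁ i≤j = coprime-cancel β cop i≤j j<e (progression-∣ α β i≤j s t eq)
... | inj₂ j≤i = sym (coprime-cancel β cop j≤i i<e (progression-∣ α β j≤i t s (sym eq)))

-- For β prime to e, i ↦ (α + β i) mod e is injective on the residues, so the sum counts the
-- multiples of e below e, and 0 is the only one.
∑-residue : ∀ e → 0 ℕ.< e → ∀ α β → Coprime e β → ∑ e (λ i → 𝟙 (e ∣? α ℕ.+ β ℕ.* i)) ≡ 1ℚ
∑-residue e@(suc e′) _ α β cop = begin
  ∑ e (λ i → 𝟙 (e ∣? α ℕ.+ β ℕ.* i)) ≡⟨ ∑-cong e (λ i _ → 𝟙-cong (e ∣? _) (e ∣? φ i)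
       (λ d → subst (e ∣_) (sym (n∣m⇒m%n≡0 _ e d)) (e ∣0))
       (λ d → subst (e ∣_) (sym (m≡m%n+[m/n]*n (α ℕ.+ β ℕ.* i) e)) (∣m∣n⇒∣m+n d (n∣m*n ((α ℕ.+ β ℕ.* i) / e))))) ⟩
  ∑ e ((λ j → 𝟙 (e ∣? j)) ∘ φ) ≡⟨ ∑-inj-≡ e φ (λ i _ → m%n<n (α ℕ.+ β ℕ.* i) e) inj (λ j → 𝟙 (e ∣? j)) (λ j → 𝟙-≥0 (e ∣? j)) (λ j → 𝟙-≤1 (e ∣? j)) ⟩
  ∑ e (λ j → 𝟙 (e ∣? j)) ≡⟨ ∑-single e 0 ℕ.z<s (λ { zero _ z → ⊥-elim (z refl) ; (suc i) i<e _ → 𝟙-no (e ∣? suc i) λ d → ℕₚ.<⇒≱ i<e (∣⇒≤ d) }) ⟩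
  𝟙 (e ∣? 0) ≡⟨ 𝟙-yes (e ∣? 0) (e ∣0) ⟩
  1ℚ ∎
  where
  open ≡-Reasoning
  φ : ℕ → ℕ
  φ i = (α ℕ.+ β ℕ.* i) % e
  inj : ∀ i j → i ℕ.< e → j ℕ.< e → φ i ≡ φ j → i ≡ j
  inj i j i<e j<e eq = progression-inj α β cop i<e j<e (Y / e) (X / e) (begin
      X ℕ.+ (Y / e) ℕ.* e ≡⟨ cong (ℕ._+ (Y / e) ℕ.* e) (m≡m%n+[m/n]*n X e) ⟩
      X % e ℕ.+ (X / e) ℕ.* e ℕ.+ (Y / e) ℕ.* e ≡⟨ cong (λ r → r ℕ.+ (X / e) ℕ.* e ℕ.+ (Y / e) ℕ.* e) eq ⟩
      Y % e ℕ.+ (X / e) ℕ.* e ℕ.+ (Y / e) ℕ.* e ≡⟨ ℕₚ.+-assoc (Y % e) _ _ ⟩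
      Y % e ℕ.+ ((X / e) ℕ.* e ℕ.+ (Y / e) ℕ.* e) ≡⟨ cong (Y % e ℕ.+_) (ℕₚ.+-comm ((X / e) ℕ.* e) _) ⟩
      Y % e ℕ.+ ((Y / e) ℕ.* e ℕ.+ (X / e) ℕ.* e) ≡⟨ sym (ℕₚ.+-assoc (Y % e) _ _) ⟩
      Y % e ℕ.+ (Y / e) ℕ.* e ℕ.+ (X / e) ℕ.* e ≡⟨ cong (ℕ._+ (X / e) ℕ.* e) (sym (m≡m%n+[m/n]*n Y e)) ⟩
      Y ℕ.+ (X / e) ℕ.* e ∎)
    where X = α ℕ.+ β ℕ.* i
          Y = α ℕ.+ β ℕ.* j

blocks : ∀ x n → 0 ℕ.< n → ∃[ y ] (x ℕ.≤ y ℕ.* n × ι y ≤ ι x * inv n + 1ℚ)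
blocks x n@(suc n′) 0<n = suc (x / n) ,
  ℕₚ.≤-trans (ℕₚ.≤-reflexive (m≡m%n+[m/n]*n x n)) (ℕₚ.+-monoˡ-≤ ((x / n) ℕ.* n) (ℕₚ.<⇒≤ (m%n<n x n))) ,
  subst (_≤ ι x * inv n + 1ℚ) (trans (ℚₚ.+-comm (ι (x / n)) 1ℚ) (sym (ι-suc (x / n)))) (ℚₚ.+-monoˡ-≤ 1ℚ
    (≤-*inv 0<n (subst (_≤ ι x) (trans (ι-* (x / n) n) (ℚₚ.*-comm (ι (x / n)) (ι n))) (ι-mono (m/n*n≤m x n)))))

count-multiples : ∀ e → 0 ℕ.< e → ∀ α β → Coprime e β → ∀ x → ∑ x (λ j → 𝟙 (e ∣? α ℕ.+ β ℕ.* j)) ≤ ι x * inv e + 1ℚ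
count-multiples e 0<e α β cop x with blocks x e 0<e
... | y , x≤ , y≤ = begin
  ∑ x f ≤⟨ ∑-extend x≤ (λ j → 𝟙-≥0 (e ∣? α ℕ.+ β ℕ.* j)) ⟩
  ∑ (y ℕ.* e) f ≡⟨ ∑-block y e f ⟩
  ∑ y (λ a → ∑ e (λ i → f (a ℕ.* e ℕ.+ i))) ≡⟨ ∑-cong y (λ a _ → trans (∑-cong e λ i _ → cong (λ k → 𝟙 (e ∣? k))
      (solveℕ 4 (λ α β c i → α ⊕ β ⊗ (c ⊕ i) ≐ (α ⊕ β ⊗ c) ⊕ β ⊗ i) refl α β (a ℕ.* e) i))
      (∑-residue e 0<e (α ℕ.+ β ℕ.* (a ℕ.* e)) β cop)) ⟩
  ∑ y (λ _ → 1ℚ) ≡⟨ trans (∑-const y 1ℚ) (ℚₚ.*-identityʳ (ι y)) ⟩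
  ι y ≤⟨ y≤ ⟩
  ι x * inv e + 1ℚ ∎
  where
  open ℚₚ.≤-Reasoning
  f = λ j → 𝟙 (e ∣? α ℕ.+ β ℕ.* j)

-- Upper averages

-- limsup ∑ x g / x ≤ q, with a bounded error for each slope q + ε.
record UAvg (g : ℕ → ℚ) (q : ℚ) : Set where
  field
    bound : ∀ ε → 0ℚ < ε → ∃[ C ] (∀ x → ∑ x g ≤ (q + ε) * ι x + C)
open UAvg

uavg-mono : ∀ {f g q} → (∀ i → f i ≤ g i) → UAvg g q → UAvg f q
uavg-mono f≤g u .bound ε 0<ε with u .bound ε 0<ε
... | C , p = C , λ x → ℚₚ.≤-trans (∑-mono x λ i _ → f≤g i) (p x)

uavg-≤ : ∀ {f q r} → q ≤ r → UAvg f q → UAvg f r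
uavg-≤ q≤r u .bound ε 0<ε with u .bound ε 0<ε
... | C , p = C , λ x → ℚₚ.≤-trans (p x) (ℚₚ.+-monoˡ-≤ C (*-monoʳ (ι-≥0 x) (ℚₚ.+-monoˡ-≤ ε q≤r)))

½ : ℚ
½ = inv 2

0<½ : 0ℚ < ½
0<½ = inv-pos ℕ.z<s

½+½ : ½ + ½ ≡ 1ℚ
½+½ = trans (solve 1 (λ h → h :+ h := h :* (con 1ℚ :+ con 1ℚ)) refl ½)
  (trans (cong (½ *_) (sym (trans (ι-suc 1) (cong (1ℚ +_) ι-1)))) (inv-ι 1))

uavg-+ : ∀ {f g q r} → UAvg f q → UAvg g r → UAvg (λ i → f i + g i) (q + r)
uavg-+ {f} {g} {q} {r} u v .bound ε 0<ε with u .bound (½ * ε) (*->0 0<½ 0<ε) | v .bound (½ * ε) (*->0 0<½ 0<ε)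
... | C , p | D , p′ = C + D , λ x → subst₂ _≤_ (sym (∑-+ x f g))
  (trans (solve 6 (λ q r he X C D → ((q :+ he) :* X :+ C) :+ ((r :+ he) :* X :+ D) := ((q :+ r) :+ (he :+ he)) :* X :+ (C :+ D)) refl q r (½ * ε) (ι x) C D)
    (cong (λ h → ((q + r) + h) * ι x + (C + D)) (trans (sym (ℚₚ.*-distribʳ-+ ε ½ ½)) (trans (cong (_* ε) ½+½) (ℚₚ.*-identityˡ ε)))))
  (ℚₚ.+-mono-≤ (p x) (p′ x))

uavg-0 : UAvg (λ _ → 0ℚ) 0ℚ
uavg-0 .bound ε 0<ε = 0ℚ , λ x → subst (_≤ (0ℚ + ε) * ι x + 0ℚ) (sym (∑-0 x))
  (+-≥0 (*-≥0 (ℚₚ.≤-trans (ℚₚ.<⇒≤ 0<ε) (ℚₚ.≤-reflexive (sym (ℚₚ.+-identityˡ ε)))) (ι-≥0 x)) ℚₚ.≤-refl)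

uavg-∑ : ∀ n {f : ℕ → ℕ → ℚ} {q : ℕ → ℚ} → (∀ i → i ℕ.< n → UAvg (f i) (q i)) → UAvg (λ j → ∑ n (λ i → f i j)) (∑ n q)
uavg-∑ zero p = uavg-0
uavg-∑ (suc n) p = uavg-+ (uavg-∑ n λ i i<n → p i (ℕₚ.m<n⇒m<1+n i<n)) (p n ℕₚ.≤-refl)

uavg-bounded : ∀ {f q} C → (∀ x → ∑ x f ≤ q * ι x + C) → UAvg f q
uavg-bounded {f} {q} C p .bound ε 0<ε = C , λ x → ℚₚ.≤-trans (p x)
  (≤-diff (ε * ι x) (*-≥0 (ℚₚ.<⇒≤ 0<ε) (ι-≥0 x)) (solve 4 (λ q e X C → (q :* X :+ C) :+ e :* X := (q :+ e) :* X :+ C) refl q ε (ι x) C))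

uavg-1 : ∀ {f} → (∀ i → f i ≤ 1ℚ) → UAvg f 1ℚ
uavg-1 f≤1 = uavg-bounded 0ℚ λ x → ℚₚ.≤-trans (∑-mono x λ i _ → f≤1 i)
  (ℚₚ.≤-reflexive (trans (∑-const x 1ℚ) (solve 1 (λ X → X :* con 1ℚ := con 1ℚ :* X :+ con 0ℚ) refl (ι x))))

uavg-scale : ∀ {f q} c → 0ℚ ≤ c → UAvg f q → UAvg (λ i → c * f i) (c * q)
uavg-scale {f} {q} c 0≤c u .bound ε 0<ε with ceil c
-- Dividing the slack by suc n ≥ c instead of by c covers c = 0 as well.
... | n , c≤n with u .bound (ε * inv (suc n)) (*->0 0<ε (inv-pos ℕ.z<s))
... | C , p = c * C , λ x → begin
  ∑ x (λ i → c * f i) ≡⟨ ∑-*ˡ x c f ⟩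
  c * ∑ x f ≤⟨ *-monoˡ 0≤c (p x) ⟩
  c * ((q + ε * inv (suc n)) * ι x + C) ≡⟨ solve 5 (λ c q e X C → c :* ((q :+ e) :* X :+ C) := (c :* q :+ c :* e) :* X :+ c :* C) refl c q (ε * inv (suc n)) (ι x) C ⟩
  (c * q + c * (ε * inv (suc n))) * ι x + c * C ≤⟨ ℚₚ.+-monoˡ-≤ (c * C) (*-monoʳ (ι-≥0 x) (ℚₚ.+-monoʳ-≤ (c * q)
     (subst (_≤ ε) (ℚₚ.*-assoc c ε (inv (suc n))) (*inv-≤ ℕ.z<s (*-monoʳ (ℚₚ.<⇒≤ 0<ε) (ℚₚ.≤-trans c≤n (ι-mono (ℕₚ.n≤1+n n)))))))) ⟩
  (c * q + ε) * ι x + c * C ∎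
  where open ℚₚ.≤-Reasoning

uavg-finite : ∀ {f} K → (∀ i → f i ≤ 1ℚ) → (∀ i → K ℕ.≤ i → f i ≤ 0ℚ) → UAvg f 0ℚ
uavg-finite {f} K f≤1 z = uavg-bounded (ι K) λ x → subst (∑ x f ≤_) (solve 2 (λ X K → K := con 0ℚ :* X :+ K) refl (ι x) (ι K)) (go x)
  where
  go : ∀ x → ∑ x f ≤ ι K
  go x with ℕₚ.≤-total x K
  ... | inj₁ x≤K = ℚₚ.≤-trans (∑-mono x λ i _ → f≤1 i) (subst (_≤ ι K) (sym (trans (∑-const x 1ℚ) (ℚₚ.*-identityʳ (ι x)))) (ι-mono x≤K))
  ... | inj₂ K≤x = subst (λ y → ∑ y f ≤ ι K) (ℕₚ.m+[n∸m]≡n K≤x) (subst (_≤ ι K) (sym (∑-split K (x ℕ.∸ K) f))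
    (subst (∑ K f + ∑ (x ℕ.∸ K) (λ i → f (K ℕ.+ i)) ≤_) (ℚₚ.+-identityʳ (ι K)) (ℚₚ.+-mono-≤ (go′ K ℕₚ.≤-refl)
      (ℚₚ.≤-trans (∑-mono (x ℕ.∸ K) λ i _ → z (K ℕ.+ i) (ℕₚ.m≤m+n K i)) (ℚₚ.≤-reflexive (∑-0 (x ℕ.∸ K)))))))
    where
    go′ : ∀ x → x ℕ.≤ K → ∑ x f ≤ ι K
    go′ x x≤K = ℚₚ.≤-trans (∑-mono x λ i _ → f≤1 i) (subst (_≤ ι K) (sym (trans (∑-const x 1ℚ) (ℚₚ.*-identityʳ (ι x)))) (ι-mono x≤K))


-- Total probability over the residues mod N. A residue class has only about x/N members up to x, so
-- the N classes together may use the slack ε N.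
uavg-split : ∀ N → 0 ℕ.< N → ∀ {g} (w : ℕ → ℚ) → (∀ j → 0ℚ ≤ g j) → (∀ i → 0ℚ ≤ w i) →
  (∀ i → i ℕ.< N → UAvg (λ j → g (j ℕ.* N ℕ.+ i)) (w i)) → UAvg g (∑ N w * inv N)
uavg-split N 0<N {g} w g≥0 w≥0 u .bound ε 0<ε with uavg-∑ N u .bound (ε * ι N) (*->0 0<ε (ι-pos 0<N))
... | C , p = (W + ε * ι N) + C , go
  where
  W = ∑ N w
  go : ∀ x → ∑ x g ≤ (W * inv N + ε) * ι x + ((W + ε * ι N) + C)
  go x with blocks x N 0<N
  ... | y , x≤ , y≤ = begin
    ∑ x g ≤⟨ ∑-extend x≤ g≥0 ⟩
    ∑ (y ℕ.* N) g ≡⟨ ∑-block y N g ⟩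
    ∑ y (λ j → ∑ N (λ i → g (j ℕ.* N ℕ.+ i))) ≤⟨ p y ⟩
    (W + ε * ι N) * ι y + C ≤⟨ ℚₚ.+-monoˡ-≤ C (*-monoˡ (+-≥0 (∑-≥0 N λ i _ → w≥0 i) (*-≥0 (ℚₚ.<⇒≤ 0<ε) (ι-≥0 N))) y≤) ⟩
    (W + ε * ι N) * (ι x * inv N + 1ℚ) + C ≡⟨ solve 6 (λ W e n X i C → (W :+ e :* n) :* (X :* i :+ con 1ℚ) :+ C := (W :* i :+ e :* (i :* n)) :* X :+ ((W :+ e :* n) :+ C)) refl W ε (ι N) (ι x) (inv N) C ⟩
    (W * inv N + ε * (inv N * ι N)) * ι x + ((W + ε * ι N) + C) ≡⟨ cong (λ k → (W * inv N + k) * ι x + ((W + ε * ι N) + C)) (trans (cong (ε *_) (inv-ι′ 0<N)) (ℚₚ.*-identityʳ ε)) ⟩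
    (W * inv N + ε) * ι x + ((W + ε * ι N) + C) ∎
    where open ℚₚ.≤-Reasoning

-- Primes and coprimality

prime>0 : ∀ {p} → Prime p → 0 ℕ.< p
prime>0 {p} pp = ℕ.>-nonZero⁻¹ p {{prime⇒nonZero pp}}

prime>1 : ∀ {p} → Prime p → 1 ℕ.< p
prime>1 {p} pp = ℕ.nonTrivial⇒n>1 p {{prime⇒nonTrivial pp}}

coprime-* : ∀ {e m n} → Coprime e m → Coprime e n → Coprime e (m ℕ.* n)
coprime-* cm cn {d} (d∣e , d∣mn) = cn (d∣e , coprime-divisor (λ (a , b) → cm (∣-trans a d∣e , b)) d∣mn)

coprime-∣ʳ : ∀ {e m n} → n ∣ m → Coprime e m → Coprime e n
coprime-∣ʳ n∣m c (a , b) = c (a , ∣-trans b n∣m)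

coprime-∣ˡ : ∀ {e m n} → n ∣ e → Coprime e m → Coprime n m
coprime-∣ˡ n∣e c (a , b) = c (∣-trans a n∣e , b)

prime-coprime : ∀ {p e} → Prime p → ¬ p ∣ e → Coprime e p
prime-coprime pp p∤e (d∣e , d∣p) with prime⇒irreducible pp d∣p
... | inj₁ d≡1 = d≡1
... | inj₂ refl = ⊥-elim (p∤e d∣e)

prime-¬coprime : ∀ {p e} → Prime p → p ∣ e → ¬ Coprime e p
prime-¬coprime pp p∣e c = ℕₚ.<⇒≢ (prime>1 pp) (sym (c (p∣e , ∣-refl)))

∑-multiples : ∀ p → 0 ℕ.< p → ∀ X (G : ℕ → ℚ) → ∑ (X ℕ.* p) (λ i → 𝟙 (p ∣? suc i) * G (suc i)) ≡ ∑ X (λ i → G (p ℕ.* suc i))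
∑-multiples p@(suc p′) 0<p X G = trans (∑-block X p _) (∑-cong X λ j _ →
  trans (∑-single p p′ ℕₚ.≤-refl λ i i<p i≢p′ → trans (cong (_* G (suc (j ℕ.* p ℕ.+ i))) (𝟙-no (p ∣? _) λ d →
      i≢p′ (ℕₚ.suc-injective (ℕₚ.≤-antisym i<p (∣⇒≤ (∣m+n∣m⇒∣n (subst (p ∣_) (sym (ℕₚ.+-suc (j ℕ.* p) i)) d) (n∣m*n j))))))) (ℚₚ.*-zeroˡ (G (suc (j ℕ.* p ℕ.+ i)))))
  (trans (cong (λ e → 𝟙 (p ∣? e) * G e) (eq j)) (trans (cong (_* G (p ℕ.* suc j)) (𝟙-yes (p ∣? _) (m∣m*n (suc j)))) (ℚₚ.*-identityˡ _))))
  where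
  eq : ∀ j → suc (j ℕ.* p ℕ.+ p′) ≡ p ℕ.* suc j
  eq j = trans (sym (ℕₚ.+-suc (j ℕ.* p) p′)) (trans (ℕₚ.+-comm (j ℕ.* p) p) (ℕₚ.*-comm (suc j) p))

-- A number prime to Q is either prime to p Q or p times a number prime to Q. With different F this
-- yields the recursion for h and the one for the sums of inverse squares.
∑-coprime-split : ∀ {p Q} → Prime p → Coprime p Q → ∀ X (F : ℕ → ℚ) →
  ∑ (X ℕ.* p) (λ i → 𝟙 (coprime? (suc i) Q) * F (suc i)) ≡
  ∑ (X ℕ.* p) (λ i → 𝟙 (coprime? (suc i) (p ℕ.* Q)) * F (suc i)) + ∑ X (λ i → 𝟙 (coprime? (suc i) Q) * F (p ℕ.* suc i))
∑-coprime-split {p} {Q} pp cop X F = trans (∑-cong (X ℕ.* p) λ i _ → pointwise (suc i)) (trans (∑-+ (X ℕ.* p) _ _)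
   (cong (∑ (X ℕ.* p) (λ i → 𝟙 (coprime? (suc i) (p ℕ.* Q)) * F (suc i)) +_)
    (trans (∑-multiples p (prime>0 pp) X (λ e → 𝟙 (coprime? e Q) * F e)) (∑-cong X λ i _ → cong (_* F (p ℕ.* suc i))
      (𝟙-cong (coprime? (p ℕ.* suc i) Q) (coprime? (suc i) Q) (coprime-∣ˡ (n∣m*n p)) λ c → Cop.sym (coprime-* (Cop.sym cop) (Cop.sym c)))))))
  where
  pointwise : ∀ e → 𝟙 (coprime? e Q) * F e ≡ 𝟙 (coprime? e (p ℕ.* Q)) * F e + 𝟙 (p ∣? e) * (𝟙 (coprime? e Q) * F e)
  pointwise e with p ∣? e
  ... | yes d = trans (solve 1 (λ x → x := con 0ℚ :+ con 1ℚ :* x) refl _) (cong (_+ 1ℚ * (𝟙 (coprime? e Q) * F e))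
        (sym (trans (cong (_* F e) (𝟙-no (coprime? e (p ℕ.* Q)) λ c → prime-¬coprime pp d (coprime-∣ʳ (m∣m*n Q) c))) (ℚₚ.*-zeroˡ (F e)))))
  ... | no ¬d = trans (cong (_* F e) (𝟙-cong (coprime? e Q) (coprime? e (p ℕ.* Q)) (coprime-* (prime-coprime pp ¬d)) (coprime-∣ʳ (n∣m*n p))))
        (solve 2 (λ x y → x := x :+ con 0ℚ :* y) refl (𝟙 (coprime? e (p ℕ.* Q)) * F e) (𝟙 (coprime? e Q) * F e))

-- Sums over the divisors prime to Q

dsum : (ℕ → ℚ) → ℕ → ℚ
dsum w m = ∑ m (λ i → 𝟙 (suc i ∣? m) * w (suc i))

dsum-range : ∀ w {m X} → 0 ℕ.< m → m ℕ.≤ X → dsum w m ≡ ∑ X (λ i → 𝟙 (suc i ∣? m) * w (suc i))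
dsum-range w {m} 0<m m≤X = ∑-extend≡ m≤X λ i m≤i → trans (cong (_* w (suc i)) (𝟙-no (suc i ∣? m) λ d → ℕₚ.<⇒≱ (ℕ.s≤s m≤i) (∣⇒≤ {{ℕ.>-nonZero 0<m}} d))) (ℚₚ.*-zeroˡ (w (suc i)))

-- h Q m sums 1/e over the divisors e of m coprime to Q, so h 1 m = σ m / m.
wt : ℕ → ℕ → ℚ
wt Q e = 𝟙 (coprime? e Q) * inv e

h : ℕ → ℕ → ℚ
h Q = dsum (wt Q)

wt-≥0 : ∀ Q e → 0ℚ ≤ wt Q e
wt-≥0 Q e = *-≥0 (𝟙-≥0 (coprime? e Q)) (inv-≥0 e)

wt-≤ : ∀ Q e → wt Q e ≤ inv e
wt-≤ Q e = subst (wt Q e ≤_) (ℚₚ.*-identityˡ (inv e)) (*-monoʳ (inv-≥0 e) (𝟙-≤1 (coprime? e Q)))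

term-≥0 : ∀ {P : Set} (d : Dec P) {a} → 0ℚ ≤ a → 0ℚ ≤ 𝟙 d * a
term-≥0 d = *-≥0 (𝟙-≥0 d)

h-≥0 : ∀ Q m → 0ℚ ≤ h Q m
h-≥0 Q m = ∑-≥0 m λ i _ → term-≥0 (suc i ∣? m) (wt-≥0 Q (suc i))

h-≥1 : ∀ Q {m} → 0 ℕ.< m → 1ℚ ≤ h Q m
h-≥1 Q {suc m} _ = subst (1ℚ ≤_) (sym (∑-first m _)) (≤-diff (∑ m (λ i → 𝟙 (suc (suc i) ∣? suc m) * wt Q (suc (suc i))))
  (∑-≥0 m λ i _ → term-≥0 (suc (suc i) ∣? suc m) (wt-≥0 Q (suc (suc i))))
  (cong (_+ ∑ m (λ i → 𝟙 (suc (suc i) ∣? suc m) * wt Q (suc (suc i)))) (sym (trans (cong₂ _*_ (𝟙-yes (1 ∣? suc m) (1∣ suc m)) (trans (cong₂ _*_ (𝟙-yes (coprime? 1 Q) (Cop.1-coprimeTo Q)) inv-1) refl)) refl))))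

h-mono-∣ : ∀ Q {m n} → 0 ℕ.< m → 0 ℕ.< n → m ∣ n → h Q m ≤ h Q n
h-mono-∣ Q {m} {n} 0<m 0<n m∣n = subst (_≤ h Q n) (sym (dsum-range (wt Q) 0<m (∣⇒≤ {{ℕ.>-nonZero 0<n}} m∣n)))
  (∑-mono n λ i _ → *-monoʳ (wt-≥0 Q (suc i)) (𝟙-mono (suc i ∣? m) (suc i ∣? n) λ d → ∣-trans d m∣n))

h-anti : ∀ {Q R} m → Q ∣ R → h R m ≤ h Q m
h-anti {Q} {R} m Q∣R = ∑-mono m λ i _ → *-monoˡ (𝟙-≥0 (suc i ∣? m)) (*-monoʳ (inv-≥0 (suc i)) (𝟙-mono (coprime? (suc i) R) (coprime? (suc i) Q) (coprime-∣ʳ Q∣R)))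

∣-cancel : ∀ {p m n} → 0 ℕ.< p → p ℕ.* m ∣ p ℕ.* n → m ∣ n
∣-cancel {p} 0<p = *-cancelˡ-∣ p {{ℕ.>-nonZero 0<p}}

h-remove : ∀ {p Q m} → Prime p → 0 ℕ.< m → h (p ℕ.* Q) (p ℕ.* m) ≡ h (p ℕ.* Q) m
h-remove {p} {Q} {m} pp 0<m = trans (∑-cong (p ℕ.* m) λ i _ → pw (suc i)) (sym (dsum-range (wt (p ℕ.* Q)) 0<m (ℕₚ.m≤n*m m p {{prime⇒nonZero pp}})))
  where
  pw : ∀ e → 𝟙 (e ∣? p ℕ.* m) * wt (p ℕ.* Q) e ≡ 𝟙 (e ∣? m) * wt (p ℕ.* Q) e
  pw e with coprime? e (p ℕ.* Q)
  ... | no _ = trans (solve 2 (λ a b → a :* (con 0ℚ :* b) := con 0ℚ) refl (𝟙 (e ∣? p ℕ.* m)) (inv e)) (solve 2 (λ a b → con 0ℚ := a :* (con 0ℚ :* b)) refl (𝟙 (e ∣? m)) (inv e))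
  ... | yes c = cong (_* (1ℚ * inv e)) (𝟙-cong (e ∣? p ℕ.* m) (e ∣? m) (coprime-divisor (coprime-∣ʳ {e} {p ℕ.* Q} {p} (m∣m*n Q) c)) (∣n⇒∣m*n p))

-- A divisor of p m is either prime to p, hence a divisor of m, or p times a divisor of m.
h-step : ∀ {p Q m} → Prime p → Coprime p Q → 0 ℕ.< m → h Q (p ℕ.* m) ≡ h (p ℕ.* Q) m + inv p * h Q m
h-step {p} {Q} {m} pp cop 0<m = begin
  h Q (p ℕ.* m) ≡⟨ cong (λ X → ∑ X f) (ℕₚ.*-comm p m) ⟩
  ∑ (m ℕ.* p) f ≡⟨ ∑-cong (m ℕ.* p) (λ i _ → rot (𝟙 (suc i ∣? p ℕ.* m)) (𝟙 (coprime? (suc i) Q)) (inv (suc i))) ⟩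
  ∑ (m ℕ.* p) (λ i → 𝟙 (coprime? (suc i) Q) * F (suc i)) ≡⟨ ∑-coprime-split pp cop m F ⟩
  ∑ (m ℕ.* p) (λ i → 𝟙 (coprime? (suc i) (p ℕ.* Q)) * F (suc i)) + ∑ m (λ i → 𝟙 (coprime? (suc i) Q) * F (p ℕ.* suc i)) ≡⟨ cong₂ _+_ first second ⟩
  h (p ℕ.* Q) m + inv p * h Q m ∎
  where
  open ≡-Reasoning
  f = λ i → 𝟙 (suc i ∣? p ℕ.* m) * wt Q (suc i)
  F : ℕ → ℚ
  F e = 𝟙 (e ∣? p ℕ.* m) * inv e
  rot : ∀ a b c → a * (b * c) ≡ b * (a * c)
  rot a b c = solve 3 (λ a b c → a :* (b :* c) := b :* (a :* c)) refl a b c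
  first : ∑ (m ℕ.* p) (λ i → 𝟙 (coprime? (suc i) (p ℕ.* Q)) * F (suc i)) ≡ h (p ℕ.* Q) m
  first = trans (∑-cong (m ℕ.* p) λ i _ → rot (𝟙 (coprime? (suc i) (p ℕ.* Q))) (𝟙 (suc i ∣? p ℕ.* m)) (inv (suc i)))
    (trans (cong (λ X → ∑ X (λ i → 𝟙 (suc i ∣? p ℕ.* m) * wt (p ℕ.* Q) (suc i))) (ℕₚ.*-comm m p)) (h-remove pp 0<m))
  second : ∑ m (λ i → 𝟙 (coprime? (suc i) Q) * F (p ℕ.* suc i)) ≡ inv p * h Q m
  second = trans (∑-cong m λ i _ → trans (cong (𝟙 (coprime? (suc i) Q) *_) (cong₂ _*_
       (𝟙-cong (p ℕ.* suc i ∣? p ℕ.* m) (suc i ∣? m) (∣-cancel {p} (prime>0 pp)) (*-monoʳ-∣ p)) (inv-* (prime>0 pp) ℕ.z<s)))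
       (solve 4 (λ a b c d → a :* (b :* (c :* d)) := c :* (b :* (a :* d))) refl (𝟙 (coprime? (suc i) Q)) (𝟙 (suc i ∣? m)) (inv p) (inv (suc i))))
     (∑-*ˡ m (inv p) _)

h-∤ : ∀ {p Q m} → Prime p → ¬ p ∣ m → h Q m ≡ h (p ℕ.* Q) m
h-∤ {p} {Q} {m} pp p∤m = ∑-cong m λ i _ → pw (suc i)
  where
  pw : ∀ e → 𝟙 (e ∣? m) * wt Q e ≡ 𝟙 (e ∣? m) * wt (p ℕ.* Q) e
  pw e with e ∣? m
  ... | no _ = trans (ℚₚ.*-zeroˡ (wt Q e)) (sym (ℚₚ.*-zeroˡ (wt (p ℕ.* Q) e)))
  ... | yes d = cong (λ k → 1ℚ * (k * inv e)) (𝟙-cong (coprime? e Q) (coprime? e (p ℕ.* Q)) (coprime-* (prime-coprime pp λ p∣e → p∤m (∣-trans p∣e d))) (coprime-∣ʳ (n∣m*n p)))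

-- 1 + x + ... + x ^ l; at x = 1/p this is σ (p ^ l) / p ^ l.
geo : ℚ → ℕ → ℚ
geo x zero = 1ℚ
geo x (suc l) = 1ℚ + x * geo x l

geo-≥1 : ∀ {x} → 0ℚ ≤ x → ∀ l → 1ℚ ≤ geo x l
geo-≥1 0≤x zero = ℚₚ.≤-refl
geo-≥1 {x} 0≤x (suc l) = ≤-diff (x * geo x l) (*-≥0 0≤x (ℚₚ.≤-trans 0≤1 (geo-≥1 0≤x l))) refl

private
  ∣-quot : ∀ {p m} → p ∣ m → 0 ℕ.< m → ∃[ k ] (m ≡ p ℕ.* k × 0 ℕ.< k)
  ∣-quot {p} (divides zero refl) ()
  ∣-quot {p} (divides (suc k) eq) _ = suc k , trans eq (ℕₚ.*-comm (suc k) p) , ℕ.s≤s ℕ.z≤n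

-- Multiplicativity in the form of an inequality. Peeling off one factor p at a time by `h-step`
-- avoids writing m as a power of p times a cofactor.
h-lower : ∀ {p Q} → Prime p → Coprime p Q → ∀ l {m} → 0 ℕ.< m → p ℕ.^ l ∣ m → geo (inv p) l * h (p ℕ.* Q) m ≤ h Q m
h-lower {p} {Q} pp cop zero {m} 0<m _ = subst (_≤ h Q m) (sym (ℚₚ.*-identityˡ _)) (h-anti m (n∣m*n p))
h-lower {p} {Q} pp cop (suc l) {m} 0<m d with ∣-quot {p} (∣-trans (m∣m*n (p ℕ.^ l)) d) 0<m
... | k , refl , 0<k = begin
  geo (inv p) (suc l) * h (p ℕ.* Q) (p ℕ.* k) ≡⟨ cong (geo (inv p) (suc l) *_) (h-remove pp 0<k) ⟩
  (1ℚ + inv p * geo (inv p) l) * h (p ℕ.* Q) k ≡⟨ solve 3 (λ i g H → (con 1ℚ :+ i :* g) :* H := H :+ i :* (g :* H)) refl (inv p) (geo (inv p) l) (h (p ℕ.* Q) k) ⟩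
  h (p ℕ.* Q) k + inv p * (geo (inv p) l * h (p ℕ.* Q) k) ≤⟨ ℚₚ.+-monoʳ-≤ (h (p ℕ.* Q) k) (*-monoˡ (inv-≥0 p) (h-lower pp cop l 0<k (∣-cancel (prime>0 pp) d))) ⟩
  h (p ℕ.* Q) k + inv p * h Q k ≡⟨ sym (h-step pp cop 0<k) ⟩
  h Q (p ℕ.* k) ∎
  where open ℚₚ.≤-Reasoning

h-upper : ∀ {p Q} → Prime p → Coprime p Q → ∀ l {m} → 0 ℕ.< m → ¬ p ℕ.^ suc l ∣ m → h Q m ≤ geo (inv p) l * h (p ℕ.* Q) m
h-upper {p} {Q} pp cop l {m} 0<m ¬d with p ∣? m
... | no p∤m = ℚₚ.≤-trans (ℚₚ.≤-reflexive (trans (h-∤ pp p∤m) (sym (ℚₚ.*-identityˡ _)))) (*-monoʳ (h-≥0 (p ℕ.* Q) m) (geo-≥1 (inv-≥0 p) l))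
h-upper {p} {Q} pp cop zero {m} 0<m ¬d | yes p∣m = ⊥-elim (¬d (subst (_∣ m) (sym (ℕₚ.*-identityʳ p)) p∣m))
h-upper {p} {Q} pp cop (suc l) {m} 0<m ¬d | yes p∣m with ∣-quot p∣m 0<m
... | k , refl , 0<k = begin
  h Q (p ℕ.* k) ≡⟨ h-step pp cop 0<k ⟩
  h (p ℕ.* Q) k + inv p * h Q k ≤⟨ ℚₚ.+-monoʳ-≤ (h (p ℕ.* Q) k) (*-monoˡ (inv-≥0 p) (h-upper pp cop l 0<k (¬d ∘ *-monoʳ-∣ p))) ⟩
  h (p ℕ.* Q) k + inv p * (geo (inv p) l * h (p ℕ.* Q) k) ≡⟨ solve 3 (λ i g H → H :+ i :* (g :* H) := (con 1ℚ :+ i :* g) :* H) refl (inv p) (geo (inv p) l) (h (p ℕ.* Q) k) ⟩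
  (1ℚ + inv p * geo (inv p) l) * h (p ℕ.* Q) k ≡⟨ cong (geo (inv p) (suc l) *_) (sym (h-remove pp 0<k)) ⟩
  geo (inv p) (suc l) * h (p ℕ.* Q) (p ℕ.* k) ∎
  where open ℚₚ.≤-Reasoning

-- If m = p k, then h Q k ≤ h Q m in `h-step`. Solved for h Q m this is the bound by the full
-- geometric series p / (p - 1), whatever the exponent of p in m.
h-top : ∀ {p Q} → Prime p → Coprime p Q → ∀ {m} → 0 ℕ.< m → h Q m ≤ h (p ℕ.* Q) m + inv p * h Q m
h-top {p} {Q} pp cop {m} 0<m with p ∣? m
... | no p∤m = ≤-diff (inv p * h Q m) (*-≥0 (inv-≥0 p) (h-≥0 Q m)) (cong (_+ inv p * h Q m) (h-∤ pp p∤m))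
... | yes p∣m with ∣-quot p∣m 0<m
... | k , refl , 0<k = subst (_≤ h (p ℕ.* Q) (p ℕ.* k) + inv p * h Q (p ℕ.* k)) (sym (trans (h-step pp cop 0<k) (cong (_+ inv p * h Q k) (sym (h-remove pp 0<k)))))
  (ℚₚ.+-monoʳ-≤ (h (p ℕ.* Q) (p ℕ.* k)) (*-monoˡ (inv-≥0 p) (h-mono-∣ Q 0<k 0<m (n∣m*n p))))

-- Truncation of divisor sums, and their averages

trunc : ℕ → ℕ → ℕ → ℚ
trunc Q Y m = ∑ Y (λ i → 𝟙 (suc i ∣? m) * wt Q (suc i))

tailWt : ℕ → ℕ → ℕ → ℚ
tailWt Q Y e = 𝟙 (Y ℕₚ.<? e) * wt Q e

tailWt-≥0 : ∀ Q Y e → 0ℚ ≤ tailWt Q Y e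
tailWt-≥0 Q Y e = term-≥0 (Y ℕₚ.<? e) (wt-≥0 Q e)

tailWt-≤ : ∀ Q Y e → tailWt Q Y e ≤ inv e
tailWt-≤ Q Y e = ℚₚ.≤-trans (subst (tailWt Q Y e ≤_) (ℚₚ.*-identityˡ (wt Q e)) (*-monoʳ (wt-≥0 Q e) (𝟙-≤1 (Y ℕₚ.<? e)))) (wt-≤ Q e)

h-trunc : ∀ Q Y {m} → 0 ℕ.< m → h Q m ≡ trunc Q Y m + dsum (tailWt Q Y) m
h-trunc Q Y {m} 0<m = begin
  h Q m ≡⟨ dsum-range (wt Q) 0<m (ℕₚ.m≤n+m m Y) ⟩
  ∑ (Y ℕ.+ m) (λ i → 𝟙 (suc i ∣? m) * wt Q (suc i)) ≡⟨ ∑-cong (Y ℕ.+ m) (λ i _ → pw i) ⟩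
  ∑ (Y ℕ.+ m) (λ i → 𝟙 (i ℕₚ.<? Y) * a i + 𝟙 (suc i ∣? m) * tailWt Q Y (suc i)) ≡⟨ ∑-+ (Y ℕ.+ m) _ _ ⟩
  ∑ (Y ℕ.+ m) (λ i → 𝟙 (i ℕₚ.<? Y) * a i) + ∑ (Y ℕ.+ m) (λ i → 𝟙 (suc i ∣? m) * tailWt Q Y (suc i)) ≡⟨ cong₂ _+_
     (trans (sym (∑-extend≡ (ℕₚ.m≤m+n Y m) λ i Y≤i → trans (cong (_* a i) (𝟙-no (i ℕₚ.<? Y) (ℕₚ.≤⇒≯ Y≤i))) (ℚₚ.*-zeroˡ (a i))))
       (∑-cong Y λ i i<Y → trans (cong (_* a i) (𝟙-yes (i ℕₚ.<? Y) i<Y)) (ℚₚ.*-identityˡ (a i))))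
     (sym (dsum-range (tailWt Q Y) 0<m (ℕₚ.m≤n+m m Y))) ⟩
  trunc Q Y m + dsum (tailWt Q Y) m ∎
  where
  open ≡-Reasoning
  a : ℕ → ℚ
  a i = 𝟙 (suc i ∣? m) * wt Q (suc i)
  pw : ∀ i → a i ≡ 𝟙 (i ℕₚ.<? Y) * a i + 𝟙 (suc i ∣? m) * tailWt Q Y (suc i)
  pw i with ℕₚ.<-≤-connex i Y
  ... | inj₁ i<Y = trans (solve 3 (λ a b c → a :* b := con 1ℚ :* (a :* b) :+ a :* (con 0ℚ :* b)) refl (𝟙 (suc i ∣? m)) (wt Q (suc i)) 0ℚ)
     (cong₂ (λ u v → u * a i + 𝟙 (suc i ∣? m) * (v * wt Q (suc i))) (sym (𝟙-yes (i ℕₚ.<? Y) i<Y)) (sym (𝟙-no (Y ℕₚ.<? suc i) (ℕₚ.≤⇒≯ i<Y))))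
  ... | inj₂ Y≤i = trans (solve 2 (λ a b → a :* b := con 0ℚ :* (a :* b) :+ a :* (con 1ℚ :* b)) refl (𝟙 (suc i ∣? m)) (wt Q (suc i)))
     (cong₂ (λ u v → u * a i + 𝟙 (suc i ∣? m) * (v * wt Q (suc i))) (sym (𝟙-no (i ℕₚ.<? Y) (ℕₚ.≤⇒≯ Y≤i))) (sym (𝟙-yes (Y ℕₚ.<? suc i) (ℕ.s≤s Y≤i))))

-- The right side is 1 / (n (n + 1)). It telescopes in `inv-sq-tail`, and it separates the
-- reciprocals of different primes in `free-unique`.
inv-sq-≤ : ∀ n → 0 ℕ.< n → inv (suc n) * inv (suc n) ≤ inv n - inv (suc n)
inv-sq-≤ n 0<n = ≤-diff (i * (j * j)) (*-≥0 (inv-≥0 n) (*-≥0 (inv-≥0 (suc n)) (inv-≥0 (suc n)))) (begin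
  j * j + i * (j * j) ≡⟨ solve 2 (λ i j → j :* j :+ i :* (j :* j) := (con 1ℚ :+ i) :* j :* j) refl i j ⟩
  (1ℚ + i) * j * j ≡⟨ cong (_* j) (trans (cong (λ k → (k + i) * j) (sym (inv-ι′ 0<n))) (trans (solve 3 (λ i n j → (i :* n :+ i) :* j := i :* (j :* (con 1ℚ :+ n))) refl i (ι n) j)
      (trans (cong (λ k → i * (j * k)) (sym (ι-suc n))) (trans (cong (i *_) (inv-ι n)) (ℚₚ.*-identityʳ i))))) ⟩
  i * j ≡⟨ solve 2 (λ i j → i :* j := i :* (j :* con 1ℚ)) refl i j ⟩
  i * (j * 1ℚ) ≡⟨ solve 3 (λ i j n → i :* (j :* con 1ℚ) := i :* (j :* (con 1ℚ :+ n)) :- (i :* n) :* j) refl i j (ι n) ⟩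
  i * (j * (1ℚ + ι n)) - (i * ι n) * j ≡⟨ cong₂ (λ u v → i * u - v * j) (trans (cong (j *_) (sym (ι-suc n))) (inv-ι n)) (inv-ι′ 0<n) ⟩
  i * 1ℚ - 1ℚ * j ≡⟨ cong₂ _-_ (ℚₚ.*-identityʳ i) (ℚₚ.*-identityˡ j) ⟩
  i - j ∎)
  where
  open ≡-Reasoning
  i = inv n
  j = inv (suc n)

inv-sq-tail : ∀ K → 0 ℕ.< K → ∀ X → ∑ X (λ i → inv (suc (K ℕ.+ i)) * inv (suc (K ℕ.+ i))) ≤ inv K
inv-sq-tail K 0<K X = ℚₚ.≤-trans (go X) (≤-diff (inv (K ℕ.+ X)) (inv-≥0 _) (solve 2 (λ a b → (a :- b) :+ b := a) refl (inv K) (inv (K ℕ.+ X))))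
  where
  go : ∀ X → ∑ X (λ i → inv (suc (K ℕ.+ i)) * inv (suc (K ℕ.+ i))) ≤ inv K - inv (K ℕ.+ X)
  go zero = subst (λ k → 0ℚ ≤ inv K - inv k) (sym (ℕₚ.+-identityʳ K)) (ℚₚ.≤-reflexive (sym (ℚₚ.+-inverseʳ (inv K))))
  go (suc X) = subst (λ k → ∑ (suc X) (λ i → inv (suc (K ℕ.+ i)) * inv (suc (K ℕ.+ i))) ≤ inv K - inv k) (sym (ℕₚ.+-suc K X))
    (subst (∑ (suc X) (λ i → inv (suc (K ℕ.+ i)) * inv (suc (K ℕ.+ i))) ≤_) (solve 3 (λ a b c → (a :- b) :+ (b :- c) := a :- c) refl (inv K) (inv (K ℕ.+ X)) (inv (suc (K ℕ.+ X))))
      (ℚₚ.+-mono-≤ (go X) (inv-sq-≤ (K ℕ.+ X) (ℕₚ.<-≤-trans 0<K (ℕₚ.m≤m+n K X)))))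

-- A substitute for the logarithm: K is arbitrary, so the harmonic sum is o(X).
harmonic-≤ : ∀ K → 0 ℕ.< K → ∀ X → ∑ X (λ i → inv (suc i)) ≤ ι K + ι X * inv K
harmonic-≤ K 0<K X = begin
  ∑ X (λ i → inv (suc i)) ≤⟨ ∑-extend (ℕₚ.m≤n+m X K) (λ i → inv-≥0 (suc i)) ⟩
  ∑ (K ℕ.+ X) (λ i → inv (suc i)) ≡⟨ ∑-split K X _ ⟩
  ∑ K (λ i → inv (suc i)) + ∑ X (λ i → inv (suc (K ℕ.+ i))) ≤⟨ ℚₚ.+-mono-≤ (∑-mono K λ i _ → inv-≤1 (suc i)) (∑-mono X λ i _ → inv-anti 0<K (ℕₚ.≤-trans (ℕₚ.m≤m+n K i) (ℕₚ.n≤1+n _))) ⟩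
  ∑ K (λ _ → 1ℚ) + ∑ X (λ _ → inv K) ≡⟨ cong₂ _+_ (trans (∑-const K 1ℚ) (ℚₚ.*-identityʳ (ι K))) (∑-const X (inv K)) ⟩
  ι K + ι X * inv K ∎
  where open ℚₚ.≤-Reasoning

-- Exchange the sums: a divisor e is met at most κ x / e + 1 times. The first part adds up to κ q x,
-- the second to a harmonic sum, which is o(x). The hypothesis on the counts carries the factor w e,
-- so it is trivial for the e of weight 0, which may share factors with β.
uavg-dsum : ∀ {w α β κ q} → 0 ℕ.< α → 0ℚ ≤ κ → (∀ e → 0ℚ ≤ w e) → (∀ e → w e ≤ inv e) →
  (∀ e → 0 ℕ.< e → ∀ x → w e * ∑ x (λ j → 𝟙 (e ∣? α ℕ.+ β ℕ.* j)) ≤ w e * (κ * (ι x * inv e) + 1ℚ)) →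
  (∀ X → ∑ X (λ i → w (suc i) * inv (suc i)) ≤ q) → UAvg (λ j → dsum w (α ℕ.+ β ℕ.* j)) (κ * q)
uavg-dsum {w} {α} {β} {κ} {q} 0<α 0≤κ w≥0 w≤ cnt sq .bound ε 0<ε with recip ε 0<ε
... | n , 0<n , 1≤nε = ι K + ι α * inv K , go
  where
  -- Since 1 ≤ n ε, this choice makes β / K ≤ ε.
  K = suc (β ℕ.* n)
  0<K : 0 ℕ.< K
  0<K = ℕ.s≤s ℕ.z≤n
  βK : ι β * inv K ≤ ε
  βK = *inv-≤ 0<K (begin
    ι β ≡⟨ sym (ℚₚ.*-identityʳ (ι β)) ⟩
    ι β * 1ℚ ≤⟨ *-monoˡ (ι-≥0 β) 1≤nε ⟩
    ι β * (ι n * ε) ≡⟨ trans (sym (ℚₚ.*-assoc (ι β) (ι n) ε)) (cong (_* ε) (sym (ι-* β n))) ⟩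
    ι (β ℕ.* n) * ε ≤⟨ *-monoʳ (ℚₚ.<⇒≤ 0<ε) (ι-mono (ℕₚ.n≤1+n _)) ⟩
    ι K * ε ∎)
    where open ℚₚ.≤-Reasoning
  go : ∀ x → ∑ x (λ j → dsum w (α ℕ.+ β ℕ.* j)) ≤ (κ * q + ε) * ι x + (ι K + ι α * inv K)
  go x = begin
    ∑ x (λ j → dsum w (α ℕ.+ β ℕ.* j)) ≡⟨ ∑-cong x (λ j j<x → dsum-range w (ℕₚ.<-≤-trans 0<α (ℕₚ.m≤m+n α _)) (ℕₚ.+-monoʳ-≤ α (ℕₚ.*-monoʳ-≤ β (ℕₚ.<⇒≤ j<x)))) ⟩
    ∑ x (λ j → ∑ X (λ i → 𝟙 (suc i ∣? α ℕ.+ β ℕ.* j) * w (suc i))) ≡⟨ ∑-swap x X _ ⟩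
    ∑ X (λ i → ∑ x (λ j → 𝟙 (suc i ∣? α ℕ.+ β ℕ.* j) * w (suc i))) ≡⟨ ∑-cong X (λ i _ → trans (∑-*ʳ x (w (suc i)) _) (ℚₚ.*-comm _ (w (suc i)))) ⟩
    ∑ X (λ i → w (suc i) * ∑ x (λ j → 𝟙 (suc i ∣? α ℕ.+ β ℕ.* j))) ≤⟨ ∑-mono X (λ i _ → cnt (suc i) ℕ.z<s x) ⟩
    ∑ X (λ i → w (suc i) * (κ * (ι x * inv (suc i)) + 1ℚ)) ≤⟨ ∑-mono X (λ i _ → ℚₚ.≤-trans (ℚₚ.≤-reflexive
        (solve 4 (λ w k x i → w :* (k :* (x :* i) :+ con 1ℚ) := (k :* x) :* (w :* i) :+ w) refl (w (suc i)) κ (ι x) (inv (suc i)))) (ℚₚ.+-monoʳ-≤ ((κ * ι x) * (w (suc i) * inv (suc i))) (w≤ (suc i)))) ⟩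
    ∑ X (λ i → (κ * ι x) * (w (suc i) * inv (suc i)) + inv (suc i)) ≡⟨ trans (∑-+ X _ _) (cong (_+ ∑ X (λ i → inv (suc i))) (∑-*ˡ X (κ * ι x) _)) ⟩
    (κ * ι x) * ∑ X (λ i → w (suc i) * inv (suc i)) + ∑ X (λ i → inv (suc i)) ≤⟨ ℚₚ.+-mono-≤ (*-monoˡ (*-≥0 0≤κ (ι-≥0 x)) (sq X)) (harmonic-≤ K 0<K X) ⟩
    (κ * ι x) * q + (ι K + ι X * inv K) ≡⟨ cong (λ k → (κ * ι x) * q + (ι K + k * inv K)) (trans (ι-+ α (β ℕ.* x)) (cong (ι α +_) (ι-* β x))) ⟩
    (κ * ι x) * q + (ι K + (ι α + ι β * ι x) * inv K) ≡⟨ solve 7 (λ k x q K a b i → (k :* x) :* q :+ (K :+ (a :+ b :* x) :* i) := (k :* q :+ b :* i) :* x :+ (K :+ a :* i)) refl κ (ι x) q (ι K) (ι α) (ι β) (inv K) ⟩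
    (κ * q + ι β * inv K) * ι x + (ι K + ι α * inv K) ≤⟨ ℚₚ.+-monoˡ-≤ (ι K + ι α * inv K) (*-monoʳ (ι-≥0 x) (ℚₚ.+-monoʳ-≤ (κ * q) βK)) ⟩
    (κ * q + ε) * ι x + (ι K + ι α * inv K) ∎
    where
    open ℚₚ.≤-Reasoning
    X = α ℕ.+ β ℕ.* x

-- The function σ as a divisor sum

∑-list : ∀ {P : ℕ → Set} (P? : Decidable P) (f : ℕ → ℕ) n → ι (sum (filter P? (map suc (applyUpTo f n)))) ≡ ∑ n (λ i → 𝟙 (P? (suc (f i))) * ι (suc (f i)))
∑-list P? f zero = ι-0
∑-list P? f (suc n) = trans head (sym (∑-first n (λ i → 𝟙 (P? (suc (f i))) * ι (suc (f i)))))
  where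
  S = ∑ n (λ i → 𝟙 (P? (suc (f (suc i)))) * ι (suc (f (suc i))))
  head : ι (sum (filter P? (map suc (applyUpTo f (suc n))))) ≡ 𝟙 (P? (suc (f 0))) * ι (suc (f 0)) + S
  head with P? (suc (f 0))
  ... | yes _ = trans (ι-+ (suc (f 0)) _) (cong₂ _+_ (sym (ℚₚ.*-identityˡ (ι (suc (f 0))))) (∑-list P? (f ∘ suc) n))
  ... | no _ = trans (∑-list P? (f ∘ suc) n) (trans (sym (ℚₚ.+-identityˡ S)) (cong (_+ S) (sym (ℚₚ.*-zeroˡ (ι (suc (f 0)))))))

∑-length : ∀ {P : ℕ → Set} (P? : Decidable P) (f : ℕ → ℕ) n → ι (length (filter P? (map suc (applyUpTo f n)))) ≡ ∑ n (λ i → 𝟙 (P? (suc (f i))))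
∑-length P? f zero = ι-0
∑-length P? f (suc n) = trans head (sym (∑-first n (λ i → 𝟙 (P? (suc (f i))))))
  where
  S = ∑ n (λ i → 𝟙 (P? (suc (f (suc i)))))
  head : ι (length (filter P? (map suc (applyUpTo f (suc n))))) ≡ 𝟙 (P? (suc (f 0))) + S
  head with P? (suc (f 0))
  ... | yes _ = trans (ι-suc (length (filter P? (map suc (applyUpTo (f ∘ suc) n))))) (cong (1ℚ +_) (∑-length P? (f ∘ suc) n))
  ... | no _ = trans (∑-length P? (f ∘ suc) n) (sym (ℚₚ.+-identityˡ S))

-- Both sides are evaluations of the double sum of d over the pairs d e = n.
σ-h : ∀ {n} → 0 ℕ.< n → ι (σ n) ≡ ι n * h 1 n
σ-h {n} 0<n = begin
  ι (σ n) ≡⟨ ∑-list (λ d → d ∣? n) (λ i → i) n ⟩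
  ∑ n (λ i → 𝟙 (suc i ∣? n) * ι (suc i)) ≡⟨ ∑-cong n (λ i _ → trans (cong (_* ι (suc i)) (sym (count (suc i) ℕ.z<s))) (sym (∑-*ʳ n (ι (suc i)) _))) ⟩
  ∑ n (λ i → ∑ n (λ j → 𝟙 (suc i ℕ.* suc j ℕₚ.≟ n) * ι (suc i))) ≡⟨ ∑-swap n n _ ⟩
  ∑ n (λ j → ∑ n (λ i → 𝟙 (suc i ℕ.* suc j ℕₚ.≟ n) * ι (suc i))) ≡⟨ ∑-cong n (λ j _ → trans (∑-cong n λ i _ → swap-term i j) (∑-*ʳ n (ι n * inv (suc j)) _)) ⟩
  ∑ n (λ j → ∑ n (λ i → 𝟙 (suc j ℕ.* suc i ℕₚ.≟ n)) * (ι n * inv (suc j))) ≡⟨ ∑-cong n (λ j _ → trans (cong (_* (ι n * inv (suc j))) (count (suc j) ℕ.z<s))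
       (trans (solve 3 (λ a b c → a :* (b :* c) := b :* (a :* (con 1ℚ :* c))) refl (𝟙 (suc j ∣? n)) (ι n) (inv (suc j)))
         (cong (λ k → ι n * (𝟙 (suc j ∣? n) * (k * inv (suc j)))) (sym (𝟙-yes (coprime? (suc j) 1) (Cop.sym (Cop.1-coprimeTo (suc j)))))))) ⟩
  ∑ n (λ j → ι n * (𝟙 (suc j ∣? n) * wt 1 (suc j))) ≡⟨ ∑-*ˡ n (ι n) _ ⟩
  ι n * h 1 n ∎
  where
  open ≡-Reasoning
  count : ∀ d → 0 ℕ.< d → ∑ n (λ j → 𝟙 (d ℕ.* suc j ℕₚ.≟ n)) ≡ 𝟙 (d ∣? n)
  count d@(suc d′) _ with d ∣? n
  ... | no d∤n = ∑-zero n λ j _ → 𝟙-no (d ℕ.* suc j ℕₚ.≟ n) λ eq → d∤n (divides (suc j) (trans (sym eq) (ℕₚ.*-comm d (suc j))))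
  ... | yes d∣n with ∣-quot d∣n 0<n
  ... | suc k , eq , _ = trans (∑-single n k (subst (k ℕ.<_) (sym eq) (ℕₚ.m≤n*m (suc k) d)) λ j _ j≢k → 𝟙-no (d ℕ.* suc j ℕₚ.≟ n)
       λ eq′ → j≢k (ℕₚ.suc-injective (ℕₚ.*-cancelˡ-≡ (suc j) (suc k) d (trans eq′ eq)))) (𝟙-yes (d ℕ.* suc k ℕₚ.≟ n) (sym eq))
  swap-term : ∀ i j → 𝟙 (suc i ℕ.* suc j ℕₚ.≟ n) * ι (suc i) ≡ 𝟙 (suc j ℕ.* suc i ℕₚ.≟ n) * (ι n * inv (suc j))
  swap-term i j with suc i ℕ.* suc j ℕₚ.≟ n
  ... | no ne = trans (ℚₚ.*-zeroˡ (ι (suc i))) (sym (trans (cong (_* (ι n * inv (suc j))) (𝟙-no (suc j ℕ.* suc i ℕₚ.≟ n) (ne ∘ trans (ℕₚ.*-comm (suc i) (suc j))))) (ℚₚ.*-zeroˡ (ι n * inv (suc j)))))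
  ... | yes eq = trans (cong (1ℚ *_) (begin
      ι (suc i) ≡⟨ sym (ℚₚ.*-identityʳ _) ⟩
      ι (suc i) * 1ℚ ≡⟨ cong (ι (suc i) *_) (trans (sym (inv-ι j)) (ℚₚ.*-comm (inv (suc j)) (ι (suc j)))) ⟩
      ι (suc i) * (ι (suc j) * inv (suc j)) ≡⟨ sym (ℚₚ.*-assoc (ι (suc i)) (ι (suc j)) (inv (suc j))) ⟩
      (ι (suc i) * ι (suc j)) * inv (suc j) ≡⟨ cong (_* inv (suc j)) (trans (sym (ι-* (suc i) (suc j))) (cong ι eq)) ⟩
      ι n * inv (suc j) ∎))
     (cong (_* (ι n * inv (suc j))) (sym (𝟙-yes (suc j ℕ.* suc i ℕₚ.≟ n) (trans (ℕₚ.*-comm (suc j) (suc i)) eq))))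

-- With k = n - 1, the shifts 2 and 3 give the numbers 2n and 2n + 1.
shift₁ shift₂ : Bool → ℕ
shift₁ true = 3
shift₁ false = 2
shift₂ s = shift₁ (not s)

opaque
  val : ℕ → ℕ → ℕ
  val c k = 2 ℕ.* k ℕ.+ c

  val-def : ∀ c k → val c k ≡ 2 ℕ.* k ℕ.+ c
  val-def c k = refl

val>0 : ∀ s k → 0 ℕ.< val (shift₁ s) k
val>0 true k = subst (0 ℕ.<_) (sym (val-def 3 k)) (ℕₚ.<-≤-trans ℕ.z<s (ℕₚ.m≤n+m 3 (2 ℕ.* k)))
val>0 false k = subst (0 ℕ.<_) (sym (val-def 2 k)) (ℕₚ.<-≤-trans ℕ.z<s (ℕₚ.m≤n+m 2 (2 ℕ.* k)))

val-sep : ∀ s {p} k → Prime p → p ∣ val (shift₁ s) k → ¬ p ∣ val (shift₂ s) k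
val-sep true {p} k pp a b = ℕₚ.<⇒≢ (prime>1 pp) (sym (∣1⇒≡1 (∣m+n∣m⇒∣n (subst (p ∣_) (trans (val-def 3 k) (sym (ℕₚ.+-assoc (2 ℕ.* k) 2 1))) a) (subst (p ∣_) (val-def 2 k) b))))
val-sep false {p} k pp a b = val-sep true k pp b a

-- The logarithmic grid and its states

pow : ℚ → ℕ → ℚ
pow b zero = 1ℚ
pow b (suc n) = b * pow b n

pow-+ : ∀ b m n → pow b (m ℕ.+ n) ≡ pow b m * pow b n
pow-+ b zero n = sym (ℚₚ.*-identityˡ (pow b n))
pow-+ b (suc m) n = trans (cong (b *_) (pow-+ b m n)) (sym (ℚₚ.*-assoc b (pow b m) (pow b n)))

pow-≥1 : ∀ {b} → 1ℚ ≤ b → ∀ n → 1ℚ ≤ pow b n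
pow-≥1 1≤b zero = ℚₚ.≤-refl
pow-≥1 {b} 1≤b (suc n) = ℚₚ.≤-trans 1≤b (subst (_≤ b * pow b n) (ℚₚ.*-identityʳ b) (*-monoˡ (ℚₚ.≤-trans 0≤1 1≤b) (pow-≥1 1≤b n)))

pow-≥0 : ∀ {b} → 1ℚ ≤ b → ∀ n → 0ℚ ≤ pow b n
pow-≥0 1≤b n = ℚₚ.≤-trans 0≤1 (pow-≥1 1≤b n)

pow-mono : ∀ {b} → 1ℚ ≤ b → ∀ {m n} → m ℕ.≤ n → pow b m ≤ pow b n
pow-mono {b} 1≤b {m} {n} m≤n = subst₂ _≤_ (ℚₚ.*-identityʳ (pow b m)) (trans (sym (pow-+ b m (n ℕ.∸ m))) (cong (pow b) (ℕₚ.m+[n∸m]≡n m≤n)))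
  (*-monoˡ (pow-≥0 1≤b m) (pow-≥1 1≤b (n ℕ.∸ m)))

bernoulli : ∀ {x} → 0ℚ ≤ x → ∀ n → 1ℚ + ι n * x ≤ pow (1ℚ + x) n
bernoulli {x} 0≤x zero = ℚₚ.≤-reflexive (trans (cong (λ k → 1ℚ + k * x) ι-0) (solve 1 (λ x → con 1ℚ :+ con 0ℚ :* x := con 1ℚ) refl x))
bernoulli {x} 0≤x (suc n) = ℚₚ.≤-trans (≤-diff (ι n * x * x) (*-≥0 (*-≥0 (ι-≥0 n) 0≤x) 0≤x)
   (trans (cong (λ k → 1ℚ + k * x + ι n * x * x) (ι-suc n)) (solve 2 (λ n x → con 1ℚ :+ (con 1ℚ :+ n) :* x :+ n :* x :* x := (con 1ℚ :+ x) :* (con 1ℚ :+ n :* x)) refl (ι n) x)))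
   (*-monoˡ (+-≥0 0≤1 0≤x) (bernoulli 0≤x n))

base : ℕ → ℚ
base N = 1ℚ + inv N

base-≥1 : ∀ N → 1ℚ ≤ base N
base-≥1 N = ≤-diff (inv N) (inv-≥0 N) refl

-- State after the primes of Q: the contributions of these primes to σ n₁ / n₁ and σ n₂ / n₂
-- are recorded as the powers i and o of the base, up to a common factor.
record Bad (s : Bool) (N Q i o k : ℕ) : Set where
  constructor mkBad
  field
    unBad : pow (base N) i * h Q (val (shift₁ s) k) < pow (base N) o * h Q (val (shift₂ s) k)
open Bad

opaque
  bad? : ∀ s N Q i o k → Dec (Bad s N Q i o k)
  bad? s N Q i o k with pow (base N) i * h Q (val (shift₁ s) k) <? pow (base N) o * h Q (val (shift₂ s) k)
  ... | yes lt = yes (mkBad lt)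
  ... | no ¬lt = no (¬lt ∘ unBad)

-- Along r + M j both numbers have slope 2 M, so the divisors prime to Q remain equidistributed
-- there. For Q = 1 no M qualifies, as e = 2 shows; this is why the tables stop at Q = 2 and the
-- prime 2 is treated separately.
Smooth : ℕ → ℕ → Set
Smooth Q M = ∀ {e} → Coprime e Q → Coprime e (2 ℕ.* M)

-- v bounds the density of Bad conditionally on any residue modulo powers of the primes of Q.
record Sound (s : Bool) (N Q i o : ℕ) (v : ℚ) : Set where
  field
    along : ∀ r M → Smooth Q M → UAvg (λ j → 𝟙 (bad? s N Q i o (r ℕ.+ M ℕ.* j))) v
open Sound

-- A larger exponent of n₁ makes failures rarer, so an index may always be rounded down.
sound-mono : ∀ {s N Q i j o v} → i ℕ.≤ j → Sound s N Q i o v → Sound s N Q j o v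
sound-mono {s} {N} {Q} {i} {j} {o} i≤j S .along r M sm = uavg-mono (λ t → 𝟙-mono (bad? s N Q j o (r ℕ.+ M ℕ.* t)) (bad? s N Q i o (r ℕ.+ M ℕ.* t))
  λ (mkBad bad) → mkBad (ℚₚ.≤-<-trans (*-monoʳ (h-≥0 Q (val (shift₁ s) (r ℕ.+ M ℕ.* t))) (pow-mono (base-≥1 N) i≤j)) bad)) (S .along r M sm)

sound-≤ : ∀ {s N Q i o v w} → v ≤ w → Sound s N Q i o v → Sound s N Q i o w
sound-≤ v≤w S .along r M sm = uavg-≤ v≤w (S .along r M sm)

sound-1 : ∀ {s N Q i o} → Sound s N Q i o 1ℚ
sound-1 {s} {N} {Q} {i} {o} .along r M sm = uavg-1 (λ t → 𝟙-≤1 (bad? s N Q i o (r ℕ.+ M ℕ.* t)))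

-- A common power of the base cancels: only the difference of i and o matters.
sound-shift : ∀ {s N Q i o v} d → Sound s N Q i o v → Sound s N Q (d ℕ.+ i) (d ℕ.+ o) v
sound-shift {s} {N} {Q} {i} {o} d S .along r M sm = uavg-mono (λ t → 𝟙-mono (bad? s N Q (d ℕ.+ i) (d ℕ.+ o) (r ℕ.+ M ℕ.* t)) (bad? s N Q i o (r ℕ.+ M ℕ.* t))
  λ (mkBad bad) → mkBad (*-cancelˡ-< (pow-≥0 (base-≥1 N) d) (subst₂ _<_ (eq i (h Q (val (shift₁ s) (r ℕ.+ M ℕ.* t)))) (eq o (h Q (val (shift₂ s) (r ℕ.+ M ℕ.* t)))) bad))) (S .along r M sm)
  where
  eq : ∀ i x → pow (base N) (d ℕ.+ i) * x ≡ pow (base N) d * (pow (base N) i * x)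
  eq i x = trans (cong (_* x) (pow-+ (base N) d i)) (ℚₚ.*-assoc (pow (base N) d) (pow (base N) i) x)

-- The base of a grid of mesh 1/N' is at most the c-th power of the base of the grid of mesh 1/(c N').
sound-refine : ∀ {s N N′ c Q i o i′ o′ v} → N ≡ c ℕ.* N′ → 0 ℕ.< c → 0 ℕ.< N′ → o′ ℕ.≤ i′ → o ℕ.+ c ℕ.* i′ ℕ.≤ i ℕ.+ c ℕ.* o′ →
  Sound s N′ Q i′ o′ v → Sound s N Q i o v
sound-refine {s} {N} {N′} {c} {Q} {i} {o} {i′} {o′} refl 0<c 0<N′ o′≤i′ le S .along r M sm =
  uavg-mono (λ t → 𝟙-mono (bad? s N Q i o (r ℕ.+ M ℕ.* t)) (bad? s N′ Q i′ o′ (r ℕ.+ M ℕ.* t)) (go (r ℕ.+ M ℕ.* t))) (S .along r M sm)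
  where
  open ℚₚ.≤-Reasoning
  t = i′ ℕ.∸ o′
  i′≡ : i′ ≡ o′ ℕ.+ t
  i′≡ = sym (ℕₚ.m+[n∸m]≡n o′≤i′)
  o+ct≤i : o ℕ.+ c ℕ.* t ℕ.≤ i
  o+ct≤i = ℕₚ.+-cancelʳ-≤ (c ℕ.* o′) (o ℕ.+ c ℕ.* t) i (ℕₚ.≤-trans (ℕₚ.≤-reflexive
    (trans (solveℕ 4 (λ o c t o′ → (o ⊕ c ⊗ t) ⊕ c ⊗ o′ ≐ o ⊕ c ⊗ (o′ ⊕ t)) refl o c t o′) (cong (λ k → o ℕ.+ c ℕ.* k) (sym i′≡)))) le)
  base≤ : base N′ ≤ pow (base N) c
  base≤ = ℚₚ.≤-trans (ℚₚ.≤-reflexive (cong (1ℚ +_) (sym (trans (cong (ι c *_) (inv-* 0<c 0<N′)) (trans (sym (ℚₚ.*-assoc (ι c) (inv c) (inv N′)))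
    (trans (cong (_* inv N′) (trans (ℚₚ.*-comm (ι c) (inv c)) (inv-ι′ 0<c))) (ℚₚ.*-identityˡ (inv N′)))))))) (bernoulli (inv-≥0 N) c)
  pow≤ : ∀ t → pow (base N′) t ≤ pow (base N) (c ℕ.* t)
  pow≤ zero = ℚₚ.≤-reflexive (cong (pow (base N)) (sym (ℕₚ.*-zeroʳ c)))
  pow≤ (suc t) = subst (pow (base N′) (suc t) ≤_) (trans (sym (pow-+ (base N) c (c ℕ.* t))) (cong (pow (base N)) (sym (ℕₚ.*-suc c t))))
    (*-mono (ℚₚ.≤-trans 0≤1 (base-≥1 N′)) (pow-≥0 (base-≥1 N) (c ℕ.* t)) base≤ (pow≤ t))
  go : ∀ k → Bad s N Q i o k → Bad s N′ Q i′ o′ k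
  go k (mkBad bad) = mkBad (begin-strict
    pow (base N′) i′ * h₁ ≡⟨ cong (_* h₁) (trans (cong (pow (base N′)) i′≡) (pow-+ (base N′) o′ t)) ⟩
    (pow (base N′) o′ * pow (base N′) t) * h₁ ≡⟨ ℚₚ.*-assoc (pow (base N′) o′) (pow (base N′) t) h₁ ⟩
    pow (base N′) o′ * (pow (base N′) t * h₁) <⟨ *-monoˡ-< (ℚₚ.<-≤-trans 0<1 (pow-≥1 (base-≥1 N′) o′)) (ℚₚ.≤-<-trans (*-monoʳ (h-≥0 Q (val (shift₁ s) k)) (pow≤ t)) lt) ⟩
    pow (base N′) o′ * h₂ ∎)
    where
    h₁ = h Q (val (shift₁ s) k)
    h₂ = h Q (val (shift₂ s) k)
    lt : pow (base N) (c ℕ.* t) * h₁ < h₂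
    lt = *-cancelˡ-< (pow-≥0 (base-≥1 N) o) (ℚₚ.≤-<-trans (ℚₚ.≤-trans (ℚₚ.≤-reflexive (trans (sym (ℚₚ.*-assoc (pow (base N) o) (pow (base N) (c ℕ.* t)) h₁)) (cong (_* h₁) (sym (pow-+ (base N) o (c ℕ.* t))))))
      (*-monoʳ (h-≥0 Q (val (shift₁ s) k)) (pow-mono (base-≥1 N) o+ct≤i))) bad)

-- Conditioning on the power of one prime

smooth-* : ∀ {p Q M} → Smooth (p ℕ.* Q) M → Smooth (p ℕ.* Q) (M ℕ.* p)
smooth-* {p} {Q} {M} sm {e} c = subst (Coprime e) (ℕₚ.*-assoc 2 M p) (coprime-* (sm c) (coprime-∣ʳ (m∣m*n Q) c))

sub-progression : ∀ r M p j i → r ℕ.+ M ℕ.* (j ℕ.* p ℕ.+ i) ≡ (r ℕ.+ M ℕ.* i) ℕ.+ (M ℕ.* p) ℕ.* j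
sub-progression = solveℕ 5 (λ r M p j i → r ⊕ M ⊗ (j ⊗ p ⊕ i) ≐ (r ⊕ M ⊗ i) ⊕ (M ⊗ p) ⊗ j) refl

uavg-cong : ∀ {f g q} → (∀ i → f i ≡ g i) → UAvg g q → UAvg f q
uavg-cong eq = uavg-mono (λ i → ℚₚ.≤-reflexive (eq i))

-- The progressions on which the number with shift c is p ^ l times a number
-- running through all residues mod p.
record PowBranch (c p Q : ℕ) (g : ℕ → ℚ) (l : ℕ) (v : ℚ) : Set where
  field
    on : ∀ r M α β → Smooth (p ℕ.* Q) M → Coprime p β → (∀ j → val c (r ℕ.+ M ℕ.* j) ≡ p ℕ.^ l ℕ.* (α ℕ.+ β ℕ.* j)) → UAvg (λ j → g (r ℕ.+ M ℕ.* j)) v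
open PowBranch

branch-last : ∀ {c p Q g l v} → (∀ r M → Smooth (p ℕ.* Q) M → (∀ j → p ℕ.^ l ∣ val c (r ℕ.+ M ℕ.* j)) → UAvg (λ j → g (r ℕ.+ M ℕ.* j)) v) → PowBranch c p Q g l v
branch-last {p = p} {l = l} L .on r M α β sm cop eq = L r M sm λ j → subst (p ℕ.^ l ∣_) (sym (eq j)) (m∣m*n (α ℕ.+ β ℕ.* j))

-- As β is prime to p, exactly one residue of j mod p brings in a further factor p and leads to the
-- branch of suc l; on the other p - 1 residues the exponent is exactly l.
branch-mix : ∀ {c p Q} → Prime p → ∀ {g : ℕ → ℚ} → (∀ k → 0ℚ ≤ g k) → ∀ {l v H} → 0ℚ ≤ v → 0ℚ ≤ H →
  (∀ r M → Smooth (p ℕ.* Q) M → (∀ j → p ℕ.^ l ∣ val c (r ℕ.+ M ℕ.* j)) → (∀ j → ¬ p ℕ.^ suc l ∣ val c (r ℕ.+ M ℕ.* j)) → UAvg (λ j → g (r ℕ.+ M ℕ.* j)) v) →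
  PowBranch c p Q g (suc l) H → PowBranch c p Q g l (((ι p - 1ℚ) * v + H) * inv p)
branch-mix {c} {p} {Q} pp {g} g≥0 {l} {v} {H} v≥0 H≥0 L B .on r M α β sm cop eq =
  uavg-≤ (ℚₚ.≤-reflexive (cong (_* inv p) sumw)) (uavg-split p (prime>0 pp) w (λ j → g≥0 _) w≥0 sub)
  where
  d? = λ i → p ∣? α ℕ.+ β ℕ.* i
  w : ℕ → ℚ
  -- The case distinction is written linearly in the indicator, so that `∑-residue` evaluates its
  -- sum.
  w i = v + 𝟙 (d? i) * (H - v)
  w≥0 : ∀ i → 0ℚ ≤ w i
  w≥0 i with d? i in e
  ... | yes d = subst (0ℚ ≤_) (solve 2 (λ v H → H := v :+ con 1ℚ :* (H :- v)) refl v H) H≥0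
  ... | no ¬d = subst (0ℚ ≤_) (solve 2 (λ v H → v := v :+ con 0ℚ :* (H :- v)) refl v H) v≥0
  sumw : ∑ p w ≡ (ι p - 1ℚ) * v + H
  sumw = trans (∑-+ p _ _) (trans (cong₂ _+_ (∑-const p v) (trans (∑-*ʳ p (H - v) _) (cong (_* (H - v)) (∑-residue p (prime>0 pp) α β cop))))
    (solve 3 (λ p v H → p :* v :+ con 1ℚ :* (H :- v) := (p :- con 1ℚ) :* v :+ H) refl (ι p) v H))
  eq′ : ∀ i j → val c ((r ℕ.+ M ℕ.* i) ℕ.+ (M ℕ.* p) ℕ.* j) ≡ p ℕ.^ l ℕ.* ((α ℕ.+ β ℕ.* i) ℕ.+ (β ℕ.* p) ℕ.* j)
  eq′ i j = trans (cong (val c) (sym (sub-progression r M p j i))) (trans (eq (j ℕ.* p ℕ.+ i)) (cong (p ℕ.^ l ℕ.*_) (sub-progression α β p j i)))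
  sub : ∀ i → i ℕ.< p → UAvg (λ j → g (r ℕ.+ M ℕ.* (j ℕ.* p ℕ.+ i))) (w i)
  sub i _ with d? i
  ... | yes d@(divides a ea) = uavg-cong (λ j → cong g (sub-progression r M p j i)) (uavg-≤ (ℚₚ.≤-reflexive (solve 2 (λ v H → H := v :+ con 1ℚ :* (H :- v)) refl v H))
     (B .on (r ℕ.+ M ℕ.* i) (M ℕ.* p) a β (smooth-* {p} {Q} {M} sm) cop
       (λ j → trans (eq′ i j) (trans (cong (λ k → p ℕ.^ l ℕ.* (k ℕ.+ (β ℕ.* p) ℕ.* j)) ea)
         (solveℕ 5 (λ P a p b j → P ⊗ (a ⊗ p ⊕ (b ⊗ p) ⊗ j) ≐ (p ⊗ P) ⊗ (a ⊕ b ⊗ j)) refl (p ℕ.^ l) a p β j)))))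
  ... | no ¬d = uavg-cong (λ j → cong g (sub-progression r M p j i)) (uavg-≤ (ℚₚ.≤-reflexive (solve 2 (λ v H → v := v :+ con 0ℚ :* (H :- v)) refl v H))
     (L (r ℕ.+ M ℕ.* i) (M ℕ.* p) (smooth-* {p} {Q} {M} sm) (λ j → subst (p ℕ.^ l ∣_) (sym (eq′ i j)) (m∣m*n ((α ℕ.+ β ℕ.* i) ℕ.+ (β ℕ.* p) ℕ.* j)))
       λ j dd → ¬d (∣m+n∣m⇒∣n (subst (p ∣_) (ℕₚ.+-comm (α ℕ.+ β ℕ.* i) _) (∣-cancel {p ℕ.^ l} (ℕₚ.m^n>0 p {{ℕ.>-nonZero (prime>0 pp)}} l) (subst₂ _∣_ (ℕₚ.*-comm p (p ℕ.^ l)) (eq′ i j) dd))) (∣m⇒∣m*n j (n∣m*n β)))))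

-- The lower bound for the contribution of p to n₁ is valid for every exponent from suc l on, so the
-- branching may stop at any power; n₂ is prime to p.
level-up : ∀ {s N p Q i o l v} u → Prime p → Coprime p Q → pow (base N) u ≤ geo (inv p) (suc l) → Sound s N (p ℕ.* Q) (u ℕ.+ i) o v →
  ∀ r M → Smooth (p ℕ.* Q) M → (∀ j → p ℕ.^ suc l ∣ val (shift₁ s) (r ℕ.+ M ℕ.* j)) → UAvg (λ j → 𝟙 (bad? s N Q i o (r ℕ.+ M ℕ.* j))) v
level-up {s} {N} {p} {Q} {i} {o} {l} u pp cop le S r M sm d = uavg-mono (λ j → 𝟙-mono (bad? s N Q i o (r ℕ.+ M ℕ.* j)) (bad? s N (p ℕ.* Q) (u ℕ.+ i) o (r ℕ.+ M ℕ.* j)) (go (r ℕ.+ M ℕ.* j) (d j))) (S .along r M sm)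
  where
  go : ∀ k → p ℕ.^ suc l ∣ val (shift₁ s) k → Bad s N Q i o k → Bad s N (p ℕ.* Q) (u ℕ.+ i) o k
  go k d (mkBad bad) = mkBad (begin-strict
    pow (base N) (u ℕ.+ i) * h (p ℕ.* Q) n₁ ≡⟨ trans (cong (_* h (p ℕ.* Q) n₁) (pow-+ (base N) u i)) (solve 3 (λ a b c → (a :* b) :* c := b :* (a :* c)) refl (pow (base N) u) (pow (base N) i) (h (p ℕ.* Q) n₁)) ⟩
    pow (base N) i * (pow (base N) u * h (p ℕ.* Q) n₁) ≤⟨ *-monoˡ (pow-≥0 (base-≥1 N) i) (ℚₚ.≤-trans (*-monoʳ (h-≥0 (p ℕ.* Q) n₁) le) (h-lower pp cop (suc l) (val>0 s k) d)) ⟩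
    pow (base N) i * h Q n₁ <⟨ bad ⟩
    pow (base N) o * h Q n₂ ≡⟨ cong (pow (base N) o *_) (h-∤ pp (val-sep s k pp (∣-trans (m∣m*n (p ℕ.^ l)) d))) ⟩
    pow (base N) o * h (p ℕ.* Q) n₂ ∎)
    where
    open ℚₚ.≤-Reasoning
    n₁ = val (shift₁ s) k
    n₂ = val (shift₂ s) k

-- For n₂ the contribution must be bounded from above: `down-exact` does so for an exact power,
-- `down-top` for all remaining powers at once.
level-down : ∀ {s N p Q i o v} d → Prime p → Coprime p Q → Sound s N (p ℕ.* Q) i (d ℕ.+ o) v →
  ∀ r M → Smooth (p ℕ.* Q) M → (∀ j → p ∣ val (shift₂ s) (r ℕ.+ M ℕ.* j)) →
  (∀ j → h Q (val (shift₂ s) (r ℕ.+ M ℕ.* j)) ≤ pow (base N) d * h (p ℕ.* Q) (val (shift₂ s) (r ℕ.+ M ℕ.* j))) → UAvg (λ j → 𝟙 (bad? s N Q i o (r ℕ.+ M ℕ.* j))) v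
level-down {s} {N} {p} {Q} {i} {o} d pp cop S r M sm dvd le = uavg-mono (λ j → 𝟙-mono (bad? s N Q i o (r ℕ.+ M ℕ.* j)) (bad? s N (p ℕ.* Q) i (d ℕ.+ o) (r ℕ.+ M ℕ.* j)) (go (r ℕ.+ M ℕ.* j) (dvd j) (le j))) (S .along r M sm)
  where
  go : ∀ k → p ∣ val (shift₂ s) k → h Q (val (shift₂ s) k) ≤ pow (base N) d * h (p ℕ.* Q) (val (shift₂ s) k) → Bad s N Q i o k → Bad s N (p ℕ.* Q) i (d ℕ.+ o) k
  go k dv le (mkBad bad) = mkBad (begin-strict
    pow (base N) i * h (p ℕ.* Q) n₁ ≡⟨ cong (pow (base N) i *_) (sym (h-∤ pp λ x → val-sep s k pp x dv)) ⟩
    pow (base N) i * h Q n₁ <⟨ bad ⟩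
    pow (base N) o * h Q n₂ ≤⟨ *-monoˡ (pow-≥0 (base-≥1 N) o) le ⟩
    pow (base N) o * (pow (base N) d * h (p ℕ.* Q) n₂) ≡⟨ trans (solve 3 (λ a b c → b :* (a :* c) := (a :* b) :* c) refl (pow (base N) d) (pow (base N) o) (h (p ℕ.* Q) n₂)) (cong (_* h (p ℕ.* Q) n₂) (sym (pow-+ (base N) d o))) ⟩
    pow (base N) (d ℕ.+ o) * h (p ℕ.* Q) n₂ ∎)
    where
    open ℚₚ.≤-Reasoning
    n₁ = val (shift₁ s) k
    n₂ = val (shift₂ s) k

down-exact : ∀ {N p Q l d m} → Prime p → Coprime p Q → 0 ℕ.< m → geo (inv p) l ≤ pow (base N) d → ¬ p ℕ.^ suc l ∣ m → h Q m ≤ pow (base N) d * h (p ℕ.* Q) m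
down-exact {p = p} {Q} {l} {m = m} pp cop 0<m le ¬d = ℚₚ.≤-trans (h-upper pp cop l 0<m ¬d) (*-monoʳ (h-≥0 (p ℕ.* Q) m) le)

down-top : ∀ {N p Q d m} → Prime p → Coprime p Q → 0 ℕ.< m → 1ℚ ≤ (1ℚ - inv p) * pow (base N) d → h Q m ≤ pow (base N) d * h (p ℕ.* Q) m
down-top {N} {p} {Q} {d} {m} pp cop 0<m le = begin
  h Q m ≡⟨ sym (ℚₚ.*-identityʳ (h Q m)) ⟩
  h Q m * 1ℚ ≤⟨ *-monoˡ (h-≥0 Q m) le ⟩
  h Q m * ((1ℚ - inv p) * pow (base N) d) ≡⟨ solve 3 (λ H i b → H :* ((con 1ℚ :- i) :* b) := b :* (H :- i :* H)) refl (h Q m) (inv p) (pow (base N) d) ⟩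
  pow (base N) d * (h Q m - inv p * h Q m) ≤⟨ *-monoˡ (pow-≥0 (base-≥1 N) d) (≤-diff _ (diff-≥0 (h-top pp cop 0<m)) (solve 3 (λ H i K → (H :- i :* H) :+ ((K :+ i :* H) :- H) := K) refl (h Q m) (inv p) (h (p ℕ.* Q) m))) ⟩
  pow (base N) d * h (p ℕ.* Q) m ∎
  where open ℚₚ.≤-Reasoning

-- One residue class mod p is removed for each of the two numbers; inside it the exact power of p decides.
sound-step : ∀ {s N p Q i o v H₁ H₂} → Prime p → Coprime p Q → 0ℚ ≤ v → 0ℚ ≤ H₁ → 0ℚ ≤ H₂ → Sound s N (p ℕ.* Q) i o v →
  PowBranch (shift₁ s) p Q (λ k → 𝟙 (bad? s N Q i o k)) 1 H₁ → PowBranch (shift₂ s) p Q (λ k → 𝟙 (bad? s N Q i o k)) 1 H₂ →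
  Sound s N Q i o (((ι p - (1ℚ + 1ℚ)) * v + H₁ + H₂) * inv p)
sound-step {s} {N} {p} {Q} {i₀} {o} {v} {H₁} {H₂} pp cop v≥0 H₁≥0 H₂≥0 S B₁ B₂ .along r M sm =
  uavg-≤ (ℚₚ.≤-reflexive (cong (_* inv p) sumw)) (uavg-split p (prime>0 pp) w (λ j → 𝟙-≥0 (bad? s N Q i₀ o (r ℕ.+ M ℕ.* j))) w≥0 sub)
  where
  c₁ = shift₁ s
  c₂ = shift₂ s
  g = λ k → 𝟙 (bad? s N Q i₀ o k)
  -- A prime not yet processed is prime to the slope, so each of the two numbers is divisible by p
  -- for exactly one residue of j.
  cop2M : Coprime p (2 ℕ.* M)
  cop2M = sm cop
  sm′ : Smooth (p ℕ.* Q) (M ℕ.* p)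
  sm′ = smooth-* {p} {Q} {M} (λ c → sm (coprime-∣ʳ (n∣m*n p) c))
  form : ∀ c i → (2 ℕ.* r ℕ.+ c) ℕ.+ (2 ℕ.* M) ℕ.* i ≡ val c (r ℕ.+ M ℕ.* i)
  form c i = trans (solveℕ 4 (λ r c M i → (# 2 ⊗ r ⊕ c) ⊕ (# 2 ⊗ M) ⊗ i ≐ # 2 ⊗ (r ⊕ M ⊗ i) ⊕ c) refl r c M i) (sym (val-def c (r ℕ.+ M ℕ.* i)))
  d? : ∀ c i → Dec (p ∣ (2 ℕ.* r ℕ.+ c) ℕ.+ (2 ℕ.* M) ℕ.* i)
  d? c i = p ∣? (2 ℕ.* r ℕ.+ c) ℕ.+ (2 ℕ.* M) ℕ.* i
  excl : ∀ i → p ∣ (2 ℕ.* r ℕ.+ c₁) ℕ.+ (2 ℕ.* M) ℕ.* i → ¬ p ∣ (2 ℕ.* r ℕ.+ c₂) ℕ.+ (2 ℕ.* M) ℕ.* i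
  excl i a b = val-sep s (r ℕ.+ M ℕ.* i) pp (subst (p ∣_) (form c₁ i) a) (subst (p ∣_) (form c₂ i) b)
  w : ℕ → ℚ
  w i = v + 𝟙 (d? c₁ i) * (H₁ - v) + 𝟙 (d? c₂ i) * (H₂ - v)
  cases : ∀ i → (p ∣ (2 ℕ.* r ℕ.+ c₁) ℕ.+ (2 ℕ.* M) ℕ.* i × w i ≡ H₁) ⊎ (p ∣ (2 ℕ.* r ℕ.+ c₂) ℕ.+ (2 ℕ.* M) ℕ.* i × w i ≡ H₂)
    ⊎ ((¬ p ∣ (2 ℕ.* r ℕ.+ c₁) ℕ.+ (2 ℕ.* M) ℕ.* i × ¬ p ∣ (2 ℕ.* r ℕ.+ c₂) ℕ.+ (2 ℕ.* M) ℕ.* i) × w i ≡ v)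
  cases i with d? c₁ i | d? c₂ i
  ... | yes a | yes b = ⊥-elim (excl i a b)
  ... | yes a | no b = inj₁ (a , solve 3 (λ v H K → v :+ con 1ℚ :* (H :- v) :+ con 0ℚ :* (K :- v) := H) refl v H₁ H₂)
  ... | no a | yes b = inj₂ (inj₁ (b , solve 3 (λ v H K → v :+ con 0ℚ :* (H :- v) :+ con 1ℚ :* (K :- v) := K) refl v H₁ H₂))
  ... | no a | no b = inj₂ (inj₂ ((a , b) , solve 3 (λ v H K → v :+ con 0ℚ :* (H :- v) :+ con 0ℚ :* (K :- v) := v) refl v H₁ H₂))
  w≥0 : ∀ i → 0ℚ ≤ w i
  w≥0 i with cases i
  ... | inj₁ (_ , e) = subst (0ℚ ≤_) (sym e) H₁≥0
  ... | inj₂ (inj₁ (_ , e)) = subst (0ℚ ≤_) (sym e) H₂≥0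
  ... | inj₂ (inj₂ (_ , e)) = subst (0ℚ ≤_) (sym e) v≥0
  one : ∀ c → ∑ p (λ i → 𝟙 (d? c i)) ≡ 1ℚ
  one c = ∑-residue p (prime>0 pp) (2 ℕ.* r ℕ.+ c) (2 ℕ.* M) cop2M
  sumw : ∑ p w ≡ (ι p - (1ℚ + 1ℚ)) * v + H₁ + H₂
  sumw = trans (trans (∑-+ p _ _) (cong (_+ ∑ p (λ i → 𝟙 (d? c₂ i) * (H₂ - v))) (∑-+ p _ _)))
    (trans (cong₂ _+_ (cong₂ _+_ (∑-const p v) (trans (∑-*ʳ p (H₁ - v) _) (cong (_* (H₁ - v)) (one c₁)))) (trans (∑-*ʳ p (H₂ - v) _) (cong (_* (H₂ - v)) (one c₂))))
    (solve 4 (λ p v H K → p :* v :+ con 1ℚ :* (H :- v) :+ con 1ℚ :* (K :- v) := (p :- (con 1ℚ :+ con 1ℚ)) :* v :+ H :+ K) refl (ι p) v H₁ H₂))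
  val-sub : ∀ c i j → val c ((r ℕ.+ M ℕ.* i) ℕ.+ (M ℕ.* p) ℕ.* j) ≡ ((2 ℕ.* r ℕ.+ c) ℕ.+ (2 ℕ.* M) ℕ.* i) ℕ.+ p ℕ.* ((2 ℕ.* M) ℕ.* j)
  val-sub c i j = trans (val-def c _) (solveℕ 6 (λ r c M i p j → # 2 ⊗ ((r ⊕ M ⊗ i) ⊕ (M ⊗ p) ⊗ j) ⊕ c ≐
     ((# 2 ⊗ r ⊕ c) ⊕ (# 2 ⊗ M) ⊗ i) ⊕ p ⊗ ((# 2 ⊗ M) ⊗ j)) refl r c M i p j)
  inside : ∀ c {H} → PowBranch c p Q g 1 H → ∀ i → p ∣ (2 ℕ.* r ℕ.+ c) ℕ.+ (2 ℕ.* M) ℕ.* i → UAvg (λ j → g ((r ℕ.+ M ℕ.* i) ℕ.+ (M ℕ.* p) ℕ.* j)) H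
  inside c B i (divides a ea) = B .on (r ℕ.+ M ℕ.* i) (M ℕ.* p) a (2 ℕ.* M) sm′ cop2M
    (λ j → trans (val-sub c i j) (trans (cong (ℕ._+ p ℕ.* ((2 ℕ.* M) ℕ.* j)) ea)
      (solveℕ 3 (λ a p y → a ⊗ p ⊕ p ⊗ y ≐ (p ⊗ # 1) ⊗ (a ⊕ y)) refl a p ((2 ℕ.* M) ℕ.* j))))
  outside : ∀ c i j → ¬ p ∣ (2 ℕ.* r ℕ.+ c) ℕ.+ (2 ℕ.* M) ℕ.* i → ¬ p ∣ val c ((r ℕ.+ M ℕ.* i) ℕ.+ (M ℕ.* p) ℕ.* j)
  outside c i j ¬d d = ¬d (∣m+n∣m⇒∣n (subst (p ∣_) (trans (val-sub c i j) (ℕₚ.+-comm ((2 ℕ.* r ℕ.+ c) ℕ.+ (2 ℕ.* M) ℕ.* i) _)) d) (m∣m*n ((2 ℕ.* M) ℕ.* j)))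
  sub : ∀ i → i ℕ.< p → UAvg (λ j → g (r ℕ.+ M ℕ.* (j ℕ.* p ℕ.+ i))) (w i)
  sub i _ with cases i
  ... | inj₁ (d , e) = uavg-cong (λ j → cong g (sub-progression r M p j i)) (uavg-≤ (ℚₚ.≤-reflexive (sym e)) (inside c₁ B₁ i d))
  ... | inj₂ (inj₁ (d , e)) = uavg-cong (λ j → cong g (sub-progression r M p j i)) (uavg-≤ (ℚₚ.≤-reflexive (sym e)) (inside c₂ B₂ i d))
  ... | inj₂ (inj₂ ((a , b) , e)) = uavg-cong (λ j → cong g (sub-progression r M p j i)) (uavg-≤ (ℚₚ.≤-reflexive (sym e))
     (uavg-mono (λ j → 𝟙-mono (bad? s N Q i₀ o ((r ℕ.+ M ℕ.* i) ℕ.+ (M ℕ.* p) ℕ.* j)) (bad? s N (p ℕ.* Q) i₀ o ((r ℕ.+ M ℕ.* i) ℕ.+ (M ℕ.* p) ℕ.* j)) (λ (mkBad bad) → mkBad (subst₂ _<_ (cong (pow (base N) i₀ *_) (h-∤ pp (outside c₁ i j a))) (cong (pow (base N) o *_) (h-∤ pp (outside c₂ i j b))) bad)))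
       (S .along (r ℕ.+ M ℕ.* i) (M ℕ.* p) sm′)))

-- Inverse squares of the numbers prime to Q

ZetaBound : ℕ → ℚ → Set
ZetaBound Q z = ∀ X → ∑ X (λ i → 𝟙 (coprime? (suc i) Q) * (inv (suc i) * inv (suc i))) ≤ z

private
  Z : ℕ → ℕ → ℚ
  Z Q X = ∑ X (λ i → 𝟙 (coprime? (suc i) Q) * (inv (suc i) * inv (suc i)))

  sq-≥0 : ∀ Q i → 0ℚ ≤ 𝟙 (coprime? (suc i) Q) * (inv (suc i) * inv (suc i))
  sq-≥0 Q i = term-≥0 (coprime? (suc i) Q) (*-≥0 (inv-≥0 (suc i)) (inv-≥0 (suc i)))

  zeta-recurrence : ∀ {p Q} → Prime p → Coprime p Q → ∀ X → Z Q (X ℕ.* p) ≡ Z (p ℕ.* Q) (X ℕ.* p) + (inv p * inv p) * Z Q X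
  zeta-recurrence {p} {Q} pp cop X = trans (∑-coprime-split pp cop X (λ e → inv e * inv e)) (cong (Z (p ℕ.* Q) (X ℕ.* p) +_)
    (trans (∑-cong X λ i _ → trans (cong (λ k → 𝟙 (coprime? (suc i) Q) * (k * k)) (inv-* (prime>0 pp) ℕ.z<s))
       (solve 3 (λ a b c → a :* ((b :* c) :* (b :* c)) := (b :* b) :* (a :* (c :* c))) refl (𝟙 (coprime? (suc i) Q)) (inv p) (inv (suc i)))) (∑-*ˡ X (inv p * inv p) _)))

  -- The recurrence is iterated j times. The range grows by p ^ j, which is harmless because
  -- `ZetaBound` is uniform in the range.
  zeta-geo : ∀ {p Q} → Prime p → Coprime p Q → ∀ j X → geo (inv p * inv p) j * Z (p ℕ.* Q) X ≤ Z Q (X ℕ.* p ℕ.^ j)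
  zeta-geo {p} {Q} pp cop zero X = subst₂ _≤_ (sym (ℚₚ.*-identityˡ (Z (p ℕ.* Q) X))) (cong (Z Q) (sym (ℕₚ.*-identityʳ X)))
    (∑-mono X λ i _ → *-monoʳ (*-≥0 (inv-≥0 (suc i)) (inv-≥0 (suc i))) (𝟙-mono (coprime? (suc i) (p ℕ.* Q)) (coprime? (suc i) Q) (coprime-∣ʳ (n∣m*n p))))
  zeta-geo {p} {Q} pp cop (suc j) X = begin
    (1ℚ + q * geo q j) * Z (p ℕ.* Q) X ≡⟨ solve 3 (λ q g z → (con 1ℚ :+ q :* g) :* z := z :+ q :* (g :* z)) refl q (geo q j) (Z (p ℕ.* Q) X) ⟩
    Z (p ℕ.* Q) X + q * (geo q j * Z (p ℕ.* Q) X) ≤⟨ ℚₚ.+-mono-≤ (∑-extend (subst (X ℕ.≤_) eq (ℕₚ.m≤m*n X (p ℕ.^ suc j) {{ℕ.>-nonZero (ℕₚ.m^n>0 p {{ℕ.>-nonZero (prime>0 pp)}} (suc j))}})) (sq-≥0 (p ℕ.* Q)))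
        (*-monoˡ (*-≥0 (inv-≥0 p) (inv-≥0 p)) (zeta-geo pp cop j X)) ⟩
    Z (p ℕ.* Q) ((X ℕ.* p ℕ.^ j) ℕ.* p) + q * Z Q (X ℕ.* p ℕ.^ j) ≡⟨ sym (zeta-recurrence pp cop (X ℕ.* p ℕ.^ j)) ⟩
    Z Q ((X ℕ.* p ℕ.^ j) ℕ.* p) ≡⟨ cong (Z Q) (sym eq) ⟩
    Z Q (X ℕ.* p ℕ.^ suc j) ∎
    where
    open ℚₚ.≤-Reasoning
    q = inv p * inv p
    eq : X ℕ.* p ℕ.^ suc j ≡ (X ℕ.* p ℕ.^ j) ℕ.* p
    eq = solveℕ 3 (λ X p P → X ⊗ (p ⊗ P) ≐ (X ⊗ P) ⊗ p) refl X p (p ℕ.^ j)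

-- Divides out the Euler factor at p, truncated after j + 1 terms.
zeta-step : ∀ {p Q z z′} → Prime p → Coprime p Q → ∀ j → z ≤ geo (inv p * inv p) j * z′ → ZetaBound Q z → ZetaBound (p ℕ.* Q) z′
zeta-step {p} {Q} pp cop j le B X = *-cancelˡ (ℚₚ.<-≤-trans 0<1 (geo-≥1 (*-≥0 (inv-≥0 p) (inv-≥0 p)) j))
  (ℚₚ.≤-trans (zeta-geo pp cop j X) (ℚₚ.≤-trans (B (X ℕ.* p ℕ.^ j)) le))

zeta-base : ∀ K → 0 ℕ.< K → ZetaBound 1 (∑ K (λ i → inv (suc i) * inv (suc i)) + inv K)
zeta-base K 0<K X = begin
  Z 1 X ≤⟨ ∑-extend (ℕₚ.m≤n+m X K) (sq-≥0 1) ⟩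
  Z 1 (K ℕ.+ X) ≤⟨ ∑-mono (K ℕ.+ X) (λ i _ → subst (𝟙 (coprime? (suc i) 1) * (inv (suc i) * inv (suc i)) ≤_) (ℚₚ.*-identityˡ _) (*-monoʳ (*-≥0 (inv-≥0 (suc i)) (inv-≥0 (suc i))) (𝟙-≤1 (coprime? (suc i) 1)))) ⟩
  ∑ (K ℕ.+ X) (λ i → inv (suc i) * inv (suc i)) ≡⟨ ∑-split K X _ ⟩
  ∑ K (λ i → inv (suc i) * inv (suc i)) + ∑ X (λ i → inv (suc (K ℕ.+ i)) * inv (suc (K ℕ.+ i))) ≤⟨ ℚₚ.+-monoʳ-≤ (∑ K (λ i → inv (suc i) * inv (suc i))) (inv-sq-tail K 0<K X) ⟩
  ∑ K (λ i → inv (suc i) * inv (suc i)) + inv K ∎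
  where open ℚₚ.≤-Reasoning

trunc-1 : ∀ Q m → trunc Q 1 m ≡ 1ℚ
trunc-1 Q m = trans (ℚₚ.+-identityˡ _) (trans (cong₂ _*_ (𝟙-yes (1 ∣? m) (1∣ m)) (trans (cong₂ _*_ (𝟙-yes (coprime? 1 Q) (Cop.1-coprimeTo Q)) inv-1) refl)) refl)

tail-sq : ∀ {Q z} → ZetaBound Q z → ∀ X → ∑ X (λ i → tailWt Q 1 (suc i) * inv (suc i)) ≤ z - 1ℚ
-- The empty sum needs z ≥ 1, which is read off from the term e = 1.
tail-sq {Q} {z} B zero = diff-≥0 (subst (_≤ z) (trans (ℚₚ.+-identityˡ _) (trans (cong₂ _*_ (𝟙-yes (coprime? 1 Q) (Cop.1-coprimeTo Q)) (cong₂ _*_ inv-1 inv-1)) refl)) (B 1))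
tail-sq {Q} {z} B (suc X) = ≤-diff (z - Z Q (suc X)) (diff-≥0 (B (suc X))) (begin
  ∑ (suc X) (λ i → tailWt Q 1 (suc i) * inv (suc i)) + (z - Z Q (suc X)) ≡⟨ cong₂ (λ a b → a + (z - b)) eq₁ eq₂ ⟩
  R + (z - (1ℚ + R)) ≡⟨ solve 2 (λ R z → R :+ (z :- (con 1ℚ :+ R)) := z :- con 1ℚ) refl R z ⟩
  z - 1ℚ ∎)
  where
  open ≡-Reasoning
  R = ∑ X (λ i → 𝟙 (coprime? (suc (suc i)) Q) * (inv (suc (suc i)) * inv (suc (suc i))))
  eq₁ : ∑ (suc X) (λ i → tailWt Q 1 (suc i) * inv (suc i)) ≡ R
  eq₁ = trans (∑-first X _) (trans (cong₂ _+_ (trans (cong (λ k → k * wt Q 1 * inv 1) (𝟙-no (1 ℕₚ.<? 1) (ℕₚ.<-irrefl refl))) (solve 2 (λ a b → con 0ℚ :* a :* b := con 0ℚ) refl (wt Q 1) (inv 1)))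
     (∑-cong X λ i _ → trans (cong (λ k → k * wt Q (suc (suc i)) * inv (suc (suc i))) (𝟙-yes (1 ℕₚ.<? suc (suc i)) (ℕ.s≤s ℕ.z<s)))
       (solve 2 (λ a b → con 1ℚ :* (a :* b) :* b := a :* (b :* b)) refl (𝟙 (coprime? (suc (suc i)) Q)) (inv (suc (suc i)))))) (ℚₚ.+-identityˡ R))
  eq₂ : Z Q (suc X) ≡ 1ℚ + R
  eq₂ = trans (∑-first X _) (cong (_+ R) (trans (cong₂ _*_ (𝟙-yes (coprime? 1 Q) (Cop.1-coprimeTo Q)) (cong₂ _*_ inv-1 inv-1)) refl))

-- Markov's inequality for the contribution of the divisors coprime to Q.
sound-tail : ∀ {s N Q z} o t → 0 ℕ.< N → 0 ℕ.< t → ZetaBound Q z → Sound s N Q (o ℕ.+ t) o ((ι N * inv t) * (z - 1ℚ))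
sound-tail {s} {N} {Q} {z} o t 0<N 0<t B .along r M sm = uavg-mono pw (uavg-scale (ι N * inv t) (*-≥0 (ι-≥0 N) (inv-≥0 t))
    (uavg-≤ (ℚₚ.≤-reflexive (ℚₚ.*-identityˡ (z - 1ℚ))) (uavg-cong (λ j → cong (dsum (tailWt Q 1)) (form j))
      (uavg-dsum {tailWt Q 1} {α} {2 ℕ.* M} {1ℚ} 0<α 0≤1 (tailWt-≥0 Q 1) (tailWt-≤ Q 1) cnt (tail-sq {Q} B)))))
  where
  c₂ = shift₂ s
  α = 2 ℕ.* r ℕ.+ c₂
  form : ∀ j → val c₂ (r ℕ.+ M ℕ.* j) ≡ α ℕ.+ (2 ℕ.* M) ℕ.* j
  form j = trans (val-def c₂ (r ℕ.+ M ℕ.* j)) (solveℕ 4 (λ r c M i → # 2 ⊗ (r ⊕ M ⊗ i) ⊕ c ≐ (# 2 ⊗ r ⊕ c) ⊕ (# 2 ⊗ M) ⊗ i) refl r c₂ M j)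
  0<α : 0 ℕ.< α
  0<α = subst (0 ℕ.<_) (val-def c₂ r) (val>0 (not s) r)
  -- A divisor prime to Q is prime to 2 M by smoothness; any other has weight 0.
  cnt : ∀ e → 0 ℕ.< e → ∀ x → tailWt Q 1 e * ∑ x (λ j → 𝟙 (e ∣? α ℕ.+ (2 ℕ.* M) ℕ.* j)) ≤ tailWt Q 1 e * (1ℚ * (ι x * inv e) + 1ℚ)
  cnt e 0<e x with coprime? e Q
  ... | yes cop = *-monoˡ (term-≥0 (1 ℕₚ.<? e) (*-≥0 0≤1 (inv-≥0 e))) (subst (λ k → ∑ x (λ j → 𝟙 (e ∣? α ℕ.+ (2 ℕ.* M) ℕ.* j)) ≤ k + 1ℚ) (sym (ℚₚ.*-identityˡ (ι x * inv e))) (count-multiples e 0<e α (2 ℕ.* M) (sm cop) x))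
  ... | no _ = ℚₚ.≤-reflexive (trans (zero-term (∑ x (λ j → 𝟙 (e ∣? α ℕ.+ (2 ℕ.* M) ℕ.* j)))) (sym (zero-term (1ℚ * (ι x * inv e) + 1ℚ))))
    where
    zero-term : ∀ y → (𝟙 (1 ℕₚ.<? e) * (0ℚ * inv e)) * y ≡ 0ℚ
    zero-term y = solve 3 (λ a b y → (a :* (con 0ℚ :* b)) :* y := con 0ℚ) refl (𝟙 (1 ℕₚ.<? e)) (inv e) y
  pw : ∀ j → 𝟙 (bad? s N Q (o ℕ.+ t) o (r ℕ.+ M ℕ.* j)) ≤ (ι N * inv t) * dsum (tailWt Q 1) (val c₂ (r ℕ.+ M ℕ.* j))
  pw j = 𝟙-≤ (bad? s N Q (o ℕ.+ t) o k) (*-≥0 (*-≥0 (ι-≥0 N) (inv-≥0 t)) τ≥0) go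
    where
    open ℚₚ.≤-Reasoning
    k = r ℕ.+ M ℕ.* j
    τ = dsum (tailWt Q 1) (val c₂ k)
    h₁ = h Q (val (shift₁ s) k)
    h₂ = h Q (val c₂ k)
    τ≥0 : 0ℚ ≤ τ
    τ≥0 = ∑-≥0 (val c₂ k) λ i _ → term-≥0 (suc i ∣? val c₂ k) (tailWt-≥0 Q 1 (suc i))
    go : Bad s N Q (o ℕ.+ t) o k → 1ℚ ≤ (ι N * inv t) * τ
    go (mkBad bad) = begin
      1ℚ ≡⟨ sym (trans (solve 4 (λ N t i j → (N :* i) :* (t :* j) := (i :* t) :* (j :* N)) refl (ι N) (ι t) (inv t) (inv N)) (trans (cong₂ _*_ (inv-ι′ 0<t) (inv-ι′ 0<N)) refl)) ⟩
      (ι N * inv t) * (ι t * inv N) ≤⟨ *-monoˡ (*-≥0 (ι-≥0 N) (inv-≥0 t)) τ-large ⟩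
      (ι N * inv t) * τ ∎
      where
      -- As h₁ ≥ 1, a failure forces h₂ above the t-th power of the base, which is at least 1 + t/N
      -- by Bernoulli. The term 1 of h₂ comes from the divisor 1, so the other divisors contribute
      -- at least t/N.
      lt : pow (base N) t < h₂
      lt = *-cancelˡ-< (pow-≥0 (base-≥1 N) o) (begin-strict
        pow (base N) o * pow (base N) t ≡⟨ trans (sym (pow-+ (base N) o t)) (sym (ℚₚ.*-identityʳ _)) ⟩
        pow (base N) (o ℕ.+ t) * 1ℚ ≤⟨ *-monoˡ (pow-≥0 (base-≥1 N) (o ℕ.+ t)) (h-≥1 Q (val>0 s k)) ⟩
        pow (base N) (o ℕ.+ t) * h₁ <⟨ bad ⟩
        pow (base N) o * h₂ ∎)
      τ-large : ι t * inv N ≤ τ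
      τ-large = ≤-diff (h₂ - (1ℚ + ι t * inv N)) (diff-≥0 (ℚₚ.≤-trans (bernoulli (inv-≥0 N) t) (ℚₚ.<⇒≤ lt)))
        (trans (cong (λ x → ι t * inv N + (x - (1ℚ + ι t * inv N))) (trans (h-trunc Q 1 (val>0 (not s) k)) (cong (_+ τ) (trunc-1 Q (val c₂ k)))))
          (solve 2 (λ x τ → x :+ ((con 1ℚ :+ τ) :- (con 1ℚ :+ x)) := τ) refl (ι t * inv N) τ))

-- Tables of fixed-point numbers

-- Entries count units of 10 ^ (-12), so the tables are computed with natural numbers only.
scale : ℕ
scale = 1000000000000

opaque
  fr : ℕ → ℚ
  fr x = ι x * inv scale

  fr-def : ∀ x → fr x ≡ ι x * inv scale
  fr-def x = refl

  fr-≥0 : ∀ x → 0ℚ ≤ fr x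
  fr-≥0 x = *-≥0 (ι-≥0 x) (inv-≥0 scale)

  fr-mono : ∀ {a b} → a ℕ.≤ b → fr a ≤ fr b
  fr-mono le = *-monoʳ (inv-≥0 scale) (ι-mono le)

  fr-+ : ∀ a b → fr (a ℕ.+ b) ≡ fr a + fr b
  fr-+ a b = trans (cong (_* inv scale) (ι-+ a b)) (ℚₚ.*-distribʳ-+ (inv scale) (ι a) (ι b))

  fr-* : ∀ a b → fr (a ℕ.* b) ≡ ι a * fr b
  fr-* a b = trans (cong (_* inv scale) (ι-* a b)) (ℚₚ.*-assoc (ι a) (ι b) (inv scale))

  fr-scale : fr scale ≡ 1ℚ
  fr-scale = trans (ℚₚ.*-comm (ι scale) (inv scale)) (inv-ι 999999999999)

ceilDiv-≤ : ∀ x q → x ℕ.≤ suc q ℕ.* ((x ℕ.+ q) / suc q)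
ceilDiv-≤ x q = ℕₚ.+-cancelʳ-≤ q x _ (ℕₚ.≤-trans (ℕₚ.≤-reflexive (m≡m%n+[m/n]*n (x ℕ.+ q) (suc q)))
  (subst ((x ℕ.+ q) % suc q ℕ.+ (x ℕ.+ q) / suc q ℕ.* suc q ℕ.≤_) (trans (ℕₚ.+-comm q _) (cong (ℕ._+ q) (ℕₚ.*-comm ((x ℕ.+ q) / suc q) (suc q))))
    (ℕₚ.+-monoˡ-≤ ((x ℕ.+ q) / suc q ℕ.* suc q) (ℕₚ.≤-pred (m%n<n (x ℕ.+ q) (suc q))))))

suc-/-≤ : ∀ x q → x ℕ.≤ suc q ℕ.* suc (x / suc q)
suc-/-≤ x q = ℕₚ.≤-trans (ℕₚ.≤-reflexive (m≡m%n+[m/n]*n x (suc q)))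
  (subst (x % suc q ℕ.+ x / suc q ℕ.* suc q ℕ.≤_) (ℕₚ.*-comm (suc (x / suc q)) (suc q)) (ℕₚ.+-monoˡ-≤ (x / suc q ℕ.* suc q) (ℕₚ.<⇒≤ (m%n<n x (suc q)))))

-- Weighted means over the residues mod suc q, rounded up.
mean₂ : ℕ → ℕ → ℕ → ℕ
mean₂ q x y = (q ℕ.* x ℕ.+ y ℕ.+ q) / suc q

mean₃ : ℕ → ℕ → ℕ → ℕ → ℕ
mean₃ q x y z = ((q ℕ.∸ 1) ℕ.* x ℕ.+ y ℕ.+ z ℕ.+ q) / suc q

mean₂-≤ : ∀ q x y → ((ι (suc q) - 1ℚ) * fr x + fr y) * inv (suc q) ≤ fr (mean₂ q x y)
mean₂-≤ q x y = *inv-≤ {suc q} ℕ.z<s (subst₂ _≤_ (trans (fr-+ (q ℕ.* x) y) (cong (_+ fr y) (trans (fr-* q x) (cong (_* fr x) (trans (solve 1 (λ a → a := (con 1ℚ :+ a) :- con 1ℚ) refl (ι q)) (cong (_- 1ℚ) (sym (ι-suc q))))))))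
  (fr-* (suc q) (mean₂ q x y)) (fr-mono (ceilDiv-≤ (q ℕ.* x ℕ.+ y) q)))

mean₃-≤ : ∀ q x y z → 0 ℕ.< q → ((ι (suc q) - (1ℚ + 1ℚ)) * fr x + fr y + fr z) * inv (suc q) ≤ fr (mean₃ q x y z)
mean₃-≤ (suc q) x y z _ = *inv-≤ {suc (suc q)} ℕ.z<s (subst₂ _≤_
   (trans (fr-+ (q ℕ.* x ℕ.+ y) z) (cong (_+ fr z) (trans (fr-+ (q ℕ.* x) y) (cong (_+ fr y) (trans (fr-* q x) (cong (_* fr x)
      (trans (solve 1 (λ a → a := (con 1ℚ :+ (con 1ℚ :+ a)) :- (con 1ℚ :+ con 1ℚ)) refl (ι q)) (cong (_- (1ℚ + 1ℚ)) (sym (trans (ι-suc (suc q)) (cong (1ℚ +_) (ι-suc q))))))))))))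
  (fr-* (suc (suc q)) (mean₃ (suc q) x y z)) (fr-mono (ceilDiv-≤ (q ℕ.* x ℕ.+ y ℕ.+ z) (suc q))))

-- In a table for the offset o, the entry with index i bounds the density of Bad with exponents i and o.

infixr 5 _∷!_
-- Strict in both arguments, so that the recursion does not pile up unevaluated means.
_∷!_ : ℕ → List ℕ → List ℕ
x ∷! xs = primForce x λ x → primForce xs λ xs → x ∷ xs

∷!-≡ : ∀ x xs → x ∷! xs ≡ x ∷ xs
∷!-≡ x xs = trans (primForceLemma x _) (primForceLemma xs _)

-- The last entry always survives: by monotonicity it is valid for all later indices.
drops : ℕ → List ℕ → List ℕ
drops (suc u) (_ ∷ y ∷ ys) = drops u (y ∷ ys)
drops _ ys = ys

-- Raising the offset by d moves the entries d places to the right; the vacated places get the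
-- trivial bound 1.
pad : ℕ → List ℕ → List ℕ
pad d W = replicate d scale ++ W

-- Shifted lists end at different places; here the shorter one is continued by its last entry,
-- whereas `mixDown` cuts the longer one.
mixUp : ℕ → List ℕ → List ℕ → List ℕ
mixUp q (x ∷ []) (y ∷ []) = mean₂ q x y ∷ []
mixUp q xs@(x ∷ []) (y ∷ ys@(_ ∷ _)) = mean₂ q x y ∷! mixUp q xs ys
mixUp q (x ∷ xs@(_ ∷ _)) ys@(y ∷ []) = mean₂ q x y ∷! mixUp q xs ys
mixUp q (x ∷ xs@(_ ∷ _)) (y ∷ ys@(_ ∷ _)) = mean₂ q x y ∷! mixUp q xs ys
mixUp q _ _ = []

mixDown : ℕ → List ℕ → List ℕ → List ℕ
mixDown q (x ∷ xs) (y ∷ ys) = mean₂ q x y ∷! mixDown q xs ys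
mixDown q _ _ = []

-- The second list has been shortened by shifting and is continued by its last entry, the third has
-- been lengthened and is cut, so a table keeps its length from prime to prime.
merge : ℕ → List ℕ → List ℕ → List ℕ → List ℕ
merge q (x ∷ xs) ys@(y ∷ []) (z ∷ zs) = mean₃ q x y z ∷! merge q xs ys zs
merge q (x ∷ xs) (y ∷ ys@(_ ∷ _)) (z ∷ zs) = mean₃ q x y z ∷! merge q xs ys zs
merge q _ _ _ = []

ups : ℕ → ℕ → List ℕ → List ℕ → List ℕ
ups q u [] W = drops u W
ups q u (u′ ∷ us) W = mixUp q (drops u W) (ups q u′ us W)

downs : ℕ → ℕ → List ℕ → List ℕ → List ℕ
downs q d [] W = pad d W
downs q d (d′ ∷ ds) W = mixDown q (pad d W) (downs q d′ ds W)

data From (S : ℕ → ℕ → Set) : ℕ → List ℕ → Set where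
  [] : ∀ {i} → From S i []
  _∷_ : ∀ {i x xs} → S i x → From S (suc i) xs → From S i (x ∷ xs)

Mono : (ℕ → ℕ → Set) → Set
Mono S = ∀ {i j x} → i ℕ.≤ j → S i x → S j x

private variable
  S S₁ S₂ S₃ S′ : ℕ → ℕ → Set

from-map : (∀ {i x} → S i x → S′ i x) → ∀ {i W} → From S i W → From S′ i W
from-map f [] = []
from-map f (x ∷ xs) = f x ∷ from-map f xs

from-offset : ∀ {u i W} → From S (u ℕ.+ i) W → From (λ t → S (u ℕ.+ t)) i W
from-offset [] = []
from-offset {S} {u} {i} {x ∷ xs} (s ∷ ss) = s ∷ from-offset {S} {u} (subst (λ k → From S k xs) (sym (ℕₚ.+-suc u i)) ss)

from-mono : Mono S → ∀ {i j W} → i ℕ.≤ j → From S i W → From S j W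
from-mono m le [] = []
from-mono m le (s ∷ ss) = m le s ∷ from-mono m (ℕ.s≤s le) ss

from-∷! : ∀ {i x xs} → S i x → From S (suc i) xs → From S i (x ∷! xs)
from-∷! {S} {i} {x} {xs} s ss = subst (From S i) (sym (∷!-≡ x xs)) (s ∷ ss)

drops-from : Mono S → ∀ u {i W} → From S i W → From S (u ℕ.+ i) (drops u W)
drops-from m zero w = w
drops-from m (suc u) [] = []
drops-from m (suc u) {i} (s ∷ []) = m (ℕₚ.m≤n+m i (suc u)) s ∷ []
drops-from {S} m (suc u) {i} {W} (_ ∷ s ∷ ss) = subst (λ k → From S k (drops (suc u) W)) (ℕₚ.+-suc u i) (drops-from m u (s ∷ ss))

mixUp-from : Mono S₁ → Mono S₂ → ∀ q → (∀ {i x y} → S₁ i x → S₂ i y → S₃ i (mean₂ q x y)) →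
  ∀ {i xs ys} → From S₁ i xs → From S₂ i ys → From S₃ i (mixUp q xs ys)
mixUp-from m₁ m₂ q f {i} {[]} {_} [] _ = []
mixUp-from m₁ m₂ q f {i} {x ∷ []} {[]} _ [] = []
mixUp-from m₁ m₂ q f {i} {x ∷ x′ ∷ xs} {[]} _ [] = []
mixUp-from m₁ m₂ q f {i} {x ∷ []} {y ∷ []} (s ∷ []) (t ∷ []) = f s t ∷ []
mixUp-from m₁ m₂ q f {i} {x ∷ []} {y ∷ y′ ∷ ys} (s ∷ []) (t ∷ ts) = from-∷! (f s t) (mixUp-from m₁ m₂ q f (m₁ (ℕₚ.n≤1+n i) s ∷ []) ts)
mixUp-from m₁ m₂ q f {i} {x ∷ x′ ∷ xs} {y ∷ []} (s ∷ ss) (t ∷ []) = from-∷! (f s t) (mixUp-from m₁ m₂ q f ss (m₂ (ℕₚ.n≤1+n i) t ∷ []))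
mixUp-from m₁ m₂ q f {i} {x ∷ x′ ∷ xs} {y ∷ y′ ∷ ys} (s ∷ ss) (t ∷ ts) = from-∷! (f s t) (mixUp-from m₁ m₂ q f ss ts)

mixDown-from : ∀ q → (∀ {i x y} → S₁ i x → S₂ i y → S₃ i (mean₂ q x y)) →
  ∀ {i xs ys} → From S₁ i xs → From S₂ i ys → From S₃ i (mixDown q xs ys)
mixDown-from q f [] _ = []
mixDown-from q f (s ∷ ss) [] = []
mixDown-from q f (s ∷ ss) (t ∷ ts) = from-∷! (f s t) (mixDown-from q f ss ts)

merge-from : Mono S₂ → ∀ q → (∀ {i x y z} → S₁ i x → S₂ i y → S₃ i z → S i (mean₃ q x y z)) →
  ∀ {i xs ys zs} → From S₁ i xs → From S₂ i ys → From S₃ i zs → From S i (merge q xs ys zs)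
merge-from m q f {i} {[]} [] _ _ = []
merge-from m q f {i} {x ∷ xs} {[]} (s ∷ ss) [] _ = []
merge-from m q f {i} {x ∷ xs} {y ∷ []} {[]} (s ∷ ss) (t ∷ []) [] = []
merge-from m q f {i} {x ∷ xs} {y ∷ y′ ∷ ys} {[]} (s ∷ ss) (t ∷ ts) [] = []
merge-from m q f {i} {x ∷ xs} {y ∷ []} {z ∷ zs} (s ∷ ss) (t ∷ []) (v ∷ vs) = from-∷! (f s t v) (merge-from m q f ss (m (ℕₚ.n≤1+n i) t ∷ []) vs)
merge-from m q f {i} {x ∷ xs} {y ∷ y′ ∷ ys} {z ∷ zs} (s ∷ ss) (t ∷ ts) (v ∷ vs) = from-∷! (f s t v) (merge-from m q f ss ts vs)

Entry : Bool → ℕ → ℕ → ℕ → ℕ → ℕ → Set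
Entry s N Q o i x = Sound s N Q i o (fr x)

entry-mono : ∀ {s N Q o} → Mono (Entry s N Q o)
entry-mono = sound-mono

pad-from : ∀ {s N Q o} d {W} → From (Entry s N Q o) 0 W → From (Entry s N Q (d ℕ.+ o)) 0 (pad d W)
pad-from {s} {N} {Q} {o} d {W} w = go d 0 (shifted w)
  where
  shifted : ∀ {i W} → From (Entry s N Q o) i W → From (Entry s N Q (d ℕ.+ o)) (d ℕ.+ i) W
  shifted [] = []
  shifted {i} {x ∷ xs} (e ∷ es) = sound-shift d e ∷ subst (λ k → From (Entry s N Q (d ℕ.+ o)) k xs) (ℕₚ.+-suc d i) (shifted es)
  go : ∀ e i → From (Entry s N Q (d ℕ.+ o)) (e ℕ.+ i) W → From (Entry s N Q (d ℕ.+ o)) i (replicate e scale ++ W)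
  go zero i w = w
  go (suc e) i w = sound-≤ (ℚₚ.≤-reflexive (sym fr-scale)) sound-1 ∷ go e (suc i) (subst (λ k → From (Entry s N Q (d ℕ.+ o)) k W) (sym (ℕₚ.+-suc e i)) w)

-- Verification of the grid shifts

-- p ^ l times the sum of p ^ (-i) over i ≤ l is suc (repunit p l).
repunit : ℕ → ℕ → ℕ
repunit p zero = 0
repunit p (suc l) = p ℕ.^ suc l ℕ.+ repunit p l

geo-repunit : ∀ {p} → 0 ℕ.< p → ∀ l → geo (inv p) l * ι (p ℕ.^ l) ≡ ι (suc (repunit p l))
geo-repunit {p} 0<p zero = trans (ℚₚ.*-identityˡ (ι 1)) refl
geo-repunit {p} 0<p (suc l) = begin
  (1ℚ + inv p * geo (inv p) l) * ι (p ℕ.* p ℕ.^ l) ≡⟨ cong ((1ℚ + inv p * geo (inv p) l) *_) (ι-* p (p ℕ.^ l)) ⟩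
  (1ℚ + inv p * geo (inv p) l) * (ι p * ι (p ℕ.^ l)) ≡⟨ solve 4 (λ i g p P → (con 1ℚ :+ i :* g) :* (p :* P) := p :* P :+ (i :* p) :* (g :* P)) refl (inv p) (geo (inv p) l) (ι p) (ι (p ℕ.^ l)) ⟩
  ι p * ι (p ℕ.^ l) + (inv p * ι p) * (geo (inv p) l * ι (p ℕ.^ l)) ≡⟨ cong₂ _+_ (sym (ι-* p (p ℕ.^ l))) (trans (cong₂ _*_ (inv-ι′ 0<p) (geo-repunit 0<p l)) (ℚₚ.*-identityˡ _)) ⟩
  ι (p ℕ.^ suc l) + ι (suc (repunit p l)) ≡⟨ trans (sym (ι-+ (p ℕ.^ suc l) (suc (repunit p l)))) (cong ι (ℕₚ.+-suc (p ℕ.^ suc l) (repunit p l))) ⟩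
  ι (suc (repunit p (suc l))) ∎
  where open ≡-Reasoning

base-pow : ∀ {N} → 0 ℕ.< N → ∀ n → pow (base N) n * ι (N ℕ.^ n) ≡ ι (suc N ℕ.^ n)
base-pow {N} 0<N zero = ℚₚ.*-identityˡ (ι 1)
base-pow {N} 0<N (suc n) = begin
  ((1ℚ + inv N) * pow (base N) n) * ι (N ℕ.* N ℕ.^ n) ≡⟨ cong (((1ℚ + inv N) * pow (base N) n) *_) (ι-* N (N ℕ.^ n)) ⟩
  ((1ℚ + inv N) * pow (base N) n) * (ι N * ι (N ℕ.^ n)) ≡⟨ solve 4 (λ i b N P → ((con 1ℚ :+ i) :* b) :* (N :* P) := (N :+ i :* N) :* (b :* P)) refl (inv N) (pow (base N) n) (ι N) (ι (N ℕ.^ n)) ⟩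
  (ι N + inv N * ι N) * (pow (base N) n * ι (N ℕ.^ n)) ≡⟨ cong₂ _*_ (trans (cong (ι N +_) (inv-ι′ 0<N)) (trans (ℚₚ.+-comm (ι N) 1ℚ) (sym (ι-suc N)))) (base-pow 0<N n) ⟩
  ι (suc N) * ι (suc N ℕ.^ n) ≡⟨ sym (ι-* (suc N) (suc N ℕ.^ n)) ⟩
  ι (suc N ℕ.^ suc n) ∎
  where open ≡-Reasoning

private
  pow>0 : ∀ {N} → 0 ℕ.< N → ∀ n → 0ℚ < ι (N ℕ.^ n)
  pow>0 {N} 0<N n = ι-pos (ℕₚ.m^n>0 N {{ℕ.>-nonZero 0<N}} n)

-- Comparisons of a power of the base with 1 + 1/p + ... + 1/p ^ l, and in `topOK` with p / (p - 1),
-- after clearing denominators.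
upOK downOK : ℕ → ℕ → ℕ → ℕ → Bool
upOK N p l u = suc N ℕ.^ u ℕ.* p ℕ.^ l ℕ.≤ᵇ N ℕ.^ u ℕ.* suc (repunit p l)
downOK N p l d = N ℕ.^ d ℕ.* suc (repunit p l) ℕ.≤ᵇ suc N ℕ.^ d ℕ.* p ℕ.^ l

topOK : ℕ → ℕ → ℕ → Bool
topOK N q d = suc q ℕ.* N ℕ.^ d ℕ.≤ᵇ q ℕ.* suc N ℕ.^ d

upOK-sound : ∀ {N p l u} → 0 ℕ.< N → 0 ℕ.< p → T (upOK N p l u) → pow (base N) u ≤ geo (inv p) l
upOK-sound {N} {p} {l} {u} 0<N 0<p ok = *-cancelˡ (*->0 (pow>0 0<N u) (pow>0 0<p l)) (subst₂ _≤_
  (trans (ι-* (suc N ℕ.^ u) (p ℕ.^ l)) (trans (cong (_* ι (p ℕ.^ l)) (sym (base-pow 0<N u))) (solve 3 (λ b n P → (b :* n) :* P := (n :* P) :* b) refl (pow (base N) u) (ι (N ℕ.^ u)) (ι (p ℕ.^ l)))))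
  (trans (ι-* (N ℕ.^ u) (suc (repunit p l))) (trans (cong (ι (N ℕ.^ u) *_) (sym (geo-repunit 0<p l))) (solve 3 (λ g n P → n :* (g :* P) := (n :* P) :* g) refl (geo (inv p) l) (ι (N ℕ.^ u)) (ι (p ℕ.^ l)))))
  (ι-mono (ℕₚ.≤ᵇ⇒≤ _ _ ok)))

downOK-sound : ∀ {N p l d} → 0 ℕ.< N → 0 ℕ.< p → T (downOK N p l d) → geo (inv p) l ≤ pow (base N) d
downOK-sound {N} {p} {l} {u} 0<N 0<p ok = *-cancelˡ (*->0 (pow>0 0<N u) (pow>0 0<p l)) (subst₂ _≤_
  (trans (ι-* (N ℕ.^ u) (suc (repunit p l))) (trans (cong (ι (N ℕ.^ u) *_) (sym (geo-repunit 0<p l))) (solve 3 (λ g n P → n :* (g :* P) := (n :* P) :* g) refl (geo (inv p) l) (ι (N ℕ.^ u)) (ι (p ℕ.^ l)))))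
  (trans (ι-* (suc N ℕ.^ u) (p ℕ.^ l)) (trans (cong (_* ι (p ℕ.^ l)) (sym (base-pow 0<N u))) (solve 3 (λ b n P → (b :* n) :* P := (n :* P) :* b) refl (pow (base N) u) (ι (N ℕ.^ u)) (ι (p ℕ.^ l)))))
  (ι-mono (ℕₚ.≤ᵇ⇒≤ _ _ ok)))

topOK-sound : ∀ {N q d} → 0 ℕ.< N → T (topOK N q d) → 1ℚ ≤ (1ℚ - inv (suc q)) * pow (base N) d
topOK-sound {N} {q} {d} 0<N ok = *-cancelˡ (*->0 (ι->0 q) (pow>0 0<N d)) (subst₂ _≤_
  (trans (ι-* (suc q) (N ℕ.^ d)) (sym (ℚₚ.*-identityʳ _)))
  (begin
    ι (q ℕ.* suc N ℕ.^ d) ≡⟨ ι-* q (suc N ℕ.^ d) ⟩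
    ι q * ι (suc N ℕ.^ d) ≡⟨ cong₂ _*_ (trans (solve 1 (λ a → a := (con 1ℚ :+ a) :- con 1ℚ) refl (ι q)) (cong₂ _-_ (sym (ι-suc q)) (sym (inv-ι q)))) (sym (base-pow 0<N d)) ⟩
    (ι (suc q) - inv (suc q) * ι (suc q)) * (pow (base N) d * ι (N ℕ.^ d)) ≡⟨ solve 4 (λ p i b n → (p :- i :* p) :* (b :* n) := (p :* n) :* ((con 1ℚ :- i) :* b)) refl (ι (suc q)) (inv (suc q)) (pow (base N) d) (ι (N ℕ.^ d)) ⟩
    (ι (suc q) * ι (N ℕ.^ d)) * ((1ℚ - inv (suc q)) * pow (base N) d) ∎)
  (ι-mono (ℕₚ.≤ᵇ⇒≤ _ _ ok)))
  where open ≡-Reasoning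

-- The last shift of a list serves all higher powers too. Upwards the finite geometric sum remains a
-- valid lower bound; downwards the full series is needed.
upsOK downsOK : ℕ → ℕ → ℕ → ℕ → List ℕ → Bool
upsOK N q l u [] = upOK N (suc q) l u
upsOK N q l u (u′ ∷ us) = upOK N (suc q) l u ∧ upsOK N q (suc l) u′ us
downsOK N q l d [] = topOK N q d
downsOK N q l d (d′ ∷ ds) = downOK N (suc q) l d ∧ downsOK N q (suc l) d′ ds

∧-T : ∀ {x y} → T (x ∧ y) → T x × T y
∧-T {true} t = tt , t

branch-mono : ∀ {s N p Q o l c} → Mono (λ i x → PowBranch c p Q (λ k → 𝟙 (bad? s N Q i o k)) l (fr x))
branch-mono {s} {N} {p} {Q} {o} {l} {c} {i} {j} i≤j B .on r M α β sm cop eq = uavg-mono (λ t → 𝟙-mono (bad? s N Q j o (r ℕ.+ M ℕ.* t)) (bad? s N Q i o (r ℕ.+ M ℕ.* t))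
  λ (mkBad bad) → mkBad (ℚₚ.≤-<-trans (*-monoʳ (h-≥0 Q (val (shift₁ s) (r ℕ.+ M ℕ.* t))) (pow-mono (base-≥1 N) i≤j)) bad)) (B .on r M α β sm cop eq)

branch-≤ : ∀ {c p Q g l v w} → v ≤ w → PowBranch c p Q g l v → PowBranch c p Q g l w
branch-≤ v≤w B .on r M α β sm cop eq = uavg-≤ v≤w (B .on r M α β sm cop eq)

ups-from : ∀ {s N q Q o} → 0 ℕ.< N → Prime (suc q) → Coprime (suc q) Q → ∀ l u us {W} → T (upsOK N q (suc l) u us) →
  From (Entry s N (suc q ℕ.* Q) o) 0 W → From (λ i x → PowBranch (shift₁ s) (suc q) Q (λ k → 𝟙 (bad? s N Q i o k)) (suc l) (fr x)) 0 (ups q u us W)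
ups-from {s} {N} {q} {Q} {o} 0<N pp cop l u [] ok w = from-map (λ {i} {x} S → branch-last λ r M sm d → level-up {l = l} u pp cop (upOK-sound {l = suc l} {u} 0<N ℕ.z<s ok) S r M sm d)
  (from-offset {u = u} (drops-from entry-mono u w))
ups-from {s} {N} {q} {Q} {o} 0<N pp cop l u (u′ ∷ us) ok w = mixUp-from (λ i≤j → sound-mono (ℕₚ.+-monoʳ-≤ u i≤j)) branch-mono q
  (λ {i} {x} {y} S B → branch-≤ (mean₂-≤ q x y) (branch-mix pp (λ k → 𝟙-≥0 (bad? s N Q i o k)) (fr-≥0 x) (fr-≥0 y)
     (λ r M sm d _ → level-up {l = l} u pp cop (upOK-sound {l = suc l} {u} 0<N ℕ.z<s (proj₁ (∧-T ok))) S r M sm d) B))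
  (from-offset {u = u} (drops-from entry-mono u w)) (ups-from 0<N pp cop (suc l) u′ us (proj₂ (∧-T {upOK N (suc q) (suc l) u} ok)) w)

downs-from : ∀ {s N q Q o} → 0 ℕ.< N → Prime (suc q) → Coprime (suc q) Q → ∀ l d ds {W} → T (downsOK N q (suc l) d ds) →
  From (Entry s N (suc q ℕ.* Q) o) 0 W → From (λ i x → PowBranch (shift₂ s) (suc q) Q (λ k → 𝟙 (bad? s N Q i o k)) (suc l) (fr x)) 0 (downs q d ds W)
downs-from {s} {N} {q} {Q} {o} 0<N pp cop l d [] ok w = from-map (λ {i} {x} S → branch-last λ r M sm dv →
    level-down d pp cop S r M sm (λ j → ∣-trans (m∣m*n (suc q ℕ.^ l)) (dv j)) (λ j → down-top {N} {d = d} pp cop (val>0 (not s) _) (topOK-sound {d = d} 0<N ok)))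
  (pad-from d w)
downs-from {s} {N} {q} {Q} {o} 0<N pp cop l d (d′ ∷ ds) ok w = mixDown-from q
  (λ {i} {x} {y} S B → branch-≤ (mean₂-≤ q x y) (branch-mix pp (λ k → 𝟙-≥0 (bad? s N Q i o k)) (fr-≥0 x) (fr-≥0 y)
     (λ r M sm dv ¬dv → level-down d pp cop S r M sm (λ j → ∣-trans (m∣m*n (suc q ℕ.^ l)) (dv j))
        (λ j → down-exact {N} {l = suc l} {d = d} pp cop (val>0 (not s) _) (downOK-sound {l = suc l} {d} 0<N ℕ.z<s (proj₁ (∧-T ok))) (¬dv j))) B))
  (pad-from d w) (downs-from 0<N pp cop (suc l) d′ ds (proj₂ (∧-T {downOK N (suc q) (suc l) d} ok)) w)

-- Trial division and runs over lists of primes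

noDivisorFrom : ℕ → ℕ → ℕ → Bool
-- Running out of fuel counts as failure, which is safe because only soundness is claimed.
noDivisorFrom zero d n = false
noDivisorFrom (suc f) d n = (n ℕ.<ᵇ suc d ℕ.* suc d) ∨ ((0 ℕ.<ᵇ n % suc d) ∧ noDivisorFrom f (suc d) n)

isPrime : ℕ → Bool
isPrime n = (1 ℕ.<ᵇ n) ∧ noDivisorFrom n 1 n

%≢0⇒∤ : ∀ d n → T (0 ℕ.<ᵇ n % suc d) → ¬ suc d ∣ n
%≢0⇒∤ d n t dv = ℕₚ.<⇒≢ (ℕₚ.<ᵇ⇒< 0 (n % suc d) t) (sym (n∣m⇒m%n≡0 n (suc d) dv))

noDivisorFrom-prime : ∀ f d n → 1 ℕ.< n → suc d Rough n → T (noDivisorFrom f d n) → Prime n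
noDivisorFrom-prime (suc f) d n 1<n r t with n ℕ.<ᵇ suc d ℕ.* suc d in eq
... | true = rough∧square>⇒prime {{ℕ.n>1⇒nonTrivial 1<n}} r (ℕₚ.<ᵇ⇒< n _ (subst T (sym eq) tt))
... | false = noDivisorFrom-prime f (suc d) n 1<n (∤⇒rough-suc (%≢0⇒∤ d n (proj₁ (∧-T t))) r) (proj₂ (∧-T {0 ℕ.<ᵇ n % suc d} t))

isPrime-sound : ∀ n → T (isPrime n) → Prime n
isPrime-sound n t = noDivisorFrom-prime n 1 n (ℕₚ.<ᵇ⇒< 1 n (proj₁ (∧-T t))) 2-rough (proj₂ (∧-T {1 ℕ.<ᵇ n} t))

-- The prime suc q with the grid shifts for its successive powers.
data Step : Set where
  step : (q u : ℕ) (us : List ℕ) (d : ℕ) (ds : List ℕ) → Step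

applyStep : Step → List ℕ → List ℕ
applyStep (step q u us d ds) W = merge q W (ups q u us W) (downs q d ds W)

-- Backward recursion: the last prime of the list acts first, on the payoff. The intermediate table
-- is forced because `applyStep` uses it three times.
run : List Step → List ℕ → List ℕ
run [] W = W
run (s ∷ ss) W = primForce (run ss W) (applyStep s)

modulus : ℕ → List Step → ℕ
modulus Q [] = Q
modulus Q (step q _ _ _ _ ∷ ss) = modulus (suc q ℕ.* Q) ss

stepOK : ℕ → ℕ → Step → Bool
stepOK N Q (step q u us d ds) = (isPrime (suc q) ∧ (0 ℕ.<ᵇ Q % suc q)) ∧ (upsOK N q 1 u us ∧ downsOK N q 1 d ds)

stepsOK : ℕ → ℕ → List Step → Bool
stepsOK N Q [] = true
stepsOK N Q (s@(step q _ _ _ _) ∷ ss) = stepOK N Q s ∧ stepsOK N (suc q ℕ.* Q) ss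

step-prime : ∀ {N Q q u us d ds} → T (stepOK N Q (step q u us d ds)) → Prime (suc q)
step-prime ok = isPrime-sound _ (proj₁ (∧-T (proj₁ (∧-T ok))))

step-coprime : ∀ {N Q q u us d ds} → T (stepOK N Q (step q u us d ds)) → Coprime (suc q) Q
step-coprime {N} {Q} {q} {u} {us} {d} {ds} ok = Cop.sym (prime-coprime (step-prime {N} {Q} {q} {u} {us} {d} {ds} ok) (%≢0⇒∤ q Q (proj₂ (∧-T {isPrime (suc q)} (proj₁ (∧-T ok))))))

stepsOK-head : ∀ {N Q q u us d ds ss} → T (stepsOK N Q (step q u us d ds ∷ ss)) → T (stepOK N Q (step q u us d ds))
stepsOK-head ok = proj₁ (∧-T ok)

stepsOK-tail : ∀ {N Q q u us d ds ss} → T (stepsOK N Q (step q u us d ds ∷ ss)) → T (stepsOK N (suc q ℕ.* Q) ss)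
stepsOK-tail {N} {Q} {q} {u} {us} {d} {ds} ok = proj₂ (∧-T {stepOK N Q (step q u us d ds)} ok)

applyStep-from : ∀ {s N Q o q u us d ds W} → 0 ℕ.< N → T (stepOK N Q (step q u us d ds)) →
  From (Entry s N (suc q ℕ.* Q) o) 0 W → From (Entry s N Q o) 0 (applyStep (step q u us d ds) W)
applyStep-from {s} {N} {Q} {o} {q} {u} {us} {d} {ds} {W} 0<N ok w =
  merge-from branch-mono q (λ {i} {x} {y} {z} S B₁ B₂ → sound-≤ (mean₃-≤ q x y z (ℕₚ.≤-pred (prime>1 pp))) (sound-step pp cop (fr-≥0 x) (fr-≥0 y) (fr-≥0 z) S B₁ B₂))
    w (ups-from 0<N pp cop 0 u us (proj₁ (∧-T oks)) w) (downs-from 0<N pp cop 0 d ds (proj₂ (∧-T {upsOK N q 1 u us} oks)) w)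
  where
  pp = step-prime {N} {Q} {q} {u} {us} {d} {ds} ok
  cop = step-coprime {N} {Q} {q} {u} {us} {d} {ds} ok
  oks : T (upsOK N q 1 u us ∧ downsOK N q 1 d ds)
  oks = proj₂ (∧-T {isPrime (suc q) ∧ (0 ℕ.<ᵇ Q % suc q)} ok)

run-from : ∀ {s N o} → 0 ℕ.< N → ∀ Q ss {W} → T (stepsOK N Q ss) → From (Entry s N (modulus Q ss) o) 0 W → From (Entry s N Q o) 0 (run ss W)
run-from 0<N Q [] ok w = w
run-from {s} {N} {o} 0<N Q (step q u us d ds ∷ ss) {W} ok w = subst (From (Entry s N Q o) 0) (sym (primForceLemma (run ss W) (applyStep (step q u us d ds))))
  (applyStep-from {us = us} {ds = ds} 0<N (stepsOK-head {N} {Q} {q} {u} {us} {d} {ds} {ss} ok) (run-from 0<N (suc q ℕ.* Q) ss (stepsOK-tail {N} {Q} {q} {u} {us} {d} {ds} {ss} ok) w))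

-- Division by 1 + p ^ (-2) + ... + p ^ (-24), rounded up; cutting off the Euler factor there costs
-- a relative error of about p ^ (-26).
zetaStep : ℕ → ℕ → ℕ
zetaStep p² z = suc ((z ℕ.* p² ℕ.^ 12) / suc (repunit p² 12))

zetaAfter : ℕ → List Step → ℕ
zetaAfter z [] = z
zetaAfter z (step q _ _ _ _ ∷ ss) = zetaAfter (zetaStep (suc q ℕ.* suc q) z) ss

zetaStep-≤ : ∀ {p z} → 0 ℕ.< p → fr z ≤ geo (inv p * inv p) 12 * fr (zetaStep (p ℕ.* p) z)
zetaStep-≤ {p} {z} 0<p = *-cancelˡ (ι-pos 0<P) (begin
  ι P * fr z ≡⟨ sym (fr-* P z) ⟩
  fr (P ℕ.* z) ≡⟨ cong fr (ℕₚ.*-comm P z) ⟩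
  fr (z ℕ.* P) ≤⟨ fr-mono (suc-/-≤ (z ℕ.* P) R) ⟩
  fr (suc R ℕ.* zetaStep (p ℕ.* p) z) ≡⟨ fr-* (suc R) (zetaStep (p ℕ.* p) z) ⟩
  ι (suc R) * fr (zetaStep (p ℕ.* p) z) ≡⟨ cong (_* fr (zetaStep (p ℕ.* p) z)) (sym (geo-repunit {p ℕ.* p} 0<p² 12)) ⟩
  (geo (inv (p ℕ.* p)) 12 * ι P) * fr (zetaStep (p ℕ.* p) z) ≡⟨ cong (λ x → (geo x 12 * ι P) * fr (zetaStep (p ℕ.* p) z)) (inv-* 0<p 0<p) ⟩
  (geo (inv p * inv p) 12 * ι P) * fr (zetaStep (p ℕ.* p) z) ≡⟨ shuffle (geo (inv p * inv p) 12) (ι P) (fr (zetaStep (p ℕ.* p) z)) ⟩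
  ι P * (geo (inv p * inv p) 12 * fr (zetaStep (p ℕ.* p) z)) ∎)
  where
  open ℚₚ.≤-Reasoning
  P = (p ℕ.* p) ℕ.^ 12
  R = repunit (p ℕ.* p) 12
  0<p² : 0 ℕ.< p ℕ.* p
  0<p² = ℕₚ.*-mono-< 0<p 0<p
  0<P : 0 ℕ.< P
  0<P = ℕₚ.m^n>0 (p ℕ.* p) {{ℕ.>-nonZero 0<p²}} 12
  shuffle : ∀ g P z → (g * P) * z ≡ P * (g * z)
  shuffle g P z = solve 3 (λ g P z → (g :* P) :* z := P :* (g :* z)) refl g P z

zetaAfter-bound : ∀ {N} Q ss {z} → T (stepsOK N Q ss) → ZetaBound Q (fr z) → ZetaBound (modulus Q ss) (fr (zetaAfter z ss))
zetaAfter-bound Q [] ok B = B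
zetaAfter-bound {N} Q (step q u us d ds ∷ ss) {z} ok B = zetaAfter-bound {N} (suc q ℕ.* Q) ss (stepsOK-tail {N} {Q} {q} {u} {us} {d} {ds} {ss} ok)
  (zeta-step (step-prime {N} {Q} {q} {u} {us} {d} {ds} hd) (step-coprime {N} {Q} {q} {u} {us} {d} {ds} hd) 12 (zetaStep-≤ {suc q} {z} ℕ.z<s) B)
  where hd = stepsOK-head {N} {Q} {q} {u} {us} {d} {ds} {ss} ok

squares : ℕ → ℕ
squares zero = 0
squares (suc k) = squares k ℕ.+ suc (scale / (suc k ℕ.* suc k))

-- An upper bound for ζ(2): suc k inverse squares, and 1 / suc k for the rest. Apart from rounding,
-- the error is of order 1 / k ^ 2.
zeta₂ : ℕ → ℕ
zeta₂ k = squares (suc k) ℕ.+ suc (scale / suc k)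

inv-≤-fr : ∀ n → inv (suc n) ≤ fr (suc (scale / suc n))
inv-≤-fr n = subst (_≤ fr (suc (scale / suc n))) (ℚₚ.*-identityˡ (inv (suc n))) (*inv-≤ {suc n} ℕ.z<s
  (subst₂ _≤_ fr-scale (fr-* (suc n) (suc (scale / suc n))) (fr-mono (suc-/-≤ scale n))))

squares-≤ : ∀ k → ∑ k (λ i → inv (suc i) * inv (suc i)) ≤ fr (squares k)
squares-≤ zero = fr-≥0 0
squares-≤ (suc k) = subst (∑ (suc k) (λ i → inv (suc i) * inv (suc i)) ≤_) (sym (fr-+ (squares k) (suc (scale / (suc k ℕ.* suc k)))))
  (ℚₚ.+-mono-≤ (squares-≤ k) (subst (_≤ fr (suc (scale / (suc k ℕ.* suc k)))) (inv-* {suc k} {suc k} ℕ.z<s ℕ.z<s) (inv-≤-fr (k ℕ.+ k ℕ.* suc k))))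

zeta₂-bound : ∀ k → ZetaBound 1 (fr (zeta₂ k))
zeta₂-bound k X = ℚₚ.≤-trans (zeta-base (suc k) ℕ.z<s X) (subst (∑ (suc k) (λ i → inv (suc i) * inv (suc i)) + inv (suc k) ≤_)
  (sym (fr-+ (squares (suc k)) (suc (scale / suc k)))) (ℚₚ.+-mono-≤ (squares-≤ (suc k)) (inv-≤-fr k)))

-- e / t bounds the loss at distance t from the threshold.
tails : ℕ → ℕ → ℕ → List ℕ
tails e t zero = []
tails e t (suc n) = suc (e / suc t) ∷! tails e (suc t) n

-- Up to index o Markov's inequality says nothing, hence the entries 1; index o + t receives the
-- bound (z - 1) N / t of `sound-tail`.
payoff : ℕ → ℕ → ℕ → ℕ → List ℕ
payoff z N o n = replicate (suc o) scale ++ tails ((z ℕ.∸ scale) ℕ.* N) 0 n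

from-replicate : ∀ {x W} n {i} → (∀ j → S j x) → From S (n ℕ.+ i) W → From S i (replicate n x ++ W)
from-replicate zero s w = w
from-replicate {S} {x} {W} (suc n) {i} s w = s i ∷ from-replicate n s (subst (λ k → From S k W) (sym (ℕₚ.+-suc n i)) w)

payoff-from : ∀ {s N Q z} → 0 ℕ.< N → ZetaBound Q (fr z) → ∀ o n → From (Entry s N Q o) 0 (payoff z N o n)
payoff-from {s} {N} {Q} {z} 0<N B o n = from-replicate (suc o) (λ j → sound-≤ (ℚₚ.≤-reflexive (sym fr-scale)) sound-1)
    (subst (λ k → From (Entry s N Q o) k (tails e 0 n)) (trans (ℕₚ.+-suc o 0) refl) (go 0 n))
  where
  e = (z ℕ.∸ scale) ℕ.* N
  excess : fr z - 1ℚ ≤ fr (z ℕ.∸ scale)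
  excess = ≤-diff _ (diff-≥0 (fr-mono (ℕₚ.m≤n+m∸n z scale))) (trans (cong (λ x → (fr z - 1ℚ) + (x - fr z)) (trans (fr-+ scale (z ℕ.∸ scale)) (cong (_+ fr (z ℕ.∸ scale)) fr-scale)))
    (solve 2 (λ a b → (a :- con 1ℚ) :+ ((con 1ℚ :+ b) :- a) := b) refl (fr z) (fr (z ℕ.∸ scale))))
  bound-≤ : ∀ t → (ι N * inv (suc t)) * (fr z - 1ℚ) ≤ fr (suc (e / suc t))
  bound-≤ t = ℚₚ.≤-trans (*-monoˡ (*-≥0 (ι-≥0 N) (inv-≥0 (suc t))) excess) (subst (_≤ fr (suc (e / suc t)))
    (trans (cong (_* inv (suc t)) (fr-* N (z ℕ.∸ scale))) (solve 3 (λ a b c → (a :* b) :* c := (a :* c) :* b) refl (ι N) (fr (z ℕ.∸ scale)) (inv (suc t))))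
    (*inv-≤ {suc t} ℕ.z<s (subst₂ _≤_ (cong fr (ℕₚ.*-comm (z ℕ.∸ scale) N)) (fr-* (suc t) (suc (e / suc t))) (fr-mono (suc-/-≤ e t)))))
  go : ∀ t n → From (Entry s N Q o) (o ℕ.+ suc t) (tails e t n)
  go t zero = []
  go t (suc n) = from-∷! (sound-≤ (bound-≤ t) (sound-tail o (suc t) 0<N ℕ.z<s B)) (subst (λ k → From (Entry s N Q o) k (tails e (suc t) n)) (ℕₚ.+-suc o (suc t)) (go (suc t) n))

-- Gluing the fine and the coarse grid

join : ℕ → List ℕ → List ℕ → List ℕ
join zero xs ys = ys
join (suc n) [] ys = []
-- The last entry stands for the missing ones, by monotonicity.
join (suc n) xs@(x ∷ []) ys = x ∷! join n xs ys
join (suc n) (x ∷ xs@(_ ∷ _)) ys = x ∷! join n xs ys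

join-from : Mono S → ∀ n {i xs ys} → From S i xs → From S (n ℕ.+ i) ys → From S i (join n xs ys)
join-from m zero _ w = w
join-from m (suc n) [] w = []
join-from {S} m (suc n) {i} {x ∷ []} {ys} (s ∷ []) w = from-∷! s (join-from m n (m (ℕₚ.n≤1+n i) s ∷ []) (subst (λ k → From S k ys) (sym (ℕₚ.+-suc n i)) w))
join-from {S} m (suc n) {i} {x ∷ x′ ∷ xs} {ys} (s ∷ ss) w = from-∷! s (join-from m n ss (subst (λ k → From S k ys) (sym (ℕₚ.+-suc n i)) w))

spread : ℕ → List ℕ → List ℕ
spread c [] = []
spread c (x ∷ xs) = replicate c x ++ spread c xs

spread-from : ∀ {s N N′ c Q o o′} → N ≡ c ℕ.* N′ → 0 ℕ.< c → 0 ℕ.< N′ → ∀ {i i′ W} → o′ ℕ.≤ i′ → o ℕ.+ c ℕ.* i′ ℕ.≤ i ℕ.+ c ℕ.* o′ →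
  From (Entry s N′ Q o′) i′ W → From (Entry s N Q o) i (spread c W)
spread-from eq 0<c 0<N′ le₁ le₂ [] = []
spread-from {s} {N} {N′} {c} {Q} {o} {o′} eq 0<c 0<N′ {i} {i′} {x ∷ xs} le₁ le₂ (e ∷ es) =
  go c i (λ j i≤j → sound-refine eq 0<c 0<N′ le₁ (ℕₚ.≤-trans le₂ (ℕₚ.+-monoˡ-≤ (c ℕ.* o′) i≤j)) e)
    (spread-from eq 0<c 0<N′ (ℕₚ.≤-trans le₁ (ℕₚ.n≤1+n i′)) le₃ es)
  where
  go : ∀ n i {W} → (∀ j → i ℕ.≤ j → Entry s N Q o j x) → From (Entry s N Q o) (n ℕ.+ i) W → From (Entry s N Q o) i (replicate n x ++ W)
  go zero i f w = w
  go (suc n) i {W} f w = f i ℕₚ.≤-refl ∷ go n (suc i) (λ j le → f j (ℕₚ.≤-trans (ℕₚ.n≤1+n i) le)) (subst (λ k → From (Entry s N Q o) k W) (sym (ℕₚ.+-suc n i)) w)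
  le₃ : o ℕ.+ c ℕ.* suc i′ ℕ.≤ (c ℕ.+ i) ℕ.+ c ℕ.* o′
  le₃ = subst₂ ℕ._≤_ (solveℕ 3 (λ o c i → c ⊕ (o ⊕ c ⊗ i) ≐ o ⊕ c ⊗ (# 1 ⊕ i)) refl o c i′)
    (sym (ℕₚ.+-assoc c i (c ℕ.* o′))) (ℕₚ.+-monoʳ-≤ c le₂)

nth : ℕ → List ℕ → ℕ
nth _ [] = scale
nth zero (x ∷ xs) = x
nth (suc n) (x ∷ xs) = nth n xs

nth-from : (∀ i → S i scale) → ∀ n {i W} → From S i W → S (n ℕ.+ i) (nth n W)
nth-from d n [] = d _
nth-from d zero (s ∷ ss) = s
nth-from {S} d (suc n) {i} {x ∷ xs} (s ∷ ss) = subst (λ k → S k (nth n xs)) (ℕₚ.+-suc n i) (nth-from d n ss)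

-- For large p the shifts are read off from log (1 + 1/p) ≈ 2 / (2 p + 1).
singleStep : ℕ → ℕ → Step
singleStep N zero = step 0 0 [] 0 []
singleStep N (suc q) = step q ((2 ℕ.* N) / suc (suc q ℕ.+ suc q)) [] (suc ((2 ℕ.* N) / suc (q ℕ.+ q))) []

modulus-single : ∀ N N′ Q ps → modulus Q (map (singleStep N) ps) ≡ modulus Q (map (singleStep N′) ps)
modulus-single N N′ Q [] = refl
modulus-single N N′ Q (zero ∷ ps) = modulus-single N N′ (1 ℕ.* Q) ps
modulus-single N N′ Q (suc q ∷ ps) = modulus-single N N′ (suc q ℕ.* Q) ps

-- The small primes work on a fine grid of mesh 1/N around the threshold; for the large ones a window
-- of radius oF is enough, completed on the right by a grid of mesh 1/N′.
fineWindow : (N oF z : ℕ) → List ℕ → List ℕ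
fineWindow N oF z ps = run (map (singleStep N) ps) (payoff z N oF oF)

-- With the threshold at lo + oF, the window ends oF cells to its right and the coarse entries start
-- at distance oF + 1. The entry for coarse distance k may be used there if c k ≤ oF + 1; each
-- coarse entry then covers c fine cells.
table : (N N′ c lo oF k n z : ℕ) → List Step → List ℕ → List ℕ
table N N′ c lo oF k n z early ps = run early (join (lo ℕ.+ suc (oF ℕ.+ oF)) (pad lo (fineWindow N oF z ps)) (spread c (drops k (run (map (singleStep N′) ps) (payoff z N′ 0 n)))))

table-from : ∀ {s N N′ c lo oF k n z early ps} → N ≡ c ℕ.* N′ → 0 ℕ.< c → 0 ℕ.< N → 0 ℕ.< N′ → c ℕ.* k ℕ.≤ suc oF →
  T (stepsOK N 2 early) → T (stepsOK N (modulus 2 early) (map (singleStep N) ps)) → T (stepsOK N′ (modulus 2 early) (map (singleStep N′) ps)) →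
  ZetaBound (modulus (modulus 2 early) (map (singleStep N) ps)) (fr z) → From (Entry s N 2 (lo ℕ.+ oF)) 0 (table N N′ c lo oF k n z early ps)
table-from {s} {N} {N′} {c} {lo} {oF} {k} {n} {z} {early} {ps} eq 0<c 0<N 0<N′ ck≤ ok ok₁ ok₂ B =
  run-from 0<N 2 early ok (join-from entry-mono (lo ℕ.+ suc (oF ℕ.+ oF))
    (pad-from lo (run-from 0<N Q (map (singleStep N) ps) ok₁ (payoff-from 0<N B oF oF)))
    (spread-from eq 0<c 0<N′ ℕ.z≤n le (drops-from entry-mono k (run-from 0<N′ Q (map (singleStep N′) ps) ok₂ (payoff-from 0<N′ (subst (λ q → ZetaBound q (fr z)) (modulus-single N N′ Q ps) B) 0 n)))))
  where
  Q = modulus 2 early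
  le : lo ℕ.+ oF ℕ.+ c ℕ.* (k ℕ.+ 0) ℕ.≤ lo ℕ.+ suc (oF ℕ.+ oF) ℕ.+ 0 ℕ.+ c ℕ.* 0
  le = subst₂ ℕ._≤_ (cong (λ x → lo ℕ.+ oF ℕ.+ c ℕ.* x) (sym (ℕₚ.+-identityʳ k)))
    (solveℕ 3 (λ lo o c → (lo ⊕ o) ⊕ (# 1 ⊕ o) ≐ lo ⊕ (# 1 ⊕ (o ⊕ o)) ⊕ # 0 ⊕ c ⊗ # 0) refl lo oF c)
    (ℕₚ.+-monoʳ-≤ (lo ℕ.+ oF) ck≤)

-- The prime 2 and the final comparison

private
  at-two : ∀ j → val 2 (0 ℕ.+ 1 ℕ.* j) ≡ 2 ℕ.^ 1 ℕ.* (1 ℕ.+ 1 ℕ.* j)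
  at-two j = trans (val-def 2 (1 ℕ.* j)) (solveℕ 1 (λ j → # 2 ⊗ (# 1 ⊗ j) ⊕ # 2 ≐ # 2 ⊗ (# 1 ⊕ # 1 ⊗ j)) refl j)

  trivial-branch : ∀ {s N Q i o c p l} → PowBranch c p Q (λ k → 𝟙 (bad? s N Q i o k)) l (fr scale)
  trivial-branch {s} {N} {Q} {i} {o} .on r M α β sm cop eq = uavg-≤ (ℚₚ.≤-reflexive (sym fr-scale)) (uavg-1 λ j → 𝟙-≤1 (bad? s N Q i o (r ℕ.+ M ℕ.* j)))

  from-branch : ∀ {s N o i v} → PowBranch 2 2 1 (λ k → 𝟙 (bad? s N 1 i o k)) 1 v → UAvg (λ j → 𝟙 (bad? s N 1 i o j)) v
  from-branch {s} {N} {o} {i} B = uavg-cong (λ j → cong (λ k → 𝟙 (bad? s N 1 i o k)) (sym (ℕₚ.+-identityʳ j))) (B .on 0 1 1 1 (λ c → c) (Cop.sym (Cop.1-coprimeTo 2)) at-two)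

-- Since 2 divides 2n and never 2n + 1, no mean over residues mod 2 is taken: every n lies in the
-- branch l = 1. In this order n₁ = 2n, so the powers of 2 act upwards; in `bad-true-bound` they act
-- downwards.
bad-false-bound : ∀ {N o W} → 0 ℕ.< N → ∀ u us → T (upsOK N 1 1 u us) → From (Entry false N 2 o) 0 W → ∀ i → UAvg (λ j → 𝟙 (bad? false N 1 i o j)) (fr (nth i (ups 1 u us W)))
bad-false-bound {N} {o} {W} 0<N u us ok w i = from-branch (subst (λ t → PowBranch 2 2 1 (λ k → 𝟙 (bad? false N 1 t o k)) 1 (fr (nth i (ups 1 u us W)))) (ℕₚ.+-identityʳ i)
  (nth-from (λ i → trivial-branch) i (ups-from {false} {N} {1} {1} {o} 0<N prime[2] (Cop.sym (Cop.1-coprimeTo 2)) 0 u us ok w)))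

bad-true-bound : ∀ {N o W} → 0 ℕ.< N → ∀ d ds → T (downsOK N 1 1 d ds) → From (Entry true N 2 o) 0 W → ∀ i → UAvg (λ j → 𝟙 (bad? true N 1 i o j)) (fr (nth i (downs 1 d ds W)))
bad-true-bound {N} {o} {W} 0<N d ds ok w i = from-branch (subst (λ t → PowBranch 2 2 1 (λ k → 𝟙 (bad? true N 1 t o k)) 1 (fr (nth i (downs 1 d ds W)))) (ℕₚ.+-identityʳ i)
  (nth-from (λ i → trivial-branch) i (downs-from {true} {N} {1} {1} {o} 0<N prime[2] (Cop.sym (Cop.1-coprimeTo 2)) 0 d ds ok w)))

zeta : ℕ → List Step → List Step → ℕ
zeta K early late = zetaAfter (zetaAfter (zetaStep 4 (zeta₂ K)) early) late

zeta-bound : ∀ N K early late → T (stepsOK N 2 early) → T (stepsOK N (modulus 2 early) late) → ZetaBound (modulus (modulus 2 early) late) (fr (zeta K early late))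
zeta-bound N K early late ok ok₁ = zetaAfter-bound {N} (modulus 2 early) late ok₁ (zetaAfter-bound {N} 2 early ok
  (zeta-step prime[2] (Cop.sym (Cop.1-coprimeTo 2)) 12 (zetaStep-≤ {2} {zeta₂ K} ℕ.z<s) (zeta₂-bound K)))

-- The threshold of the table is suc i. The bound for B is read one cell below it, to absorb the
-- factor (2n + 1) / 2n, and the bound for the complement at the threshold itself.
check : (i u : ℕ) (us : List ℕ) (d : ℕ) (ds : List ℕ) (v w : ℕ) → List ℕ → Bool
check i u us d ds v w W = (nth i (ups 1 u us W) ℕ.≤ᵇ v) ∧ (nth (suc i) (downs 1 d ds W) ℕ.≤ᵇ w)

≡-T : ∀ {b} → b ≡ true → T b
≡-T refl = tt

-- With variable parameters and all computed facts as hypotheses, the concrete tables are evaluated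
-- only inside the sealed equations of `check-ok` and its companions.
bounds : ∀ N N′ c lo oF k n K early ps i u us d ds v w → N ≡ c ℕ.* N′ → 0 ℕ.< c → 0 ℕ.< N → 0 ℕ.< N′ → c ℕ.* k ℕ.≤ suc oF → suc i ≡ lo ℕ.+ oF →
  stepsOK N 2 early ≡ true → stepsOK N (modulus 2 early) (map (singleStep N) ps) ≡ true → stepsOK N′ (modulus 2 early) (map (singleStep N′) ps) ≡ true →
  upsOK N 1 1 u us ≡ true → downsOK N 1 1 d ds ≡ true →
  primForce (table N N′ c lo oF k n (zeta K early (map (singleStep N) ps)) early ps) (check i u us d ds v w) ≡ true →
  UAvg (λ j → 𝟙 (bad? false N 1 i (suc i) j)) (fr v) × UAvg (λ j → 𝟙 (bad? true N 1 (suc i) (suc i) j)) (fr w)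
bounds N N′ c lo oF k n K early ps i u us d ds v w eq 0<c 0<N 0<N′ ck≤ i≡ e e₁ e₂ eᵤ e_d e_c =
  uavg-≤ (fr-mono (ℕₚ.≤ᵇ⇒≤ (nth i (ups 1 u us W)) v (proj₁ (∧-T okW)))) (bad-false-bound 0<N u us (≡-T eᵤ) (w-from false) i) ,
  uavg-≤ (fr-mono (ℕₚ.≤ᵇ⇒≤ (nth (suc i) (downs 1 d ds W)) w (proj₂ (∧-T {nth i (ups 1 u us W) ℕ.≤ᵇ v} okW)))) (bad-true-bound 0<N d ds (≡-T e_d) (w-from true) (suc i))
  where
  z = zeta K early (map (singleStep N) ps)
  W = table N N′ c lo oF k n z early ps
  okW : T (check i u us d ds v w W)
  okW = ≡-T (trans (sym (primForceLemma W (check i u us d ds v w))) e_c)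
  w-from : ∀ s → From (Entry s N 2 (suc i)) 0 W
  w-from s = subst (λ o → From (Entry s N 2 o) 0 W) (sym i≡)
    (table-from {s} {N} {N′} {c} {lo} {oF} {k} {n} {z} {early} {ps} eq 0<c 0<N 0<N′ ck≤ (≡-T e) (≡-T e₁) (≡-T e₂) (zeta-bound N K early (map (singleStep N) ps) (≡-T e) (≡-T e₁)))

-- The computation with the primes up to 7000

primesFrom : ℕ → ℕ → List ℕ
primesFrom n zero = []
primesFrom n (suc k) = if isPrime n then n ∷ primesFrom (suc n) k else primesFrom (suc n) k

-- The shifts are log (1 + 1/p + ... + 1/p ^ l) in units of log (1 + 1/16000), rounded down in the
-- first list and up in the second, whose last entry belongs to p / (p - 1).
ups₂ downs₂ : List ℕ
ups₂ = 8954 ∷ 10058 ∷ 10582 ∷ 10838 ∷ 10965 ∷ 11028 ∷ 11059 ∷ 11075 ∷ 11082 ∷ []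
downs₂ = 8955 ∷ 10059 ∷ 10583 ∷ 10839 ∷ 10966 ∷ 11029 ∷ 11060 ∷ 11076 ∷ 11091 ∷ []

-- Shifts in the format of `ups₂` and `downs₂` for the powers of the primes from 3 to 31. The larger
-- p, the fewer powers are told apart; from 37 to 61 a single shift serves all of them.
early : List Step
early =
    step 2 4603 (5883 ∷ 6288 ∷ 6421 ∷ 6465 ∷ 6480 ∷ []) 4604 (5884 ∷ 6289 ∷ 6422 ∷ 6466 ∷ 6488 ∷ []) ∷
  step 4 2917 (3441 ∷ 3544 ∷ 3565 ∷ []) 2918 (3442 ∷ 3545 ∷ 3571 ∷ []) ∷
  step 6 2136 (2419 ∷ 2459 ∷ []) 2137 (2420 ∷ 2467 ∷ []) ∷
  step 10 1392 (1512 ∷ []) 1393 (1526 ∷ []) ∷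
  step 12 1185 (1273 ∷ []) 1186 (1281 ∷ []) ∷
  step 16 914 (966 ∷ []) 915 (971 ∷ []) ∷
  step 18 820 (862 ∷ []) 821 (866 ∷ []) ∷
  step 22 680 (709 ∷ []) 681 (712 ∷ []) ∷
  step 28 542 (560 ∷ []) 543 (562 ∷ []) ∷
  step 30 507 (524 ∷ []) 508 (525 ∷ []) ∷
  map (singleStep 16000) (primesFrom 32 30)

late : List ℕ
late = primesFrom 62 6939

abstract
  early-ok : stepsOK 16000 2 early ≡ true
  early-ok = refl

  late-ok : stepsOK 16000 (modulus 2 early) (map (singleStep 16000) late) ≡ true
  late-ok = refl

  late-ok′ : stepsOK 400 (modulus 2 early) (map (singleStep 400) late) ≡ true
  late-ok′ = refl

  ups₂-ok : upsOK 16000 1 1 6487 ups₂ ≡ true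
  ups₂-ok = refl

  downs₂-ok : downsOK 16000 1 1 6488 downs₂ ≡ true
  downs₂-ok = refl

  check-ok : primForce (table 16000 400 40 10721 479 12 280 (zeta 2999 early (map (singleStep 16000) late)) early late) (check 11199 6487 ups₂ 6488 downs₂ 54944500000 946082900000) ≡ true
  check-ok = refl

-- The table covers |log| ≤ 0.7, that is 11200 cells on each side; the primes above 61 are followed within
-- 479 cells of the threshold, and beyond on the coarser grid.
bad-bounds : UAvg (λ j → 𝟙 (bad? false 16000 1 11199 11200 j)) (fr 54944500000) × UAvg (λ j → 𝟙 (bad? true 16000 1 11200 11200 j)) (fr 946082900000)
bad-bounds = bounds 16000 400 40 10721 479 12 280 2999 early late 11199 6487 ups₂ 6488 downs₂ 54944500000 946082900000
  refl ℕ.z<s ℕ.z<s ℕ.z<s ℕₚ.≤-refl refl early-ok late-ok late-ok′ ups₂-ok downs₂-ok check-ok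

-- Periodicity of the truncated sums

a# b# : ℕ → ℕ
a# = val 2
b# = val 3

-- The product of the e ≤ Y prime to Q. Being prime to Q itself, it makes the truncated sums for Q =
-- p independent of the residue mod p.
period : ℕ → ℕ → ℕ
period Q zero = 1
period Q (suc Y) with coprime? (suc Y) Q
... | yes _ = suc Y ℕ.* period Q Y
... | no _ = period Q Y

period>0 : ∀ Q Y → 0 ℕ.< period Q Y
period>0 Q zero = ℕ.s≤s ℕ.z≤n
period>0 Q (suc Y) with coprime? (suc Y) Q
... | yes _ = ℕₚ.*-mono-< (ℕ.s≤s (ℕ.z≤n {Y})) (period>0 Q Y)
... | no _ = period>0 Q Y

period-coprime : ∀ Q Y → Coprime Q (period Q Y)
period-coprime Q zero = Cop.sym (Cop.1-coprimeTo Q)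
period-coprime Q (suc Y) with coprime? (suc Y) Q
... | yes c = coprime-* (Cop.sym c) (period-coprime Q Y)
... | no _ = period-coprime Q Y

∣-period : ∀ Q Y i → i ℕ.< Y → Coprime (suc i) Q → suc i ∣ period Q Y
∣-period Q (suc Y) i i<Y c with coprime? (suc Y) Q | i ℕₚ.≟ Y
... | yes _ | yes refl = m∣m*n (period Q Y)
... | yes _ | no i≢Y = ∣n⇒∣m*n (suc Y) (∣-period Q Y i (ℕₚ.≤∧≢⇒< (ℕₚ.≤-pred i<Y) i≢Y) c)
... | no ¬c | yes refl = ⊥-elim (¬c c)
... | no _ | no i≢Y = ∣-period Q Y i (ℕₚ.≤∧≢⇒< (ℕₚ.≤-pred i<Y) i≢Y) c

trunc-periodic : ∀ Q Y c t i → trunc Q Y (val c (t ℕ.* period Q Y ℕ.+ i)) ≡ trunc Q Y (val c i)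
trunc-periodic Q Y c t i = ∑-cong Y λ k k<Y → pw k k<Y
  where
  M = period Q Y
  split : val c (t ℕ.* M ℕ.+ i) ≡ (2 ℕ.* t) ℕ.* M ℕ.+ val c i
  split = trans (val-def c _) (trans (solveℕ 4 (λ t M i c → # 2 ⊗ (t ⊗ M ⊕ i) ⊕ c ≐ (# 2 ⊗ t) ⊗ M ⊕ (# 2 ⊗ i ⊕ c)) refl t M i c)
    (cong ((2 ℕ.* t) ℕ.* M ℕ.+_) (sym (val-def c i))))
  pw : ∀ k → k ℕ.< Y → 𝟙 (suc k ∣? val c (t ℕ.* M ℕ.+ i)) * wt Q (suc k) ≡ 𝟙 (suc k ∣? val c i) * wt Q (suc k)
  pw k k<Y with coprime? (suc k) Q
  ... | no _ = trans (zero-term (𝟙 (suc k ∣? val c (t ℕ.* M ℕ.+ i)))) (sym (zero-term (𝟙 (suc k ∣? val c i))))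
    where
    zero-term : ∀ x → x * (0ℚ * inv (suc k)) ≡ 0ℚ
    zero-term x = solve 2 (λ a b → a :* (con 0ℚ :* b) := con 0ℚ) refl x (inv (suc k))
  ... | yes cop = cong (_* (1ℚ * inv (suc k))) (𝟙-cong (suc k ∣? val c (t ℕ.* M ℕ.+ i)) (suc k ∣? val c i)
      (λ d → ∣m+n∣m⇒∣n (subst (suc k ∣_) split d) k∣) (λ d → subst (suc k ∣_) (sym split) (∣m∣n⇒∣m+n k∣ d)))
    where
    k∣ : suc k ∣ (2 ℕ.* t) ℕ.* M
    k∣ = ∣n⇒∣m*n (2 ℕ.* t) (∣-period Q Y k k<Y cop)

Periodic : ℕ → (ℕ → ℚ) → Set
Periodic M f = ∀ t i → f (t ℕ.* M ℕ.+ i) ≡ f i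

∑-periodic : ∀ {M f} → Periodic M f → ∀ t → ∑ (t ℕ.* M) f ≡ ι t * ∑ M f
∑-periodic {M} {f} per t = trans (∑-block t M f) (trans (∑-cong t λ j _ → ∑-cong M λ i _ → per j i) (∑-const t (∑ M f)))

uavg-periodic : ∀ {M f} → 0 ℕ.< M → Periodic M f → (∀ i → 0ℚ ≤ f i) → UAvg f (∑ M f * inv M)
uavg-periodic {M} {f} 0<M per f≥0 = uavg-bounded (∑ M f) go
  where
  go : ∀ x → ∑ x f ≤ (∑ M f * inv M) * ι x + ∑ M f
  go x with blocks x M 0<M
  ... | y , x≤ , y≤ = ℚₚ.≤-trans (∑-extend x≤ f≥0) (ℚₚ.≤-trans (ℚₚ.≤-reflexive (∑-periodic per y))
     (ℚₚ.≤-trans (*-monoʳ (∑-≥0 M λ i _ → f≥0 i) y≤) (ℚₚ.≤-reflexive (solve 3 (λ x i F → (x :* i :+ con 1ℚ) :* F := (F :* i) :* x :+ F) refl (ι x) (inv M) (∑ M f)))))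

-- A bound from below, because `divided-free` compares two densities.
periodic-lower : ∀ {M f} → 0 ℕ.< M → Periodic M f → (∀ i → 0ℚ ≤ f i) → ∀ x → (∑ M f * inv M) * ι x - ∑ M f ≤ ∑ x f
periodic-lower {M@(suc M′)} {f} 0<M per f≥0 x = ℚₚ.≤-trans
   (≤-diff ((ι t + 1ℚ - ι x * inv M) * F) (*-≥0 (diff-≥0 le) (∑-≥0 M λ i _ → f≥0 i))
     (solve 4 (λ x i F t → ((F :* i) :* x :- F) :+ (t :+ con 1ℚ :- x :* i) :* F := t :* F) refl (ι x) (inv M) F (ι t)))
   (ℚₚ.≤-trans (ℚₚ.≤-reflexive (sym (∑-periodic per t))) (∑-extend (m/n*n≤m x M) f≥0))
  where
  F = ∑ M f
  t = x / M
  le : ι x * inv M ≤ ι t + 1ℚ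
  le = *inv-≤ {M} 0<M (subst (ι x ≤_) (trans (ι-* M (suc t)) (cong (ι M *_) (trans (ι-suc t) (ℚₚ.+-comm 1ℚ (ι t)))))
    (ι-mono (ℕₚ.≤-trans (ℕₚ.≤-reflexive (m≡m%n+[m/n]*n x M)) (ℕₚ.≤-trans (ℕₚ.+-monoˡ-≤ (t ℕ.* M) (ℕₚ.<⇒≤ (m%n<n x M))) (ℕₚ.≤-reflexive (ℕₚ.*-comm (suc t) M))))))

-- Independence: p is prime to 2 M, so inside each residue class mod M a proportion 1/p of the
-- values is divisible by p.
periodic-multiples : ∀ {M f p} c → 0 ℕ.< M → Periodic M f → (∀ i → 0ℚ ≤ f i) → 0 ℕ.< p → Coprime p (2 ℕ.* M) → ∀ x →
  ∑ x (λ j → 𝟙 (p ∣? val c j) * f j) ≤ (∑ M f * inv M) * inv p * ι x + (∑ M f + ∑ M f)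
periodic-multiples {M} {f} {p} c 0<M per f≥0 0<p cop x with blocks x M 0<M
... | y , x≤ , y≤ = begin
  ∑ x g ≤⟨ ∑-extend x≤ (λ j → term-≥0 (p ∣? val c j) (f≥0 j)) ⟩
  ∑ (y ℕ.* M) g ≡⟨ ∑-block y M g ⟩
  ∑ y (λ t → ∑ M (λ i → g (t ℕ.* M ℕ.+ i))) ≡⟨ ∑-swap y M _ ⟩
  ∑ M (λ i → ∑ y (λ t → g (t ℕ.* M ℕ.+ i))) ≡⟨ ∑-cong M (λ i _ → trans (∑-cong y λ t _ → cong₂ (λ m v → 𝟙 (p ∣? m) * v) (form t i) (per t i)) (∑-*ʳ y (f i) _)) ⟩
  ∑ M (λ i → ∑ y (λ t → 𝟙 (p ∣? val c i ℕ.+ (2 ℕ.* M) ℕ.* t)) * f i) ≤⟨ ∑-mono M (λ i _ → *-monoʳ (f≥0 i) (count-multiples p 0<p (val c i) (2 ℕ.* M) cop y)) ⟩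
  ∑ M (λ i → (ι y * inv p + 1ℚ) * f i) ≡⟨ ∑-*ˡ M (ι y * inv p + 1ℚ) f ⟩
  (ι y * inv p + 1ℚ) * F ≤⟨ *-monoʳ F≥0 (ℚₚ.+-monoˡ-≤ 1ℚ (*-monoʳ (inv-≥0 p) y≤)) ⟩
  ((ι x * inv M + 1ℚ) * inv p + 1ℚ) * F ≤⟨ ≤-diff ((1ℚ - inv p) * F) (*-≥0 (diff-≥0 (inv-≤1 p)) F≥0) (solve 4 (λ x i p F → ((x :* i :+ con 1ℚ) :* p :+ con 1ℚ) :* F :+ (con 1ℚ :- p) :* F := (F :* i) :* p :* x :+ (F :+ F)) refl (ι x) (inv M) (inv p) F) ⟩
  (F * inv M) * inv p * ι x + (F + F) ∎
  where
  open ℚₚ.≤-Reasoning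
  F = ∑ M f
  F≥0 : 0ℚ ≤ F
  F≥0 = ∑-≥0 M λ i _ → f≥0 i
  g = λ j → 𝟙 (p ∣? val c j) * f j
  form : ∀ t i → val c (t ℕ.* M ℕ.+ i) ≡ val c i ℕ.+ (2 ℕ.* M) ℕ.* t
  form t i = trans (val-def c _) (trans (solveℕ 4 (λ t M i c → # 2 ⊗ (t ⊗ M ⊕ i) ⊕ c ≐ (# 2 ⊗ i ⊕ c) ⊕ (# 2 ⊗ M) ⊗ t) refl t M i c)
    (cong (ℕ._+ (2 ℕ.* M) ℕ.* t) (sym (val-def c i))))

∑-term : ∀ n {f : ℕ → ℚ} i → i ℕ.< n → (∀ j → 0ℚ ≤ f j) → f i ≤ ∑ n f
∑-term n {f} i i<n f≥0 = ℚₚ.≤-trans (≤-diff (∑ i f) (∑-≥0 i λ j _ → f≥0 j) (ℚₚ.+-comm (f i) (∑ i f))) (∑-extend i<n f≥0)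

sq-above : ∀ {y} → 0 ℕ.< y → ∀ X → ∑ X (λ i → 𝟙 (y ℕₚ.<? suc i) * (inv (suc i) * inv (suc i))) ≤ inv y
sq-above {y} 0<y X = begin
  ∑ X f ≤⟨ ∑-extend (ℕₚ.m≤n+m X y) (λ i → term-≥0 (y ℕₚ.<? suc i) (*-≥0 (inv-≥0 (suc i)) (inv-≥0 (suc i)))) ⟩
  ∑ (y ℕ.+ X) f ≡⟨ ∑-split y X f ⟩
  ∑ y f + ∑ X (λ i → f (y ℕ.+ i)) ≡⟨ cong₂ _+_ (∑-zero y λ i i<y → trans (cong (_* (inv (suc i) * inv (suc i))) (𝟙-no (y ℕₚ.<? suc i) (ℕₚ.≤⇒≯ i<y))) (ℚₚ.*-zeroˡ (inv (suc i) * inv (suc i))))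
      (∑-cong X λ i _ → trans (cong (_* (inv (suc (y ℕ.+ i)) * inv (suc (y ℕ.+ i)))) (𝟙-yes (y ℕₚ.<? suc (y ℕ.+ i)) (ℕ.s≤s (ℕₚ.m≤m+n y i)))) (ℚₚ.*-identityˡ (inv (suc (y ℕ.+ i)) * inv (suc (y ℕ.+ i))))) ⟩
  0ℚ + ∑ X (λ i → inv (suc (y ℕ.+ i)) * inv (suc (y ℕ.+ i))) ≡⟨ ℚₚ.+-identityˡ _ ⟩
  ∑ X (λ i → inv (suc (y ℕ.+ i)) * inv (suc (y ℕ.+ i))) ≤⟨ inv-sq-tail y 0<y X ⟩
  inv y ∎
  where
  open ℚₚ.≤-Reasoning
  f = λ i → 𝟙 (y ℕₚ.<? suc i) * (inv (suc i) * inv (suc i))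

two : ℚ
two = 1ℚ + 1ℚ

2≥0 : 0ℚ ≤ two
2≥0 = +-≥0 0≤1 0≤1

-- Here e may be even. The x values are among the 2x consecutive numbers from c on, which costs the
-- factor two.
count-val : ∀ e → 0 ℕ.< e → ∀ c x → ∑ x (λ j → 𝟙 (e ∣? c ℕ.+ 2 ℕ.* j)) ≤ two * (ι x * inv e) + 1ℚ
count-val e 0<e c x = begin
  ∑ x (λ j → g (2 ℕ.* j)) ≤⟨ ∑-mono x (λ j _ → ≤-diff (g (2 ℕ.* j ℕ.+ 1)) (𝟙-≥0 (e ∣? c ℕ.+ (2 ℕ.* j ℕ.+ 1))) (cong (_+ g (2 ℕ.* j ℕ.+ 1)) (cong g (sym (ℕₚ.+-identityʳ (2 ℕ.* j)))))) ⟩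
  ∑ x (λ j → g (2 ℕ.* j ℕ.+ 0) + g (2 ℕ.* j ℕ.+ 1)) ≡⟨ ∑-cong x (λ j _ → trans (cong₂ (λ u v → g (u ℕ.+ 0) + g (v ℕ.+ 1)) (ℕₚ.*-comm 2 j) (ℕₚ.*-comm 2 j)) (cong (_+ g (j ℕ.* 2 ℕ.+ 1)) (sym (ℚₚ.+-identityˡ (g (j ℕ.* 2 ℕ.+ 0)))))) ⟩
  ∑ x (λ j → ∑ 2 (λ i → g (j ℕ.* 2 ℕ.+ i))) ≡⟨ sym (∑-block x 2 g) ⟩
  ∑ (x ℕ.* 2) g ≡⟨ ∑-cong (x ℕ.* 2) (λ i _ → cong (λ k → 𝟙 (e ∣? c ℕ.+ k)) (sym (ℕₚ.*-identityˡ i))) ⟩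
  ∑ (x ℕ.* 2) (λ i → 𝟙 (e ∣? c ℕ.+ 1 ℕ.* i)) ≤⟨ count-multiples e 0<e c 1 (Cop.sym (Cop.1-coprimeTo e)) (x ℕ.* 2) ⟩
  ι (x ℕ.* 2) * inv e + 1ℚ ≡⟨ cong (λ k → k * inv e + 1ℚ) (trans (ι-* x 2) (cong (ι x *_) (trans (ι-suc 1) (cong (1ℚ +_) ι-1)))) ⟩
  (ι x * two) * inv e + 1ℚ ≡⟨ cong (_+ 1ℚ) (solve 3 (λ x t e → (x :* t) :* e := t :* (x :* e)) refl (ι x) two (inv e)) ⟩
  two * (ι x * inv e) + 1ℚ ∎
  where
  open ℚₚ.≤-Reasoning
  g : ℕ → ℚ
  g i = 𝟙 (e ∣? c ℕ.+ i)

tailOf : ℕ → ℕ → ℚ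
tailOf Y = dsum (tailWt 1 Y)

tail-≥0 : ∀ Q Y m → 0ℚ ≤ dsum (tailWt Q Y) m
tail-≥0 Q Y m = ∑-≥0 m λ i _ → term-≥0 (suc i ∣? m) (tailWt-≥0 Q Y (suc i))

big-tail? : ∀ c Y d j → Dec (inv d < tailOf Y (val c j))
big-tail? c Y d j = inv d <? tailOf Y (val c j)

-- The tail has mean at most twice the sum of 1/e² over e > Y, that is at most 2/Y.
uavg-big-tail : ∀ {c Y d} → 0 ℕ.< c → 0 ℕ.< Y → 0 ℕ.< d → UAvg (λ j → 𝟙 (big-tail? c Y d j)) (ι d * (two * inv Y))
uavg-big-tail {c} {Y} {d} 0<c 0<Y 0<d = uavg-mono (λ j → 𝟙-≤ (big-tail? c Y d j) (*-≥0 (ι-≥0 d) (tail-≥0 1 Y (val c j)))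
    λ lt → subst (_≤ ι d * tailOf Y (val c j)) (trans (ℚₚ.*-comm (ι d) (inv d)) (inv-ι′ 0<d)) (*-monoˡ (ι-≥0 d) (ℚₚ.<⇒≤ lt)))
  (uavg-scale (ι d) (ι-≥0 d) (uavg-cong (λ j → cong (tailOf Y) (trans (val-def c j) (ℕₚ.+-comm (2 ℕ.* j) c)))
    (uavg-dsum {tailWt 1 Y} {c} {2} {two} 0<c 2≥0 (tailWt-≥0 1 Y) (tailWt-≤ 1 Y)
      (λ e 0<e x → *-monoˡ (tailWt-≥0 1 Y e) (count-val e 0<e c x))
      λ X → ℚₚ.≤-trans (∑-mono X λ i _ → ℚₚ.≤-trans (*-monoʳ (inv-≥0 (suc i)) (*-monoˡ (𝟙-≥0 (Y ℕₚ.<? suc i)) (wt-≤ 1 (suc i)))) (ℚₚ.≤-reflexive (ℚₚ.*-assoc (𝟙 (Y ℕₚ.<? suc i)) (inv (suc i)) (inv (suc i)))))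
        (sq-above 0<Y X))))

-- Sieving by the primes in (y, z]

LargePrime : ℕ → ℕ → Set
LargePrime y p = Prime p × y ℕ.< p

largePrime? : ∀ y p → Dec (LargePrime y p)
largePrime? y p = prime? p ×-dec (y ℕₚ.<? p)

-- The indicator that no prime in (y, z] divides m, as a product that can be peeled off prime by
-- prime.
sieve : ℕ → ℕ → ℕ → ℚ
sieve y zero m = 1ℚ
sieve y (suc z) m = sieve y z m * (1ℚ - 𝟙 (largePrime? y (suc z)) * 𝟙 (suc z ∣? m))

sieveDensity : ℕ → ℕ → ℚ
sieveDensity y zero = 1ℚ
sieveDensity y (suc z) = sieveDensity y z * (1ℚ - 𝟙 (largePrime? y (suc z)) * inv (suc z))

private
  factor-≥0 : ∀ {P : Set} (d : Dec P) {x} → x ≤ 1ℚ → 0ℚ ≤ 1ℚ - 𝟙 d * x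
  factor-≥0 (yes _) {x} x≤1 = diff-≥0 (subst (_≤ 1ℚ) (sym (ℚₚ.*-identityˡ x)) x≤1)
  factor-≥0 (no _) {x} x≤1 = diff-≥0 (subst (_≤ 1ℚ) (sym (ℚₚ.*-zeroˡ x)) 0≤1)

sieve-≥0 : ∀ y z m → 0ℚ ≤ sieve y z m
sieve-≥0 y zero m = 0≤1
sieve-≥0 y (suc z) m = *-≥0 (sieve-≥0 y z m) (factor-≥0 (largePrime? y (suc z)) (𝟙-≤1 (suc z ∣? m)))

sieveDensity-≥0 : ∀ y z → 0ℚ ≤ sieveDensity y z
sieveDensity-≥0 y zero = 0≤1
sieveDensity-≥0 y (suc z) = *-≥0 (sieveDensity-≥0 y z) (factor-≥0 (largePrime? y (suc z)) (inv-≤1 (suc z)))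

sieve-cases : ∀ y z m → sieve y z m ≡ 1ℚ ⊎ (∃[ i ] (i ℕ.< z × LargePrime y (suc i) × suc i ∣ m))
sieve-cases y zero m = inj₁ refl
sieve-cases y (suc z) m with sieve-cases y z m
... | inj₂ (i , i<z , r) = inj₂ (i , ℕₚ.m<n⇒m<1+n i<z , r)
... | inj₁ eq with largePrime? y (suc z) | suc z ∣? m
... | yes lp | yes d = inj₂ (z , ℕₚ.≤-refl , lp , d)
... | yes _ | no _ = inj₁ (trans (cong (_* (1ℚ - 1ℚ * 0ℚ)) eq) refl)
... | no _ | yes _ = inj₁ (trans (cong (_* (1ℚ - 0ℚ * 1ℚ)) eq) refl)
... | no _ | no _ = inj₁ (trans (cong (_* (1ℚ - 0ℚ * 0ℚ)) eq) refl)

prime-∤-prime : ∀ {p q} → Prime p → Prime q → p ℕ.< q → Coprime p q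
prime-∤-prime pp pq p<q = prime-coprime pq λ d → ℕₚ.<⇒≱ p<q (∣⇒≤ {{ℕ.>-nonZero (prime>0 pp)}} d)

-- Split mod p = suc z: the multiples of p contribute 0, and the other p - 1 classes are handled by
-- induction. They are progressions of modulus M p, hence the general r and M.
uavg-sieve : ∀ y z r M → (∀ i → i ℕ.< z → LargePrime y (suc i) → Coprime (suc i) (2 ℕ.* M)) → UAvg (λ j → sieve y z (b# (r ℕ.+ M ℕ.* j))) (sieveDensity y z)
uavg-sieve y zero r M cop = uavg-1 λ _ → ℚₚ.≤-refl
uavg-sieve y (suc z) r M cop with largePrime? y (suc z)
... | no _ = uavg-≤ (ℚₚ.≤-reflexive (solve 2 (λ a i → a := a :* (con 1ℚ :- con 0ℚ :* i)) refl (sieveDensity y z) (inv (suc z))))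
  (uavg-mono (λ j → ℚₚ.≤-reflexive (solve 2 (λ a i → a :* (con 1ℚ :- con 0ℚ :* i) := a) refl (sieve y z (b# (r ℕ.+ M ℕ.* j))) (𝟙 (suc z ∣? b# (r ℕ.+ M ℕ.* j)))))
    (uavg-sieve y z r M λ i i<z → cop i (ℕₚ.m<n⇒m<1+n i<z)))
... | yes lp@(pp , y<p) = uavg-≤ (ℚₚ.≤-reflexive total) (uavg-split p ℕ.z<s w (λ j → *-≥0 (sieve-≥0 y z (b# (r ℕ.+ M ℕ.* j))) (diff-≥0 (subst (_≤ 1ℚ) (sym (ℚₚ.*-identityˡ _)) (𝟙-≤1 (p ∣? b# (r ℕ.+ M ℕ.* j)))))) (λ i → *-≥0 (sieveDensity-≥0 y z) (diff-≥0 (𝟙-≤1 (d? i)))) sub)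
  where
  p = suc z
  R = sieveDensity y z
  d? : ∀ i → Dec (p ∣ val 3 r ℕ.+ (2 ℕ.* M) ℕ.* i)
  d? i = p ∣? val 3 r ℕ.+ (2 ℕ.* M) ℕ.* i
  w : ℕ → ℚ
  w i = R * (1ℚ - 𝟙 (d? i))
  total : ∑ p w * inv p ≡ R * (1ℚ - 1ℚ * inv p)
  total = trans (cong (_* inv p) (trans (∑-*ˡ p R _) (cong (R *_) (trans (∑-neg p _) (cong (λ k → ι p - k) (∑-residue p ℕ.z<s (val 3 r) (2 ℕ.* M) (cop z ℕₚ.≤-refl lp)))))))
    (trans (solve 3 (λ R p i → (R :* (p :- con 1ℚ)) :* i := R :* (i :* p :- con 1ℚ :* i)) refl R (ι p) (inv p)) (cong (λ k → R * (k - 1ℚ * inv p)) (inv-ι z)))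
  form : ∀ i j → b# ((r ℕ.+ M ℕ.* i) ℕ.+ (M ℕ.* p) ℕ.* j) ≡ (val 3 r ℕ.+ (2 ℕ.* M) ℕ.* i) ℕ.+ p ℕ.* ((2 ℕ.* M) ℕ.* j)
  form i j = trans (val-def 3 _) (trans (solveℕ 6 (λ r c M i p j → # 2 ⊗ ((r ⊕ M ⊗ i) ⊕ (M ⊗ p) ⊗ j) ⊕ c ≐
     ((# 2 ⊗ r ⊕ c) ⊕ (# 2 ⊗ M) ⊗ i) ⊕ p ⊗ ((# 2 ⊗ M) ⊗ j)) refl r 3 M i p j)
     (cong (λ k → (k ℕ.+ (2 ℕ.* M) ℕ.* i) ℕ.+ p ℕ.* ((2 ℕ.* M) ℕ.* j)) (sym (val-def 3 r))))
  G : ℕ → ℚ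
  G k = sieve y z (b# k) * (1ℚ - 1ℚ * 𝟙 (p ∣? b# k))
  sub : ∀ i → i ℕ.< p → UAvg (λ j → G (r ℕ.+ M ℕ.* (j ℕ.* p ℕ.+ i))) (w i)
  sub i _ with d? i
  ... | yes d = uavg-≤ (ℚₚ.≤-reflexive (solve 1 (λ R → con 0ℚ := R :* (con 1ℚ :- con 1ℚ)) refl R)) (uavg-cong (λ j → trans (cong G (sub-progression r M p j i))
      (trans (cong (λ k → sieve y z (b# ((r ℕ.+ M ℕ.* i) ℕ.+ (M ℕ.* p) ℕ.* j)) * (1ℚ - 1ℚ * k)) (𝟙-yes (p ∣? _) (subst (p ∣_) (sym (form i j)) (∣m∣n⇒∣m+n d (m∣m*n ((2 ℕ.* M) ℕ.* j))))))
        (solve 1 (λ s → s :* (con 1ℚ :- con 1ℚ :* con 1ℚ) := con 0ℚ) refl (sieve y z (b# ((r ℕ.+ M ℕ.* i) ℕ.+ (M ℕ.* p) ℕ.* j)))))) uavg-0)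
  ... | no ¬d = uavg-≤ (ℚₚ.≤-reflexive (solve 1 (λ R → R := R :* (con 1ℚ :- con 0ℚ)) refl R)) (uavg-mono (λ j → ℚₚ.≤-reflexive (trans (cong G (sub-progression r M p j i))
      (trans (cong (λ k → sieve y z (b# ((r ℕ.+ M ℕ.* i) ℕ.+ (M ℕ.* p) ℕ.* j)) * (1ℚ - 1ℚ * k)) (𝟙-no (p ∣? _) λ dv → ¬d (∣m+n∣m⇒∣n (subst (p ∣_) (trans (form i j) (ℕₚ.+-comm (val 3 r ℕ.+ (2 ℕ.* M) ℕ.* i) _)) dv) (m∣m*n ((2 ℕ.* M) ℕ.* j)))))
        (solve 1 (λ s → s :* (con 1ℚ :- con 1ℚ :* con 0ℚ) := s) refl (sieve y z (b# ((r ℕ.+ M ℕ.* i) ℕ.+ (M ℕ.* p) ℕ.* j)))))))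
      (uavg-sieve y z (r ℕ.+ M ℕ.* i) (M ℕ.* p) λ k k<z lp′ → subst (Coprime (suc k)) (ℕₚ.*-assoc 2 M p) (coprime-* (cop k (ℕₚ.m<n⇒m<1+n k<z) lp′) (prime-∤-prime (proj₁ lp′) pp (ℕ.s≤s k<z)))))

-- A factor 1 - 1/p at most removes the multiples of p from the harmonic sum; once only the term 1 is left,
-- the product of these factors is bounded by the inverse of a divergent sum.

recipSum : ℕ → ℕ → ℚ
recipSum Q X = ∑ X (λ i → wt Q (suc i))

recipSum-step : ∀ {p Q} → Prime p → Coprime p Q → ∀ X → recipSum Q X * (1ℚ - inv p) ≤ recipSum (p ℕ.* Q) X
recipSum-step {p} {Q} pp cop X = ≤-diff _ (diff-≥0 le) (solve 3 (λ A i B → A :* (con 1ℚ :- i) :+ ((B :+ i :* A) :- A) := B) refl (recipSum Q X) (inv p) (recipSum (p ℕ.* Q) X))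
  where
  open ℚₚ.≤-Reasoning
  pw : ∀ e → wt Q e ≤ wt (p ℕ.* Q) e + 𝟙 (p ∣? e) * wt Q e
  pw e with p ∣? e
  ... | yes _ = ≤-diff (wt (p ℕ.* Q) e) (wt-≥0 (p ℕ.* Q) e) (solve 2 (λ a b → a :+ b := b :+ con 1ℚ :* a) refl (wt Q e) (wt (p ℕ.* Q) e))
  ... | no ¬d = ℚₚ.≤-reflexive (trans (cong (_* inv e) (𝟙-cong (coprime? e Q) (coprime? e (p ℕ.* Q)) (coprime-* (prime-coprime pp ¬d)) (coprime-∣ʳ (n∣m*n p))))
        (solve 2 (λ a b → a := a :+ con 0ℚ :* b) refl (wt (p ℕ.* Q) e) (wt Q e)))
  le : recipSum Q X ≤ recipSum (p ℕ.* Q) X + inv p * recipSum Q X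
  le = begin
    recipSum Q X ≤⟨ ∑-mono X (λ i _ → pw (suc i)) ⟩
    ∑ X (λ i → wt (p ℕ.* Q) (suc i) + 𝟙 (p ∣? suc i) * wt Q (suc i)) ≡⟨ ∑-+ X _ _ ⟩
    recipSum (p ℕ.* Q) X + ∑ X (λ i → 𝟙 (p ∣? suc i) * wt Q (suc i)) ≤⟨ ℚₚ.+-monoʳ-≤ (recipSum (p ℕ.* Q) X) (ℚₚ.≤-trans (∑-extend (ℕₚ.m≤m*n X p {{ℕ.>-nonZero (prime>0 pp)}}) (λ i → term-≥0 (p ∣? suc i) (wt-≥0 Q (suc i))))
        (ℚₚ.≤-trans (ℚₚ.≤-reflexive (∑-multiples p (prime>0 pp) X (wt Q))) (ℚₚ.≤-trans (∑-mono X λ i _ → scaled (suc i) ℕ.z<s) (ℚₚ.≤-reflexive (∑-*ˡ X (inv p) _))))) ⟩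
    recipSum (p ℕ.* Q) X + inv p * recipSum Q X ∎
    where
    scaled : ∀ e → 0 ℕ.< e → wt Q (p ℕ.* e) ≤ inv p * wt Q e
    scaled e 0<e = ℚₚ.≤-trans (*-monoʳ (inv-≥0 (p ℕ.* e)) (𝟙-mono (coprime? (p ℕ.* e) Q) (coprime? e Q) (coprime-∣ˡ (n∣m*n p))))
      (ℚₚ.≤-reflexive (trans (cong (𝟙 (coprime? e Q) *_) (inv-* (prime>0 pp) 0<e)) (solve 3 (λ a b c → a :* (b :* c) := b :* (a :* c)) refl (𝟙 (coprime? e Q)) (inv p) (inv e))))

-- Starting from y ! makes the modulus divisible by every prime up to z, so that no e with 1 < e ≤ z
-- is prime to it.
sieveModulus : ℕ → ℕ → ℕ
sieveModulus y zero = y !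
sieveModulus y (suc z) with largePrime? y (suc z)
... | yes _ = suc z ℕ.* sieveModulus y z
... | no _ = sieveModulus y z

prime-∤-! : ∀ {p} → Prime p → ∀ y → y ℕ.< p → ¬ p ∣ y !
prime-∤-! pp zero _ d = ℕₚ.<⇒≢ (prime>1 pp) (sym (∣1⇒≡1 d))
prime-∤-! pp (suc y) y<p d with euclidsLemma (suc y) (y !) pp d
... | inj₁ e = ℕₚ.<⇒≱ y<p (∣⇒≤ e)
... | inj₂ e = prime-∤-! pp y (ℕₚ.<-trans (ℕₚ.n<1+n y) y<p) e

sieveModulus-coprime : ∀ {p} y → Prime p → y ℕ.< p → ∀ z → z ℕ.< p → Coprime p (sieveModulus y z)
sieveModulus-coprime y pp y<p zero _ = Cop.sym (prime-coprime pp (prime-∤-! pp y y<p))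
sieveModulus-coprime y pp y<p (suc z) z<p with largePrime? y (suc z)
... | yes (pq , _) = coprime-* (Cop.sym (prime-∤-prime pq pp z<p)) (sieveModulus-coprime y pp y<p z (ℕₚ.<-trans (ℕₚ.n<1+n z) z<p))
... | no _ = sieveModulus-coprime y pp y<p z (ℕₚ.<-trans (ℕₚ.n<1+n z) z<p)

sieveModulus-∣ : ∀ y z {p} → LargePrime y p → p ℕ.≤ z → p ∣ sieveModulus y z
sieveModulus-∣ y zero {p} (pp , _) p≤z = ⊥-elim (ℕₚ.<⇒≱ (prime>0 pp) p≤z)
sieveModulus-∣ y (suc z) {p} lp p≤z with p ℕₚ.≟ suc z | largePrime? y (suc z)
... | yes refl | yes _ = m∣m*n (sieveModulus y z)
... | yes refl | no ¬lp = ⊥-elim (¬lp lp)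
... | no p≢ | yes _ = ∣n⇒∣m*n (suc z) (sieveModulus-∣ y z lp (ℕₚ.≤-pred (ℕₚ.≤∧≢⇒< p≤z p≢)))
... | no p≢ | no _ = sieveModulus-∣ y z lp (ℕₚ.≤-pred (ℕₚ.≤∧≢⇒< p≤z p≢))

!-∣-sieveModulus : ∀ y z → y ! ∣ sieveModulus y z
!-∣-sieveModulus y zero = ∣-refl
!-∣-sieveModulus y (suc z) with largePrime? y (suc z)
... | yes _ = ∣n⇒∣m*n (suc z) (!-∣-sieveModulus y z)
... | no _ = !-∣-sieveModulus y z

recipSum-sieve : ∀ y z X → recipSum (y !) X * sieveDensity y z ≤ recipSum (sieveModulus y z) X
recipSum-sieve y zero X = ℚₚ.≤-reflexive (ℚₚ.*-identityʳ (recipSum (y !) X))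
recipSum-sieve y (suc z) X with largePrime? y (suc z)
... | no _ = ℚₚ.≤-trans (ℚₚ.≤-reflexive (solve 3 (λ A R i → A :* (R :* (con 1ℚ :- con 0ℚ :* i)) := A :* R) refl (recipSum (y !) X) (sieveDensity y z) (inv (suc z)))) (recipSum-sieve y z X)
... | yes (pp , y<p) = ℚₚ.≤-trans (ℚₚ.≤-reflexive (solve 3 (λ A R i → A :* (R :* (con 1ℚ :- con 1ℚ :* i)) := (A :* R) :* (con 1ℚ :- i)) refl (recipSum (y !) X) (sieveDensity y z) (inv (suc z))))
   (ℚₚ.≤-trans (*-monoʳ (diff-≥0 (inv-≤1 (suc z))) (recipSum-sieve y z X)) (recipSum-step pp (sieveModulus-coprime y pp y<p z ℕₚ.≤-refl) X))

prime-divisor : ∀ e → 1 ℕ.< e → ∃[ p ] (Prime p × p ∣ e)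
prime-divisor e@(suc _) 1<e with factorise e
... | record { factors = []; isFactorisation = eq } = ⊥-elim (ℕₚ.<⇒≢ 1<e (sym eq))
... | record { factors = p ∷ ps; isFactorisation = eq; factorsPrime = pp ∷ _ } = p , pp , subst (p ∣_) (sym eq) (m∣m*n (product ps))

∣-! : ∀ {m} n → 0 ℕ.< m → m ℕ.≤ n → m ∣ n !
∣-! {suc m} n _ le = ∣-trans (m∣m*n (m !)) (m≤n⇒m!∣n! le)

recipSum-sieved : ∀ y X → recipSum (sieveModulus y X) X ≤ 1ℚ
recipSum-sieved y zero = 0≤1
recipSum-sieved y X@(suc X′) = subst (_≤ 1ℚ) (sym (trans (∑-first X′ _) (trans (cong (wt Q 1 +_) (∑-zero X′ λ i i<X′ → trans (cong (_* inv (suc (suc i))) (𝟙-no (coprime? (suc (suc i)) Q) (not-coprime i i<X′))) (ℚₚ.*-zeroˡ (inv (suc (suc i))))))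
    (ℚₚ.+-identityʳ (wt Q 1))))) (ℚₚ.≤-trans (wt-≤ Q 1) (inv-≤1 1))
  where
  Q = sieveModulus y X
  not-coprime : ∀ i → i ℕ.< X′ → ¬ Coprime (suc (suc i)) Q
  not-coprime i i<X′ c with prime-divisor (suc (suc i)) (ℕ.s≤s ℕ.z<s)
  ... | p , pp , d = ℕₚ.<⇒≢ (prime>1 pp) (sym (c (d , p∣Q)))
    where
    p≤ : p ℕ.≤ X
    p≤ = ℕₚ.≤-trans (∣⇒≤ d) (ℕ.s≤s i<X′)
    p∣Q : p ∣ Q
    p∣Q with ℕₚ.<-≤-connex y p
    ... | inj₁ y<p = sieveModulus-∣ y X (pp , y<p) p≤
    ... | inj₂ p≤y = ∣-trans (∣-! y (prime>0 pp) p≤y) (!-∣-sieveModulus y X)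

-- Each dyadic block contributes at least 1/2.
harmonic-lower : ∀ k → ½ * ι k ≤ ∑ (2 ℕ.^ k) (λ i → inv (suc i))
harmonic-lower zero = ℚₚ.≤-trans (ℚₚ.≤-reflexive (trans (cong (½ *_) ι-0) (ℚₚ.*-zeroʳ ½))) (∑-≥0 1 λ i _ → inv-≥0 (suc i))
harmonic-lower (suc k) = begin
  ½ * ι (suc k) ≡⟨ trans (cong (½ *_) (ι-suc k)) (solve 2 (λ h k → h :* (con 1ℚ :+ k) := h :* k :+ h) refl ½ (ι k)) ⟩
  ½ * ι k + ½ ≤⟨ ℚₚ.+-mono-≤ (harmonic-lower k) half ⟩
  ∑ n (λ i → inv (suc i)) + ∑ n (λ i → inv (suc (n ℕ.+ i))) ≡⟨ sym (∑-split n n _) ⟩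
  ∑ (n ℕ.+ n) (λ i → inv (suc i)) ≡⟨ cong (λ m → ∑ m (λ i → inv (suc i))) (cong (n ℕ.+_) (sym (ℕₚ.+-identityʳ n))) ⟩
  ∑ (2 ℕ.* n) (λ i → inv (suc i)) ∎
  where
  open ℚₚ.≤-Reasoning
  n = 2 ℕ.^ k
  0<n : 0 ℕ.< n
  0<n = ℕₚ.m^n>0 2 k
  half : ½ ≤ ∑ n (λ i → inv (suc (n ℕ.+ i)))
  half = begin
    ½ ≡⟨ sym (trans (cong (ι n *_) (inv-* {2} {n} ℕ.z<s 0<n)) (trans (solve 3 (λ n h i → n :* (h :* i) := h :* (i :* n)) refl (ι n) ½ (inv n)) (trans (cong (½ *_) (inv-ι′ 0<n)) (ℚₚ.*-identityʳ ½)))) ⟩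
    ι n * inv (2 ℕ.* n) ≡⟨ sym (∑-const n (inv (2 ℕ.* n))) ⟩
    ∑ n (λ _ → inv (2 ℕ.* n)) ≤⟨ ∑-mono n (λ i i<n → inv-anti ℕ.z<s (subst (suc (n ℕ.+ i) ℕ.≤_) (cong (n ℕ.+_) (sym (ℕₚ.+-identityʳ n))) (subst (ℕ._≤ n ℕ.+ n) (ℕₚ.+-suc n i) (ℕₚ.+-monoʳ-≤ n i<n)))) ⟩
    ∑ n (λ i → inv (suc (n ℕ.+ i))) ∎

-- The numbers 1 + j W are prime to W and at most W (j + 1).
recipSum-lower : ∀ W → 0 ℕ.< W → ∀ n → inv W * ∑ n (λ i → inv (suc i)) ≤ recipSum W (n ℕ.* W)
recipSum-lower W 0<W n = begin
  inv W * ∑ n (λ i → inv (suc i)) ≡⟨ sym (∑-*ˡ n (inv W) _) ⟩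
  ∑ n (λ j → inv W * inv (suc j)) ≤⟨ ∑-mono n (λ j _ → ℚₚ.≤-trans (ℚₚ.≤-reflexive (sym (inv-* 0<W ℕ.z<s))) (ℚₚ.≤-trans (inv-anti ℕ.z<s (le j)) (ℚₚ.≤-reflexive (sym (wt-eq j))))) ⟩
  ∑ n (λ j → wt W (suc (j ℕ.* W ℕ.+ 0))) ≤⟨ ∑-mono n (λ j _ → ∑-term W 0 0<W (λ i → wt-≥0 W (suc (j ℕ.* W ℕ.+ i)))) ⟩
  ∑ n (λ j → ∑ W (λ i → wt W (suc (j ℕ.* W ℕ.+ i)))) ≡⟨ sym (∑-block n W _) ⟩
  recipSum W (n ℕ.* W) ∎
  where
  open ℚₚ.≤-Reasoning
  le : ∀ j → suc (j ℕ.* W ℕ.+ 0) ℕ.≤ W ℕ.* suc j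
  le j = subst₂ ℕ._≤_ (cong suc (sym (ℕₚ.+-identityʳ (j ℕ.* W)))) (ℕₚ.*-comm (suc j) W) (ℕₚ.+-monoˡ-≤ (j ℕ.* W) 0<W)
  wt-eq : ∀ j → wt W (suc (j ℕ.* W ℕ.+ 0)) ≡ inv (suc (j ℕ.* W ℕ.+ 0))
  wt-eq j = trans (cong (_* inv (suc (j ℕ.* W ℕ.+ 0))) (𝟙-yes (coprime? (suc (j ℕ.* W ℕ.+ 0)) W) λ {d} (d₁ , d₂) →
     ∣1⇒≡1 (∣m+n∣m⇒∣n (subst (d ∣_) (trans (cong suc (ℕₚ.+-identityʳ (j ℕ.* W))) (ℕₚ.+-comm 1 (j ℕ.* W))) d₁) (∣n⇒∣m*n j d₂)))) (ℚₚ.*-identityˡ (inv (suc (j ℕ.* W ℕ.+ 0))))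

sieve-small : ∀ y n → 0 ℕ.< n → ∃[ z ] (0 ℕ.< z × sieveDensity y z ≤ inv n)
sieve-small y n 0<n = z , ℕₚ.*-mono-< (ℕₚ.m^n>0 2 k) 0<W , subst (sieveDensity y z ≤_) (ℚₚ.*-identityˡ (inv n)) (≤-*inv 0<n (begin
  ι n * sieveDensity y z ≤⟨ *-monoʳ (sieveDensity-≥0 y z) lower ⟩
  recipSum W z * sieveDensity y z ≤⟨ recipSum-sieve y z z ⟩
  recipSum (sieveModulus y z) z ≤⟨ recipSum-sieved y z ⟩
  1ℚ ∎))
  where
  open ℚₚ.≤-Reasoning
  W = y !
  0<W : 0 ℕ.< W
  0<W = ℕₚ.1≤n! y
  -- The harmonic sum up to 2 ^ k is at least k/2, and passing to the numbers prime to W costs the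
  -- factor W; this k leaves n.
  k = 2 ℕ.* (W ℕ.* n)
  z = 2 ℕ.^ k ℕ.* W
  lower : ι n ≤ recipSum W z
  lower = begin
    ι n ≡⟨ sym (trans (cong (λ x → inv W * (½ * x)) (trans (ι-* 2 (W ℕ.* n)) (cong (ι 2 *_) (ι-* W n))))
         (trans (solve 5 (λ i h t w n → i :* (h :* (t :* (w :* n))) := (i :* w) :* ((h :* t) :* n)) refl (inv W) ½ (ι 2) (ι W) (ι n))
           (trans (cong₂ (λ u v → u * (v * ι n)) (inv-ι′ 0<W) (inv-ι 1)) (solve 1 (λ n → con 1ℚ :* (con 1ℚ :* n) := n) refl (ι n))))) ⟩
    inv W * (½ * ι k) ≤⟨ *-monoˡ (inv-≥0 W) (harmonic-lower k) ⟩
    inv W * ∑ (2 ℕ.^ k) (λ i → inv (suc i)) ≤⟨ recipSum-lower W 0<W (2 ℕ.^ k) ⟩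
    recipSum W z ∎

-- Concentration of σ(2n+1)/(2n+1) - σ(2n)/(2n)

-- The error budget of `close-resonant`: closeness costs 2 δ, one tail costs δ, and the other,
-- multiplied by 1 + 1/p, at most 2 δ.
five : ℚ → ℚ
five x = x + (x + (x + (x + x)))

three : ℚ
three = 1ℚ + (1ℚ + 1ℚ)

three≥0 : 0ℚ ≤ three
three≥0 = +-≥0 0≤1 (+-≥0 0≤1 0≤1)

1≤-inl : ∀ {x y} → 1ℚ ≤ x → 0ℚ ≤ y → 1ℚ ≤ x + y
1≤-inl {x} {y} 1≤x 0≤y = ℚₚ.≤-trans 1≤x (≤-diff y 0≤y refl)

1≤-inr : ∀ {x y} → 0ℚ ≤ x → 1ℚ ≤ y → 1ℚ ≤ x + y
1≤-inr {x} {y} 0≤x 1≤y = ℚₚ.≤-trans 1≤y (≤-diff x 0≤x (ℚₚ.+-comm y x))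

1≤-𝟙 : ∀ {P : Set} (d : Dec P) → P → 1ℚ ≤ 𝟙 d
1≤-𝟙 d p = ℚₚ.≤-reflexive (sym (𝟙-yes d p))

Close : ℕ → ℕ → ℕ → Set
Close Y d j = trunc 1 Y (b# j) ≤ trunc 1 Y (a# j) + (inv d + inv d) × trunc 1 Y (a# j) ≤ trunc 1 Y (b# j) + (inv d + inv d)

opaque
  close? : ∀ Y d j → Dec (Close Y d j)
  close? Y d j = (_ ≤? _) ×-dec (_ ≤? _)

-- If p divides 2n + 1 exactly once and 2n, 2n + 1 are close, then Resonant p holds;
-- it does not depend on the residue of n mod p.
Resonant : (Y d p j : ℕ) → Set
Resonant Y d p j = trunc (p ℕ.* 1) Y (b# j) * (1ℚ + inv p) ≤ trunc (p ℕ.* 1) Y (a# j) + five (inv d) × trunc (p ℕ.* 1) Y (a# j) ≤ trunc (p ℕ.* 1) Y (b# j) * (1ℚ + inv p) + five (inv d)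

opaque
  resonant? : ∀ Y d p j → Dec (Resonant Y d p j)
  resonant? Y d p j = (_ ≤? _) ×-dec (_ ≤? _)

opaque
  square? : ∀ y i j → Dec (LargePrime y (suc i) × suc i ℕ.* suc i ∣ b# j)
  square? y i j = largePrime? y (suc i) ×-dec (suc i ℕ.* suc i ∣? b# j)

opaque
  divided? : ∀ y Y d i j → Dec (LargePrime y (suc i) × suc i ∣ b# j × Resonant Y d (suc i) j)
  divided? y Y d i j = largePrime? y (suc i) ×-dec ((suc i ∣? b# j) ×-dec resonant? Y d (suc i) j)

Free : (y Y d i j : ℕ) → Set
Free y Y d i j = LargePrime y (suc i) × (¬ suc i ∣ a# j × ¬ suc i ∣ b# j) × Resonant Y d (suc i) j

opaque
  free? : ∀ y Y d i j → Dec (Free y Y d i j)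
  free? y Y d i j = largePrime? y (suc i) ×-dec ((¬? (suc i ∣? a# j) ×-dec ¬? (suc i ∣? b# j)) ×-dec resonant? Y d (suc i) j)

a>0 : ∀ j → 0 ℕ.< a# j
a>0 = val>0 false

b>0 : ∀ j → 0 ℕ.< b# j
b>0 = val>0 true

tail-anti : ∀ Q Y m → dsum (tailWt Q Y) m ≤ tailOf Y m
tail-anti Q Y m = ∑-mono m λ i _ → *-monoˡ (𝟙-≥0 (suc i ∣? m)) (*-monoˡ (𝟙-≥0 (Y ℕₚ.<? suc i)) (*-monoʳ (inv-≥0 (suc i)) (𝟙-mono (coprime? (suc i) Q) (coprime? (suc i) 1) λ _ → Cop.sym (Cop.1-coprimeTo (suc i)))))

trunc-∤ : ∀ {p Q} Y {m} → Prime p → ¬ p ∣ m → trunc Q Y m ≡ trunc (p ℕ.* Q) Y m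
trunc-∤ {p} {Q} Y {m} pp p∤m = ∑-cong Y λ i _ → pw (suc i)
  where
  pw : ∀ e → 𝟙 (e ∣? m) * wt Q e ≡ 𝟙 (e ∣? m) * wt (p ℕ.* Q) e
  pw e with e ∣? m
  ... | no _ = trans (ℚₚ.*-zeroˡ (wt Q e)) (sym (ℚₚ.*-zeroˡ (wt (p ℕ.* Q) e)))
  ... | yes d = cong (λ k → 1ℚ * (k * inv e)) (𝟙-cong (coprime? e Q) (coprime? e (p ℕ.* Q)) (coprime-* (prime-coprime pp λ p∣e → p∤m (∣-trans p∣e d))) (coprime-∣ʳ (n∣m*n p)))

h-exact : ∀ {p m} → Prime p → 0 ℕ.< m → p ∣ m → ¬ p ℕ.* p ∣ m → h 1 m ≡ (1ℚ + inv p) * h (p ℕ.* 1) m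
h-exact {p} {m} pp 0<m d ¬dd = trans (ℚₚ.≤-antisym (h-upper pp (Cop.sym (Cop.1-coprimeTo p)) 1 0<m (¬dd ∘ subst (_∣ m) (cong (p ℕ.*_) (ℕₚ.*-identityʳ p))))
   (h-lower pp (Cop.sym (Cop.1-coprimeTo p)) 1 0<m (subst (_∣ m) (sym (ℕₚ.*-identityʳ p)) d))) (cong (λ k → (1ℚ + k) * h (p ℕ.* 1) m) (ℚₚ.*-identityʳ (inv p)))

close-resonant : ∀ {Y d p j} → Prime p → p ∣ b# j → ¬ p ℕ.* p ∣ b# j → Close Y d j → tailOf Y (a# j) ≤ inv d → tailOf Y (b# j) ≤ inv d → Resonant Y d p j
close-resonant {Y} {d} {p} {j} pp p∣b ¬pp∣b (c₁ , c₂) τa≤ τb≤ = first , second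
  where
  open ℚₚ.≤-Reasoning
  δ = inv d
  δ≥0 = inv-≥0 d
  i = inv p
  x = trunc (p ℕ.* 1) Y (b# j)
  w = trunc (p ℕ.* 1) Y (a# j)
  ta = trunc 1 Y (a# j)
  tb = trunc 1 Y (b# j)
  τa = tailOf Y (a# j)
  τb = tailOf Y (b# j)
  τ′a = dsum (tailWt (p ℕ.* 1) Y) (a# j)
  τ′b = dsum (tailWt (p ℕ.* 1) Y) (b# j)
  b-eq : tb + τb ≡ (1ℚ + i) * (x + τ′b)
  b-eq = trans (sym (h-trunc 1 Y (b>0 j))) (trans (h-exact pp (b>0 j) p∣b ¬pp∣b) (cong ((1ℚ + i) *_) (h-trunc (p ℕ.* 1) Y (b>0 j))))
  a-eq : ta + τa ≡ w + τ′a
  a-eq = trans (sym (h-trunc 1 Y (a>0 j))) (trans (h-∤ pp (λ p∣a → val-sep true j pp p∣b p∣a)) (h-trunc (p ℕ.* 1) Y (a>0 j)))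
  1+i≥0 : 0ℚ ≤ 1ℚ + i
  1+i≥0 = +-≥0 0≤1 (inv-≥0 p)
  first : x * (1ℚ + i) ≤ w + five δ
  first = begin
    x * (1ℚ + i) ≤⟨ ≤-diff ((1ℚ + i) * τ′b) (*-≥0 1+i≥0 (tail-≥0 (p ℕ.* 1) Y (b# j))) (solve 3 (λ x i t → x :* (con 1ℚ :+ i) :+ (con 1ℚ :+ i) :* t := (con 1ℚ :+ i) :* (x :+ t)) refl x i τ′b) ⟩
    (1ℚ + i) * (x + τ′b) ≡⟨ sym b-eq ⟩
    tb + τb ≤⟨ ℚₚ.+-mono-≤ c₁ τb≤ ⟩
    ta + (δ + δ) + δ ≤⟨ ≤-diff τa (tail-≥0 1 Y (a# j)) (solve 3 (λ a d t → (a :+ (d :+ d) :+ d) :+ t := (a :+ t) :+ (d :+ d :+ d)) refl ta δ τa) ⟩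
    (ta + τa) + (δ + δ + δ) ≡⟨ cong (_+ (δ + δ + δ)) a-eq ⟩
    (w + τ′a) + (δ + δ + δ) ≤⟨ ℚₚ.+-monoˡ-≤ (δ + δ + δ) (ℚₚ.+-monoʳ-≤ w (ℚₚ.≤-trans (tail-anti (p ℕ.* 1) Y (a# j)) τa≤)) ⟩
    (w + δ) + (δ + δ + δ) ≤⟨ ≤-diff δ δ≥0 (solve 2 (λ w d → ((w :+ d) :+ (d :+ d :+ d)) :+ d := w :+ (d :+ (d :+ (d :+ (d :+ d))))) refl w δ) ⟩
    w + five δ ∎
  second : w ≤ x * (1ℚ + i) + five δ
  second = begin
    w ≤⟨ ≤-diff τ′a (tail-≥0 (p ℕ.* 1) Y (a# j)) refl ⟩
    w + τ′a ≡⟨ sym a-eq ⟩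
    ta + τa ≤⟨ ℚₚ.+-mono-≤ c₂ τa≤ ⟩
    tb + (δ + δ) + δ ≤⟨ ≤-diff τb (tail-≥0 1 Y (b# j)) (solve 3 (λ a d t → (a :+ (d :+ d) :+ d) :+ t := (a :+ t) :+ (d :+ d :+ d)) refl tb δ τb) ⟩
    (tb + τb) + (δ + δ + δ) ≡⟨ cong (_+ (δ + δ + δ)) b-eq ⟩
    (1ℚ + i) * (x + τ′b) + (δ + δ + δ) ≤⟨ ℚₚ.+-monoˡ-≤ (δ + δ + δ) (*-monoˡ 1+i≥0 (ℚₚ.+-monoʳ-≤ x (ℚₚ.≤-trans (tail-anti (p ℕ.* 1) Y (b# j)) τb≤))) ⟩
    (1ℚ + i) * (x + δ) + (δ + δ + δ) ≤⟨ ≤-diff ((1ℚ - i) * δ) (*-≥0 (diff-≥0 (inv-≤1 p)) δ≥0) (solve 3 (λ x i d → ((con 1ℚ :+ i) :* (x :+ d) :+ (d :+ d :+ d)) :+ (con 1ℚ :- i) :* d := x :* (con 1ℚ :+ i) :+ (d :+ (d :+ (d :+ (d :+ d))))) refl x i δ) ⟩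
    x * (1ℚ + i) + five δ ∎

trunc-≥1 : ∀ Q {Y} m → 0 ℕ.< Y → 1ℚ ≤ trunc Q Y m
trunc-≥1 Q {Y} m 0<Y = ℚₚ.≤-trans (ℚₚ.≤-reflexive (sym (trans (cong₂ _*_ (𝟙-yes (1 ∣? m) (1∣ m)) (trans (cong₂ _*_ (𝟙-yes (coprime? 1 Q) (Cop.1-coprimeTo Q)) inv-1) refl)) refl)))
  (∑-term Y 0 0<Y λ i → term-≥0 (suc i ∣? m) (wt-≥0 Q (suc i)))

-- For n prime to two large primes p < q, Resonant p and Resonant q would force 1/p - 1/q to be tiny.
free-unique : ∀ {y Y d z i k j} → 0 ℕ.< Y → 0 ℕ.< z → five (inv d) + five (inv d) < inv z * inv z → i ℕ.< k → k ℕ.< z → Free y Y d i j → Free y Y d k j → ⊥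
free-unique {y} {Y} {d} {z} {i} {k} {j} 0<Y 0<z gap i<k k<z (lp , (p∤a , p∤b) , (r₁ , _)) (lq , (q∤a , q∤b) , (_ , s₂)) = ℚₚ.<-irrefl refl (begin-strict
  inv z * inv z ≤⟨ *-mono (inv-≥0 z) (inv-≥0 (suc p)) inv≤ inv≤ ⟩
  inv (suc p) * inv (suc p) ≤⟨ inv-sq-≤ p ℕ.z<s ⟩
  inv p - inv (suc p) ≤⟨ ℚₚ.+-monoʳ-≤ (inv p) (ℚₚ.neg-antimono-≤ (inv-anti {suc p} ℕ.z<s (ℕ.s≤s i<k))) ⟩
  inv p - inv q ≡⟨ sym (ℚₚ.*-identityˡ (inv p - inv q)) ⟩
  1ℚ * (inv p - inv q) ≤⟨ *-monoʳ (diff-≥0 (inv-anti {p} ℕ.z<s (ℕₚ.<⇒≤ (ℕ.s≤s i<k)))) (trunc-≥1 1 (b# j) 0<Y) ⟩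
  B * (inv p - inv q) ≤⟨ ≤-diff ((B * (1ℚ + inv q) + five δ) + (A + five δ) - (A + B * (1ℚ + inv p))) (diff-≥0 (ℚₚ.≤-trans (ℚₚ.≤-reflexive (ℚₚ.+-comm A (B * (1ℚ + inv p)))) (ℚₚ.≤-trans (ℚₚ.+-mono-≤ r₁′ s₂′) (ℚₚ.≤-reflexive (ℚₚ.+-comm (A + five δ) _)))))
      (solve 5 (λ B ip iq A f → B :* (ip :- iq) :+ ((B :* (con 1ℚ :+ iq) :+ f) :+ (A :+ f) :- (A :+ B :* (con 1ℚ :+ ip))) := f :+ f) refl B (inv p) (inv q) A (five δ)) ⟩
  five δ + five δ <⟨ gap ⟩
  inv z * inv z ∎)
  where
  open ℚₚ.≤-Reasoning
  p = suc i
  q = suc k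
  δ = inv d
  A = trunc 1 Y (a# j)
  B = trunc 1 Y (b# j)
  inv≤ : inv z ≤ inv (suc p)
  inv≤ = inv-anti {suc p} ℕ.z<s (ℕₚ.≤-trans (ℕ.s≤s i<k) k<z)
  -- As p and q divide neither number, removing them changes nothing, and both resonances concern
  -- the same pair A, B.
  r₁′ : B * (1ℚ + inv p) ≤ A + five δ
  r₁′ = subst₂ (λ u v → u * (1ℚ + inv p) ≤ v + five δ) (sym (trunc-∤ {p} {1} Y (proj₁ lp) p∤b)) (sym (trunc-∤ {p} {1} Y (proj₁ lp) p∤a)) r₁
  s₂′ : A ≤ B * (1ℚ + inv q) + five δ
  s₂′ = subst₂ (λ u v → u ≤ v * (1ℚ + inv q) + five δ) (sym (trunc-∤ {q} {1} Y (proj₁ lq) q∤a)) (sym (trunc-∤ {q} {1} Y (proj₁ lq) q∤b)) s₂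

free-atMostOne : ∀ {y Y d z} → 0 ℕ.< Y → 0 ℕ.< z → five (inv d) + five (inv d) < inv z * inv z → ∀ j → ∑ z (λ i → 𝟙 (free? y Y d i j)) ≤ 1ℚ
free-atMostOne {y} {Y} {d} {z} 0<Y 0<z gap j = ∑-atMostOne z (λ i → free? y Y d i j) uniq
  where
  uniq : ∀ i k → i ℕ.< z → k ℕ.< z → Free y Y d i j → Free y Y d k j → i ≡ k
  uniq i k i<z k<z f g with ℕₚ.<-cmp i k
  ... | tri≈ _ eq _ = eq
  ... | tri< i<k _ _ = ⊥-elim (free-unique {y} {Y} {d} {z} {i} {k} {j} 0<Y 0<z gap i<k k<z f g)
  ... | tri> _ _ k<i = ⊥-elim (free-unique {y} {Y} {d} {z} {k} {i} {j} 0<Y 0<z gap k<i i<z g f)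

-- Passing from n with p | 2n + 1 to n prime to p costs a factor of about 1/p in density.
divided-free : ∀ y Y d i → 2 ℕ.≤ y → ∃[ K ] (∀ x → ∑ x (λ j → 𝟙 (divided? y Y d i j)) ≤ (three * inv y) * ∑ x (λ j → 𝟙 (free? y Y d i j)) + K)
divided-free y Y d i 2≤y with largePrime? y (suc i)
... | no ¬lp = 0ℚ , λ x → ℚₚ.≤-trans (ℚₚ.≤-reflexive (∑-zero x λ j _ → 𝟙-no (divided? y Y d i j) (¬lp ∘ proj₁)))
    (+-≥0 (*-≥0 (*-≥0 three≥0 (inv-≥0 y)) (∑-≥0 x λ j _ → 𝟙-≥0 (free? y Y d i j))) ℚₚ.≤-refl)
... | yes lp@(pp , y<p) = K , go
  where
  open ℚₚ.≤-Reasoning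
  p = suc i
  ip = inv p
  M = period (p ℕ.* 1) Y
  f : ℕ → ℚ
  f j = 𝟙 (resonant? Y d p j)
  f≥0 : ∀ j → 0ℚ ≤ f j
  f≥0 j = 𝟙-≥0 (resonant? Y d p j)
  per : Periodic M f
  per t j = 𝟙-cong (resonant? Y d p (t ℕ.* M ℕ.+ j)) (resonant? Y d p j)
    (subst₂ (λ u v → u * (1ℚ + inv p) ≤ v + five (inv d) × v ≤ u * (1ℚ + inv p) + five (inv d)) (trunc-periodic (p ℕ.* 1) Y 3 t j) (trunc-periodic (p ℕ.* 1) Y 2 t j))
    (subst₂ (λ u v → u * (1ℚ + inv p) ≤ v + five (inv d) × v ≤ u * (1ℚ + inv p) + five (inv d)) (sym (trunc-periodic (p ℕ.* 1) Y 3 t j)) (sym (trunc-periodic (p ℕ.* 1) Y 2 t j)))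
  0<M = period>0 (p ℕ.* 1) Y
  cop : Coprime p (2 ℕ.* M)
  cop = coprime-* (Cop.sym (prime-∤-prime prime[2] pp (ℕₚ.≤-<-trans 2≤y y<p))) (coprime-∣ˡ (m∣m*n 1) (period-coprime (p ℕ.* 1) Y))
  F = ∑ M f
  F≥0 : 0ℚ ≤ F
  F≥0 = ∑-≥0 M λ j _ → f≥0 j
  c = F * inv M
  c≥0 : 0ℚ ≤ c
  c≥0 = *-≥0 F≥0 (inv-≥0 M)
  -- Up to an error 5 F, a share of at least 1 - 2/p ≥ 1/3 of the resonant n is free of p. Hence the
  -- factor 3/p, and the total error 2 F + 15 F.
  ι17 = two + (three * five 1ℚ)
  K = ι17 * F
  3ip≤1 : three * ip ≤ 1ℚ
  3ip≤1 = ℚₚ.≤-trans (*-monoˡ three≥0 (inv-anti {3} ℕ.z<s (ℕₚ.≤-<-trans 2≤y y<p)))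
    (ℚₚ.≤-reflexive (trans (ℚₚ.*-comm three (inv 3)) (trans (cong (inv 3 *_) (sym (trans (ι-suc 2) (cong (1ℚ +_) (trans (ι-suc 1) (cong (1ℚ +_) ι-1)))))) (inv-ι 2))))
  go : ∀ x → ∑ x (λ j → 𝟙 (divided? y Y d i j)) ≤ (three * inv y) * ∑ x (λ j → 𝟙 (free? y Y d i j)) + K
  go x = begin
    ∑ x (λ j → 𝟙 (divided? y Y d i j)) ≤⟨ ∑-mono x (λ j _ → 𝟙-≤ (divided? y Y d i j) (term-≥0 (p ∣? b# j) (f≥0 j)) λ (_ , dv , r) →
        ℚₚ.≤-reflexive (sym (trans (cong₂ _*_ (𝟙-yes (p ∣? b# j) dv) (𝟙-yes (resonant? Y d p j) r)) refl))) ⟩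
    Sb ≤⟨ Sb≤ ⟩
    c * ip * X + (F + F) ≤⟨ ≤-diff (c * ip * X * (two * (1ℚ - three * ip)) + F * (three * five 1ℚ * (1ℚ - ip)))
         (+-≥0 (*-≥0 (*-≥0 (*-≥0 c≥0 (inv-≥0 p)) (ι-≥0 x)) (*-≥0 2≥0 (diff-≥0 3ip≤1))) (*-≥0 F≥0 (*-≥0 (*-≥0 three≥0 (+-≥0 0≤1 (+-≥0 0≤1 (+-≥0 0≤1 (+-≥0 0≤1 0≤1))))) (diff-≥0 (inv-≤1 p)))))
         (solve 4 (λ c ip X F → let one = con 1ℚ ; thr = one :+ (one :+ one) ; fiv = one :+ (one :+ (one :+ (one :+ one))) ; tw = one :+ one in
            (c :* ip :* X :+ (F :+ F)) :+ (c :* ip :* X :* (tw :* (one :- thr :* ip)) :+ F :* (thr :* fiv :* (one :- ip))) :=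
            thr :* ip :* ((c :* X :- F) :- ((c :* ip :* X :+ (F :+ F)) :+ (c :* ip :* X :+ (F :+ F)))) :+ (tw :+ (thr :* fiv)) :* F) refl c ip X F) ⟩
    three * ip * ((c * X - F) - ((c * ip * X + (F + F)) + (c * ip * X + (F + F)))) + K ≤⟨ ℚₚ.+-monoˡ-≤ K (*-monoˡ (*-≥0 three≥0 (inv-≥0 p)) G≥) ⟩
    three * ip * G + K ≤⟨ ℚₚ.+-monoˡ-≤ K (*-monoʳ (∑-≥0 x λ j _ → 𝟙-≥0 (free? y Y d i j)) (*-monoˡ three≥0 (inv-anti (ℕₚ.<-≤-trans ℕ.z<s 2≤y) (ℕₚ.<⇒≤ y<p)))) ⟩
    (three * inv y) * G + K ∎
    where
    X = ι x
    G = ∑ x (λ j → 𝟙 (free? y Y d i j))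
    Sa = ∑ x (λ j → 𝟙 (p ∣? a# j) * f j)
    Sb = ∑ x (λ j → 𝟙 (p ∣? b# j) * f j)
    Sa≤ : Sa ≤ c * ip * X + (F + F)
    Sa≤ = periodic-multiples 2 0<M per f≥0 ℕ.z<s cop x
    Sb≤ : Sb ≤ c * ip * X + (F + F)
    Sb≤ = periodic-multiples 3 0<M per f≥0 ℕ.z<s cop x
    pw : ∀ j → f j ≤ (𝟙 (p ∣? a# j) * f j + 𝟙 (p ∣? b# j) * f j) + 𝟙 (free? y Y d i j)
    pw j with p ∣? a# j | p ∣? b# j
    ... | yes _ | dB = ≤-diff (𝟙 dB * f j + 𝟙 (free? y Y d i j)) (+-≥0 (term-≥0 dB (f≥0 j)) (𝟙-≥0 (free? y Y d i j))) (solve 3 (λ f b g → f :+ (b :+ g) := (con 1ℚ :* f :+ b) :+ g) refl (f j) (𝟙 dB * f j) (𝟙 (free? y Y d i j)))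
    ... | no _ | yes _ = ≤-diff (𝟙 (free? y Y d i j)) (𝟙-≥0 (free? y Y d i j)) (solve 2 (λ f g → f :+ g := (con 0ℚ :* f :+ con 1ℚ :* f) :+ g) refl (f j) (𝟙 (free? y Y d i j)))
    ... | no ¬a | no ¬b = ℚₚ.≤-trans (𝟙-mono (resonant? Y d p j) (free? y Y d i j) (λ r → lp , (¬a , ¬b) , r)) (ℚₚ.≤-reflexive (solve 2 (λ f g → g := (con 0ℚ :* f :+ con 0ℚ :* f) :+ g) refl (f j) (𝟙 (free? y Y d i j))))
    all≤ : ∑ x f ≤ (Sa + Sb) + G
    all≤ = ℚₚ.≤-trans (∑-mono x λ j _ → pw j) (ℚₚ.≤-reflexive (trans (∑-+ x _ _) (cong (_+ G) (∑-+ x _ _))))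
    G≥ : (c * X - F) - ((c * ip * X + (F + F)) + (c * ip * X + (F + F))) ≤ G
    G≥ = begin
      (c * X - F) - ((c * ip * X + (F + F)) + (c * ip * X + (F + F))) ≤⟨ ℚₚ.+-mono-≤ (ℚₚ.≤-trans (periodic-lower 0<M per f≥0 x) all≤) (ℚₚ.neg-antimono-≤ (ℚₚ.+-mono-≤ Sa≤ Sb≤)) ⟩
      ((Sa + Sb) + G) - (Sa + Sb) ≡⟨ solve 2 (λ s g → (s :+ g) :- s := g) refl (Sa + Sb) G ⟩
      G ∎

-- At each n at most one prime is free, so the sum over p of the densities of the free n is at most
-- 1, however many primes there are.
uavg-divided : ∀ {y Y d z} → 2 ℕ.≤ y → 0 ℕ.< Y → 0 ℕ.< z → five (inv d) + five (inv d) < inv z * inv z → UAvg (λ j → ∑ z (λ i → 𝟙 (divided? y Y d i j))) (three * inv y)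
uavg-divided {y} {Y} {d} {z} 2≤y 0<Y 0<z gap = uavg-bounded (∑ z K) λ x → begin
  ∑ x (λ j → ∑ z (λ i → 𝟙 (divided? y Y d i j))) ≡⟨ ∑-swap x z _ ⟩
  ∑ z (λ i → ∑ x (λ j → 𝟙 (divided? y Y d i j))) ≤⟨ ∑-mono z (λ i _ → proj₂ (divided-free y Y d i 2≤y) x) ⟩
  ∑ z (λ i → (three * inv y) * ∑ x (λ j → 𝟙 (free? y Y d i j)) + K i) ≡⟨ trans (∑-+ z _ K) (cong (_+ ∑ z K) (trans (∑-*ˡ z (three * inv y) _) (cong ((three * inv y) *_) (∑-swap z x _)))) ⟩
  (three * inv y) * ∑ x (λ j → ∑ z (λ i → 𝟙 (free? y Y d i j))) + ∑ z K ≤⟨ ℚₚ.+-monoˡ-≤ (∑ z K) (*-monoˡ (*-≥0 three≥0 (inv-≥0 y)) (ℚₚ.≤-trans (∑-mono x λ j _ → free-atMostOne {y} {Y} {d} {z} 0<Y 0<z gap j) (ℚₚ.≤-reflexive (trans (∑-const x 1ℚ) (ℚₚ.*-identityʳ (ι x)))))) ⟩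
  (three * inv y) * ι x + ∑ z K ∎
  where
  open ℚₚ.≤-Reasoning
  K : ℕ → ℚ
  K i = proj₁ (divided-free y Y d i 2≤y)

uavg-square : ∀ {y} z → 2 ℕ.≤ y → UAvg (λ j → ∑ z (λ i → 𝟙 (square? y i j))) (inv y)
uavg-square {y} z 2≤y = uavg-≤ (sq-above (ℕₚ.<-≤-trans ℕ.z<s 2≤y) z) (uavg-∑ z λ i _ → one i)
  where
  one : ∀ i → UAvg (λ j → 𝟙 (square? y i j)) (𝟙 (y ℕₚ.<? suc i) * (inv (suc i) * inv (suc i)))
  one i with largePrime? y (suc i)
  ... | no ¬lp = uavg-≤ (term-≥0 (y ℕₚ.<? suc i) (*-≥0 (inv-≥0 (suc i)) (inv-≥0 (suc i)))) (uavg-mono (λ j → ℚₚ.≤-reflexive (𝟙-no (square? y i j) (¬lp ∘ proj₁))) uavg-0)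
  ... | yes lp@(pp , y<p) = uavg-mono {g = λ j → 𝟙 (p ℕ.* p ∣? 3 ℕ.+ 2 ℕ.* j)} (λ j → 𝟙-mono (square? y i j) (p ℕ.* p ∣? 3 ℕ.+ 2 ℕ.* j) λ (_ , dv) → subst (p ℕ.* p ∣_) (trans (val-def 3 j) (ℕₚ.+-comm (2 ℕ.* j) 3)) dv)
     (uavg-bounded 1ℚ λ x → ℚₚ.≤-trans (count-multiples (p ℕ.* p) ℕ.z<s 3 2 (Cop.sym (coprime-* 2⊥p 2⊥p)) x)
        (ℚₚ.≤-reflexive (cong (_+ 1ℚ) (trans (ℚₚ.*-comm (ι x) (inv (p ℕ.* p))) (cong (_* ι x) (trans (inv-* {p} {p} ℕ.z<s ℕ.z<s) (sym (trans (cong (_* (inv p * inv p)) (𝟙-yes (y ℕₚ.<? p) y<p)) (ℚₚ.*-identityˡ (inv p * inv p))))))))))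
    where
    p = suc i
    2⊥p : Coprime 2 p
    2⊥p = prime-∤-prime prime[2] pp (ℕₚ.≤-<-trans 2≤y y<p)

-- If the tails are small and a prime p in (y, z] divides 2n + 1, then either p² divides it or
-- `close-resonant` applies; without such a prime the sieve counts n.
close-cover : ∀ y z Y d j → 𝟙 (close? Y d j) ≤ 𝟙 (big-tail? 2 Y d j) + (𝟙 (big-tail? 3 Y d j) + (sieve y z (b# j) + (∑ z (λ i → 𝟙 (square? y i j)) + ∑ z (λ i → 𝟙 (divided? y Y d i j)))))
close-cover y z Y d j = 𝟙-≤ (close? Y d j) (+-≥0 A≥0 (+-≥0 B≥0 (+-≥0 S≥0 (+-≥0 Q≥0 D≥0)))) go
  where
  A≥0 = 𝟙-≥0 (big-tail? 2 Y d j)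
  B≥0 = 𝟙-≥0 (big-tail? 3 Y d j)
  S≥0 = sieve-≥0 y z (b# j)
  Q≥0 = ∑-≥0 z λ i _ → 𝟙-≥0 (square? y i j)
  D≥0 = ∑-≥0 z λ i _ → 𝟙-≥0 (divided? y Y d i j)
  go : Close Y d j → 1ℚ ≤ 𝟙 (big-tail? 2 Y d j) + (𝟙 (big-tail? 3 Y d j) + (sieve y z (b# j) + (∑ z (λ i → 𝟙 (square? y i j)) + ∑ z (λ i → 𝟙 (divided? y Y d i j)))))
  go cl with inv d <? tailOf Y (a# j)
  ... | yes _ = 1≤-inl ℚₚ.≤-refl (+-≥0 B≥0 (+-≥0 S≥0 (+-≥0 Q≥0 D≥0)))
  ... | no ¬ta with inv d <? tailOf Y (b# j)
  ... | yes _ = 1≤-inr ℚₚ.≤-refl (1≤-inl ℚₚ.≤-refl (+-≥0 S≥0 (+-≥0 Q≥0 D≥0)))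
  ... | no ¬tb with sieve-cases y z (b# j)
  ... | inj₁ eq = 1≤-inr ℚₚ.≤-refl (1≤-inr ℚₚ.≤-refl (1≤-inl (ℚₚ.≤-reflexive (sym eq)) (+-≥0 Q≥0 D≥0)))
  ... | inj₂ (i , i<z , lp , dv) with suc i ℕ.* suc i ∣? b# j
  ... | yes dd = 1≤-inr ℚₚ.≤-refl (1≤-inr ℚₚ.≤-refl (1≤-inr S≥0 (1≤-inl (ℚₚ.≤-trans (1≤-𝟙 (square? y i j) (lp , dd)) (∑-term z i i<z λ k → 𝟙-≥0 (square? y k j))) D≥0)))
  ... | no ¬dd = 1≤-inr ℚₚ.≤-refl (1≤-inr ℚₚ.≤-refl (1≤-inr S≥0 (1≤-inr Q≥0 (ℚₚ.≤-trans (1≤-𝟙 (divided? y Y d i j)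
      (lp , dv , close-resonant {Y} {d} {suc i} {j} (proj₁ lp) dv ¬dd cl (ℚₚ.≮⇒≥ ¬ta) (ℚₚ.≮⇒≥ ¬tb))) (∑-term z i i<z λ k → 𝟙-≥0 (divided? y Y d k j))))))

uavg-close : ∀ y z Y d → 2 ℕ.≤ y → 0 ℕ.< z → 0 ℕ.< Y → 0 ℕ.< d → five (inv d) + five (inv d) < inv z * inv z →
  UAvg (λ j → 𝟙 (close? Y d j)) (ι d * (two * inv Y) + (ι d * (two * inv Y) + (sieveDensity y z + (inv y + three * inv y))))
uavg-close y z Y d 2≤y 0<z 0<Y 0<d gap = uavg-mono (close-cover y z Y d)
  (uavg-+ (uavg-big-tail ℕ.z<s 0<Y 0<d) (uavg-+ (uavg-big-tail ℕ.z<s 0<Y 0<d) (uavg-+ sv (uavg-+ (uavg-square z 2≤y) (uavg-divided {y} {Y} {d} {z} 2≤y 0<Y 0<z gap)))))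
  where
  sv : UAvg (λ j → sieve y z (b# j)) (sieveDensity y z)
  sv = uavg-cong (λ j → cong (λ k → sieve y z (b# k)) (sym (ℕₚ.*-identityˡ j))) (uavg-sieve y z 0 1 λ i _ (pp , y<p) → Cop.sym (prime-∤-prime prime[2] pp (ℕₚ.≤-<-trans 2≤y y<p)))

-- The set B in terms of h

InB : ℕ → Set
InB j = σ (2 ℕ.* suc j) ℕ.≤ σ (2 ℕ.* suc j ℕ.+ 1)

opaque
  inB? : ∀ j → Dec (InB j)
  inB? j = σ (2 ℕ.* suc j) ℕ.≤? σ (2 ℕ.* suc j ℕ.+ 1)

  ∑-inB : ∀ x → ι (Bcount x) ≡ ∑ x (λ j → 𝟙 (inB? j))
  ∑-inB x = ∑-length (λ n → σ (2 ℕ.* n) ℕ.≤? σ (2 ℕ.* n ℕ.+ 1)) (λ j → j) x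

a-form : ∀ j → a# j ≡ 2 ℕ.* suc j
a-form j = trans (val-def 2 j) (solveℕ 1 (λ j → # 2 ⊗ j ⊕ # 2 ≐ # 2 ⊗ (# 1 ⊕ j)) refl j)

b-form : ∀ j → b# j ≡ 2 ℕ.* suc j ℕ.+ 1
b-form j = trans (val-def 3 j) (solveℕ 1 (λ j → # 2 ⊗ j ⊕ # 3 ≐ # 2 ⊗ (# 1 ⊕ j) ⊕ # 1) refl j)

σ-a : ∀ j → ι (σ (2 ℕ.* suc j)) ≡ ι (a# j) * h 1 (a# j)
σ-a j = subst (λ n → ι (σ n) ≡ ι (a# j) * h 1 (a# j)) (a-form j) (σ-h (a>0 j))

σ-b : ∀ j → ι (σ (2 ℕ.* suc j ℕ.+ 1)) ≡ ι (a# j) * h 1 (b# j) + h 1 (b# j)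
σ-b j = trans (subst (λ n → ι (σ n) ≡ ι (b# j) * h 1 (b# j)) (b-form j) (σ-h (b>0 j)))
  (trans (cong (_* h 1 (b# j)) (trans (cong ι (trans (b-form j) (cong (ℕ._+ 1) (sym (a-form j))))) (trans (ι-+ (a# j) 1) (cong (ι (a# j) +_) ι-1))))
    (solve 2 (λ a h → (a :+ con 1ℚ) :* h := a :* h :+ h) refl (ι (a# j)) (h 1 (b# j))))

inB-h : ∀ j → InB j → ι (a# j) * h 1 (a# j) ≤ ι (a# j) * h 1 (b# j) + h 1 (b# j)
inB-h j le = subst₂ _≤_ (σ-a j) (σ-b j) (ι-mono le)

¬inB-h : ∀ j → ¬ InB j → h 1 (b# j) < h 1 (a# j)
¬inB-h j ¬le = *-cancelˡ-< (ι-≥0 (a# j)) (ℚₚ.≤-<-trans (≤-diff (h 1 (b# j)) (h-≥0 1 (b# j)) refl)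
  (ℚₚ.≰⇒> (¬le ∘ ι-cancel ∘ subst₂ _≤_ (sym (σ-a j)) (sym (σ-b j)))))

¬inB-bad : ∀ N o j → ¬ InB j → Bad true N 1 o o j
¬inB-bad N o j ¬le = mkBad (*-monoˡ-< (ℚₚ.<-≤-trans 0<1 (pow-≥1 (base-≥1 N) o)) (¬inB-h j ¬le))

-- For n in B, h(2n) ≤ (1 + 1/(2n)) h(2n + 1), and 2n > N here, so one cell of the grid absorbs the
-- factor.
inB-bad : ∀ N i j → 0 ℕ.< N → N ℕ.≤ j → InB j → Bad false N 1 i (suc i) j
inB-bad N i j 0<N N≤j le = mkBad (subst (pow (base N) i * ha <_) (solve 3 (λ b p x → p :* (b :* x) := (b :* p) :* x) refl (base N) (pow (base N) i) hb)
    (*-monoˡ-< (ℚₚ.<-≤-trans 0<1 (pow-≥1 (base-≥1 N) i)) lt))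
  where
  ha = h 1 (a# j)
  hb = h 1 (b# j)
  A = ι (a# j)
  j<a : j ℕ.< a# j
  j<a = subst (j ℕ.<_) (sym (a-form j)) (ℕₚ.m≤m+n (suc j) (suc j ℕ.+ 0))
  1<A/N : 1ℚ < A * inv N
  1<A/N = subst₂ _<_ (trans (ℚₚ.*-comm (inv N) (ι N)) (trans (ℚₚ.*-comm (ι N) (inv N)) (inv-ι′ 0<N))) (ℚₚ.*-comm (inv N) A)
    (*-monoˡ-< (inv-pos 0<N) (ℚₚ.≰⇒> λ A≤N → ℕₚ.<⇒≱ (ℕₚ.≤-<-trans N≤j j<a) (ι-cancel A≤N)))
  lt : ha < base N * hb
  lt = *-cancelˡ-< (ι-≥0 (a# j)) (ℚₚ.≤-<-trans (inB-h j le) (<-diff (hb * (A * inv N - 1ℚ)) (*->0 (ℚₚ.<-≤-trans 0<1 (h-≥1 1 (b>0 j))) (diff->0 1<A/N))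
    (solve 3 (λ A h i → (A :* h :+ h) :+ h :* (A :* i :- con 1ℚ) := A :* ((con 1ℚ :+ i) :* h)) refl A hb (inv N))))

¬-indicator : ℕ → ℚ
¬-indicator j = 1ℚ - 𝟙 (inB? j)

¬-indicator-≤ : ∀ j {x} → 0ℚ ≤ x → (¬ InB j → 1ℚ ≤ x) → ¬-indicator j ≤ x
¬-indicator-≤ j 0≤x f with inB? j
... | yes _ = 0≤x
... | no ¬b = f ¬b

upper-B : UAvg (λ j → 𝟙 (inB? j)) (fr 54944500000)
upper-B = uavg-≤ (ℚₚ.≤-reflexive (ℚₚ.+-identityʳ (fr 54944500000))) (uavg-mono pw (uavg-+ (proj₁ bad-bounds) few))
  where
  few : UAvg (λ j → 𝟙 (j ℕₚ.<? 16000)) 0ℚ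
  few = uavg-finite 16000 (λ j → 𝟙-≤1 (j ℕₚ.<? 16000)) (λ j le → ℚₚ.≤-reflexive (𝟙-no (j ℕₚ.<? 16000) (ℕₚ.≤⇒≯ le)))
  pw : ∀ j → 𝟙 (inB? j) ≤ 𝟙 (bad? false 16000 1 11199 11200 j) + 𝟙 (j ℕₚ.<? 16000)
  pw j = 𝟙-⊎ (inB? j) (bad? false 16000 1 11199 11200 j) (j ℕₚ.<? 16000) λ b → cases b (ℕₚ.<-≤-connex j 16000)
    where
    cases : InB j → j ℕ.< 16000 ⊎ 16000 ℕ.≤ j → Bad false 16000 1 11199 11200 j ⊎ j ℕ.< 16000
    cases b (inj₁ lt) = inj₂ lt
    cases b (inj₂ le) = inj₁ (inB-bad 16000 11199 j ℕ.z<s le b)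

upper-¬B : UAvg ¬-indicator (fr 946082900000)
upper-¬B = uavg-mono (λ j → ¬-indicator-≤ j (𝟙-≥0 (bad? true 16000 1 11200 11200 j)) λ ¬b → 1≤-𝟙 (bad? true 16000 1 11200 11200 j) (¬inB-bad 16000 11200 j ¬b)) (proj₂ bad-bounds)

-- Approximation by a periodic set

below? : ∀ Y j → Dec (trunc 1 Y (a# j) < trunc 1 Y (b# j))
below? Y j = trunc 1 Y (a# j) <? trunc 1 Y (b# j)

exceptional : ℕ → ℕ → ℕ → ℚ
exceptional Y d j = 𝟙 (big-tail? 2 Y d j) + (𝟙 (big-tail? 3 Y d j) + 𝟙 (close? Y d j))

exceptional-≥0 : ∀ Y d j → 0ℚ ≤ exceptional Y d j
exceptional-≥0 Y d j = +-≥0 (𝟙-≥0 (big-tail? 2 Y d j)) (+-≥0 (𝟙-≥0 (big-tail? 3 Y d j)) (𝟙-≥0 (close? Y d j)))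

exceptional-cases : ∀ Y d j → 1ℚ ≤ exceptional Y d j ⊎ (tailOf Y (a# j) ≤ inv d × tailOf Y (b# j) ≤ inv d × ¬ Close Y d j)
exceptional-cases Y d j with big-tail? 2 Y d j | big-tail? 3 Y d j | close? Y d j
... | yes _ | tb | c = inj₁ (1≤-inl ℚₚ.≤-refl (+-≥0 (𝟙-≥0 tb) (𝟙-≥0 c)))
... | no _ | yes _ | c = inj₁ (1≤-inr ℚₚ.≤-refl (1≤-inl ℚₚ.≤-refl (𝟙-≥0 c)))
... | no _ | no _ | yes _ = inj₁ (1≤-inr ℚₚ.≤-refl (1≤-inr ℚₚ.≤-refl ℚₚ.≤-refl))
... | no ¬ta | no ¬tb | no ¬c = inj₂ (ℚₚ.≮⇒≥ ¬ta , ℚₚ.≮⇒≥ ¬tb , ¬c)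

trunc-≤ : ∀ Y m → trunc 1 Y m ≤ ι Y
trunc-≤ Y m = ℚₚ.≤-trans (∑-mono Y λ i _ → subst (𝟙 (suc i ∣? m) * wt 1 (suc i) ≤_) (ℚₚ.*-identityˡ 1ℚ)
  (*-mono (𝟙-≥0 (suc i ∣? m)) 0≤1 (𝟙-≤1 (suc i ∣? m)) (ℚₚ.≤-trans (wt-≤ 1 (suc i)) (inv-≤1 (suc i))))) (ℚₚ.≤-reflexive (trans (∑-const Y 1ℚ) (ℚₚ.*-identityʳ (ι Y))))


h-≤-trunc : ∀ Y {m δ} → 0 ℕ.< m → tailOf Y m ≤ δ → h 1 m ≤ trunc 1 Y m + δ
h-≤-trunc Y {m} 0<m le = subst (_≤ trunc 1 Y m + _) (sym (h-trunc 1 Y 0<m)) (ℚₚ.+-monoʳ-≤ (trunc 1 Y m) le)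

trunc-≤-h : ∀ Y {m} → 0 ℕ.< m → trunc 1 Y m ≤ h 1 m
trunc-≤-h Y {m} 0<m = ≤-diff (tailOf Y m) (tail-≥0 1 Y m) (sym (h-trunc 1 Y 0<m))

¬close-below : ∀ {Y d j} → ¬ Close Y d j → trunc 1 Y (b# j) ≤ trunc 1 Y (a# j) → trunc 1 Y (b# j) + (inv d + inv d) < trunc 1 Y (a# j)
¬close-below {Y} {d} {j} ¬c le = ℚₚ.≰⇒> λ le′ → ¬c (ℚₚ.≤-trans le (≤-diff (inv d + inv d) (+-≥0 (inv-≥0 d) (inv-≥0 d)) refl) , le′)

¬close-above : ∀ {Y d j} → ¬ Close Y d j → trunc 1 Y (a# j) ≤ trunc 1 Y (b# j) → trunc 1 Y (a# j) + (inv d + inv d) < trunc 1 Y (b# j)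
¬close-above {Y} {d} {j} ¬c le = ℚₚ.≰⇒> λ le′ → ¬c (le′ , ℚₚ.≤-trans le (≤-diff (inv d + inv d) (+-≥0 (inv-≥0 d) (inv-≥0 d)) refl))

-- Outside the exceptional set the failure of `below?` means h(2n + 1) + δ < h(2n) for δ = 1/d. For
-- n in B this gives 2n δ ≤ h(2n + 1) < Y, which is impossible once j ≥ Y d.
inB-cover : ∀ Y d j → 0 ℕ.< d → 𝟙 (inB? j) ≤ 𝟙 (below? Y j) + (exceptional Y d j + 𝟙 (j ℕₚ.<? Y ℕ.* d))
inB-cover Y d j 0<d = 𝟙-≤ (inB? j) (+-≥0 (𝟙-≥0 (below? Y j)) (+-≥0 (exceptional-≥0 Y d j) (𝟙-≥0 (j ℕₚ.<? Y ℕ.* d)))) go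
  where
  open ℚₚ.≤-Reasoning
  go : InB j → 1ℚ ≤ 𝟙 (below? Y j) + (exceptional Y d j + 𝟙 (j ℕₚ.<? Y ℕ.* d))
  go b with exceptional-cases Y d j | ℕₚ.<-≤-connex j (Y ℕ.* d) | below? Y j
  ... | inj₁ e | _ | A = 1≤-inr (𝟙-≥0 A) (1≤-inl e (𝟙-≥0 (j ℕₚ.<? Y ℕ.* d)))
  ... | inj₂ _ | inj₁ lt | A = 1≤-inr (𝟙-≥0 A) (1≤-inr (exceptional-≥0 Y d j) (1≤-𝟙 (j ℕₚ.<? Y ℕ.* d) lt))
  ... | inj₂ _ | inj₂ _ | yes _ = 1≤-inl ℚₚ.≤-refl (+-≥0 (exceptional-≥0 Y d j) (𝟙-≥0 (j ℕₚ.<? Y ℕ.* d)))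
  ... | inj₂ (ta , tb , ¬c) | inj₂ large | no ¬A = ⊥-elim (ℚₚ.<-irrefl refl (begin-strict
    ι Y ≡⟨ sym (trans (cong (_* δ) (ι-* Y d)) (trans (ℚₚ.*-assoc (ι Y) (ι d) δ) (trans (cong (ι Y *_) (trans (ℚₚ.*-comm (ι d) δ) (inv-ι′ 0<d))) (ℚₚ.*-identityʳ (ι Y))))) ⟩
    ι (Y ℕ.* d) * δ ≤⟨ *-monoʳ (inv-≥0 d) (ι-mono (ℕₚ.≤-trans large (subst (j ℕ.≤_) (sym (a-form j)) (ℕₚ.≤-trans (ℕₚ.n≤1+n j) (ℕₚ.m≤m+n (suc j) (suc j ℕ.+ 0)))))) ⟩
    A * δ ≤⟨ ≤-diff (A * (ha - (hb + δ))) (*-≥0 (ι-≥0 (a# j)) (diff-≥0 (ℚₚ.<⇒≤ hb+δ<ha))) (solve 4 (λ A d x y → A :* d :+ A :* (x :- (y :+ d)) := A :* x :- A :* y) refl A δ ha hb) ⟩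
    A * ha - A * hb ≤⟨ ≤-diff (A * hb + hb - A * ha) (diff-≥0 (inB-h j b)) (solve 3 (λ A x y → (A :* x :- A :* y) :+ ((A :* y :+ y) :- A :* x) := y) refl A ha hb) ⟩
    hb <⟨ <-diff (ta′ - (tb′ + (δ + δ)) + δ) (ℚₚ.<-≤-trans (diff->0 lt) (≤-diff δ (inv-≥0 d) refl)) refl ⟩
    hb + (ta′ - (tb′ + (δ + δ)) + δ) ≤⟨ ≤-diff (tb′ + δ - hb) (diff-≥0 (h-≤-trunc Y (b>0 j) tb)) (solve 4 (λ h ta tb d → (h :+ (ta :- (tb :+ (d :+ d)) :+ d)) :+ ((tb :+ d) :- h) := ta) refl hb ta′ tb′ δ) ⟩
    ta′ ≤⟨ trunc-≤ Y (a# j) ⟩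
    ι Y ∎))
    where
    δ = inv d
    A = ι (a# j)
    ha = h 1 (a# j)
    hb = h 1 (b# j)
    ta′ = trunc 1 Y (a# j)
    tb′ = trunc 1 Y (b# j)
    lt : tb′ + (δ + δ) < ta′
    lt = ¬close-below {Y} {d} {j} ¬c (ℚₚ.≮⇒≥ ¬A)
    hb+δ<ha : hb + δ < ha
    hb+δ<ha = ℚₚ.≤-<-trans (ℚₚ.+-monoˡ-≤ δ (h-≤-trunc Y (b>0 j) tb)) (ℚₚ.<-≤-trans (subst (_< ta′) (sym (ℚₚ.+-assoc tb′ δ δ)) lt) (trunc-≤-h Y (a>0 j)))

-- Here the factor (2n + 1) / 2n is favourable, so no initial segment is excluded.
¬inB-cover : ∀ Y d j → ¬-indicator j ≤ (1ℚ - 𝟙 (below? Y j)) + exceptional Y d j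
¬inB-cover Y d j = ¬-indicator-≤ j (+-≥0 (diff-≥0 (𝟙-≤1 (below? Y j))) (exceptional-≥0 Y d j)) go
  where
  go : ¬ InB j → 1ℚ ≤ (1ℚ - 𝟙 (below? Y j)) + exceptional Y d j
  go ¬b with exceptional-cases Y d j | below? Y j
  ... | inj₁ e | A = 1≤-inr (diff-≥0 (𝟙-≤1 A)) e
  ... | inj₂ _ | no _ = 1≤-inl ℚₚ.≤-refl (exceptional-≥0 Y d j)
  ... | inj₂ (ta , tb , ¬c) | yes A = ⊥-elim (ℚₚ.<-asym (¬inB-h j ¬b) (ℚₚ.≤-<-trans (h-≤-trunc Y (a>0 j) ta)
     (ℚₚ.≤-<-trans (ℚₚ.+-monoʳ-≤ (trunc 1 Y (a# j)) (≤-diff (inv d) (inv-≥0 d) refl)) (ℚₚ.<-≤-trans (¬close-above {Y} {d} {j} ¬c (ℚₚ.<⇒≤ A)) (trunc-≤-h Y (b>0 j))))))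

five-inv : ∀ {n} → 0 ℕ.< n → five (inv (5 ℕ.* n)) ≡ inv n
five-inv {n} 0<n = trans (cong five (inv-* {5} {n} ℕ.z<s 0<n)) (trans (solve 2 (λ a b → let x = a :* b in x :+ (x :+ (x :+ (x :+ x))) :=
    (a :* (con 1ℚ :+ (con 1ℚ :+ (con 1ℚ :+ (con 1ℚ :+ con 1ℚ))))) :* b) refl (inv 5) (inv n))
  (trans (cong (λ k → (inv 5 * k) * inv n) (sym ι5)) (trans (cong (_* inv n) (inv-ι 4)) (ℚₚ.*-identityˡ (inv n)))))
  where
  ι5 : ι 5 ≡ 1ℚ + (1ℚ + (1ℚ + (1ℚ + 1ℚ)))
  ι5 = trans (ι-suc 4) (cong (1ℚ +_) (trans (ι-suc 3) (cong (1ℚ +_) (trans (ι-suc 2) (cong (1ℚ +_) (trans (ι-suc 1) (cong (1ℚ +_) ι-1)))))))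

five>0 : ∀ {x} → 0ℚ < x → 0ℚ < five x
five>0 p = ℚₚ.+-mono-< p (ℚₚ.+-mono-< p (ℚₚ.+-mono-< p (ℚₚ.+-mono-< p p)))

ten<25 : ∀ {u} → 0ℚ < u → five u + five u < five (five u)
ten<25 {u} 0<u = <-diff (five (five u) - (five u + five u)) (subst (0ℚ <_) (solve 1 (λ u → let f = λ x → x :+ (x :+ (x :+ (x :+ x))) in f u :+ (f u :+ f u) := f (f u) :- (f u :+ f u)) refl u)
    (ℚₚ.+-mono-< (five>0 0<u) (ℚₚ.+-mono-< (five>0 0<u) (five>0 0<u)))) (solve 2 (λ a b → a :+ (b :- a) := b) refl (five u + five u) (five (five u)))

-- Bracketed like the error of `approximable`: four Markov terms, the sieve, 1/y and 3/y.
nine : ℚ → ℚ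
nine u = u + (u + (u + (u + (u + (u + three * u)))))

-- In use, c is the density of a periodic set. The two bounds confine the limit points of B(x)/x to
-- within e of c, which yields the Cauchy property without naming the limit.
Approximable : ℚ → Set
Approximable e = ∃[ c ] (UAvg (λ j → 𝟙 (inB? j)) (c + e) × UAvg ¬-indicator ((1ℚ - c) + e))

approximable : ∀ y z n → 0 ℕ.< n → 2 ℕ.≤ y → n ℕ.≤ y → 0 ℕ.< z → sieveDensity y z ≤ inv n → Approximable (nine (inv n))
approximable y z n 0<n 2≤y n≤y 0<z R≤ = c ,
  uavg-≤ (ℚₚ.+-monoʳ-≤ c (ℚₚ.≤-trans (ℚₚ.≤-reflexive (ℚₚ.+-identityʳ _)) err≤)) (uavg-mono (λ j → inB-cover Y d j 0<d) (uavg-+ A-avg (uavg-+ exc few))) ,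
  uavg-≤ (ℚₚ.+-monoʳ-≤ (1ℚ - c) err≤) (uavg-mono (¬inB-cover Y d) (uavg-+ ¬A-avg exc))
  where
  u = inv n
  -- With δ = 1/d, 10 δ < 25 δ = 1/z² is the gap demanded by `free-unique`; Y then makes each Markov
  -- term d (2/Y) equal to 1/n.
  d = 5 ℕ.* (5 ℕ.* (z ℕ.* z))
  Y = d ℕ.* (2 ℕ.* n)
  M = period 1 Y
  0<z² : 0 ℕ.< z ℕ.* z
  0<z² = ℕₚ.*-mono-< 0<z 0<z
  0<d : 0 ℕ.< d
  0<d = ℕₚ.*-mono-< {0} {5} ℕ.z<s (ℕₚ.*-mono-< {0} {5} ℕ.z<s 0<z²)
  0<2n : 0 ℕ.< 2 ℕ.* n
  0<2n = ℕₚ.*-mono-< {0} {2} ℕ.z<s 0<n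
  0<Y : 0 ℕ.< Y
  0<Y = ℕₚ.*-mono-< 0<d 0<2n
  gap : five (inv d) + five (inv d) < inv z * inv z
  gap = subst (five (inv d) + five (inv d) <_) (trans (cong five (five-inv (ℕₚ.*-mono-< {0} {5} ℕ.z<s 0<z²))) (trans (five-inv 0<z²) (inv-* 0<z 0<z))) (ten<25 (inv-pos 0<d))
  A-≥0 : ∀ j → 0ℚ ≤ 𝟙 (below? Y j)
  A-≥0 j = 𝟙-≥0 (below? Y j)
  per : Periodic M (λ j → 𝟙 (below? Y j))
  per t i = 𝟙-cong (below? Y (t ℕ.* M ℕ.+ i)) (below? Y i) (subst₂ _<_ (trunc-periodic 1 Y 2 t i) (trunc-periodic 1 Y 3 t i)) (subst₂ _<_ (sym (trunc-periodic 1 Y 2 t i)) (sym (trunc-periodic 1 Y 3 t i)))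
  c = ∑ M (λ j → 𝟙 (below? Y j)) * inv M
  A-avg : UAvg (λ j → 𝟙 (below? Y j)) c
  A-avg = uavg-periodic (period>0 1 Y) per A-≥0
  ¬A-avg : UAvg (λ j → 1ℚ - 𝟙 (below? Y j)) (1ℚ - c)
  ¬A-avg = uavg-≤ (ℚₚ.≤-reflexive (trans (cong (_* inv M) (∑-neg M _)) (trans (solve 3 (λ m s i → (m :- s) :* i := i :* m :- s :* i) refl (ι M) (∑ M (λ j → 𝟙 (below? Y j))) (inv M)) (cong (_- c) (inv-ι′ (period>0 1 Y))))))
    (uavg-periodic (period>0 1 Y) (λ t i → cong (λ k → 1ℚ - k) (per t i)) (λ j → diff-≥0 (𝟙-≤1 (below? Y j))))
  t = ι d * (two * inv Y)
  t≡u : t ≡ u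
  t≡u = begin
    ι d * (two * inv (d ℕ.* (2 ℕ.* n))) ≡⟨ cong (λ k → ι d * (two * k)) (trans (inv-* 0<d 0<2n) (cong (inv d *_) (inv-* {2} {n} ℕ.z<s 0<n))) ⟩
    ι d * (two * (inv d * (inv 2 * u))) ≡⟨ solve 4 (λ d i h u → d :* ((con 1ℚ :+ con 1ℚ) :* (i :* (h :* u))) := (i :* d) :* ((h :+ h) :* u)) refl (ι d) (inv d) (inv 2) u ⟩
    (inv d * ι d) * ((½ + ½) * u) ≡⟨ cong₂ (λ a b → a * (b * u)) (inv-ι′ 0<d) ½+½ ⟩
    1ℚ * (1ℚ * u) ≡⟨ trans (ℚₚ.*-identityˡ (1ℚ * u)) (ℚₚ.*-identityˡ u) ⟩
    u ∎
    where open ≡-Reasoning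
  err = t + (t + (t + (t + (sieveDensity y z + (inv y + three * inv y)))))
  err≤ : err ≤ nine u
  err≤ = ℚₚ.+-mono-≤ t≤ (ℚₚ.+-mono-≤ t≤ (ℚₚ.+-mono-≤ t≤ (ℚₚ.+-mono-≤ t≤ (ℚₚ.+-mono-≤ R≤ (ℚₚ.+-mono-≤ y≤ (*-monoˡ three≥0 y≤))))))
    where
    t≤ : t ≤ u
    t≤ = ℚₚ.≤-reflexive t≡u
    y≤ : inv y ≤ u
    y≤ = inv-anti 0<n n≤y
  exc : UAvg (exceptional Y d) err
  exc = uavg-+ (uavg-big-tail ℕ.z<s 0<Y 0<d) (uavg-+ (uavg-big-tail ℕ.z<s 0<Y 0<d) (uavg-close y z Y d 2≤y 0<z 0<Y 0<d gap))
  few : UAvg (λ j → 𝟙 (j ℕₚ.<? Y ℕ.* d)) 0ℚ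
  few = uavg-finite (Y ℕ.* d) (λ j → 𝟙-≤1 (j ℕₚ.<? Y ℕ.* d)) (λ j le → ℚₚ.≤-reflexive (𝟙-no (j ℕₚ.<? Y ℕ.* d) (ℕₚ.≤⇒≯ le)))

approximation : ∀ n → 0 ℕ.< n → Approximable (nine (inv n))
approximation n 0<n = let z , 0<z , R≤ = sieve-small (2 ℕ.+ n) n 0<n in
  approximable (2 ℕ.+ n) z n 0<n (ℕₚ.m≤m+n 2 n) (ℕₚ.m≤n+m n 2) 0<z R≤

-- The sequence B(x)/x

eventually : ∀ {f q} → UAvg f q → ∀ ε → 0ℚ < ε → ∃[ N ] (∀ n → N ℕ.≤ n → ∑ (suc n) f ≤ (q + ε) * ι (suc n))
eventually {f} {q} U ε 0<ε with U .bound (½ * ε) (*->0 0<½ 0<ε) | recip (½ * ε) (*->0 0<½ 0<ε)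
... | C , p | r , _ , 1≤rη with ceil C
... | K , C≤K = K ℕ.* r , λ n N≤n → ℚₚ.≤-trans (p (suc n)) (begin
    (q + η) * X n + C ≤⟨ ℚₚ.+-monoʳ-≤ ((q + η) * X n) (begin
      C ≤⟨ C≤K ⟩
      ι K ≡⟨ sym (ℚₚ.*-identityʳ (ι K)) ⟩
      ι K * 1ℚ ≤⟨ *-monoˡ (ι-≥0 K) 1≤rη ⟩
      ι K * (ι r * η) ≡⟨ trans (sym (ℚₚ.*-assoc (ι K) (ι r) η)) (cong (_* η) (sym (ι-* K r))) ⟩
      ι (K ℕ.* r) * η ≤⟨ *-monoʳ (ℚₚ.<⇒≤ (*->0 0<½ 0<ε)) (ι-mono (ℕₚ.≤-trans N≤n (ℕₚ.n≤1+n n))) ⟩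
      X n * η ∎) ⟩
    (q + η) * X n + X n * η ≡⟨ solve 4 (λ q h e x → (q :+ h :* e) :* x :+ x :* (h :* e) := (q :+ (h :+ h) :* e) :* x) refl q ½ ε (X n) ⟩
    (q + (½ + ½) * ε) * X n ≡⟨ cong (λ k → (q + k) * X n) (trans (cong (_* ε) ½+½) (ℚₚ.*-identityˡ ε)) ⟩
    (q + ε) * X n ∎)
  where
  open ℚₚ.≤-Reasoning
  η = ½ * ε
  X : ℕ → ℚ
  X n = ι (suc n)

ratio-∑ : ∀ n → ratio n * ι (suc n) ≡ ∑ (suc n) (λ j → 𝟙 (inB? j))
ratio-∑ n = trans (/-ι (Bcount (suc n)) n) (∑-inB (suc n))

ratio-upper : ∀ {q} → UAvg (λ j → 𝟙 (inB? j)) q → ∀ ε → 0ℚ < ε → ∃[ N ] (∀ n → N ℕ.≤ n → ratio n ≤ q + ε)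
ratio-upper {q} U ε 0<ε = let N , p = eventually U ε 0<ε in N , λ n N≤n → *-cancelˡ (ι->0 n) (subst₂ _≤_ (trans (sym (ratio-∑ n)) (ℚₚ.*-comm (ratio n) (ι (suc n)))) (ℚₚ.*-comm (q + ε) (ι (suc n))) (p n N≤n))

ratio-lower : ∀ {q} → UAvg ¬-indicator q → ∀ ε → 0ℚ < ε → ∃[ N ] (∀ n → N ℕ.≤ n → 1ℚ - ratio n ≤ q + ε)
ratio-lower {q} U ε 0<ε = let N , p = eventually U ε 0<ε in N , λ n N≤n → *-cancelˡ (ι->0 n) (subst₂ _≤_
  (trans (∑-neg (suc n) _) (trans (cong (λ k → ι (suc n) - k) (sym (ratio-∑ n))) (solve 2 (λ r x → x :- r :* x := x :* (con 1ℚ :- r)) refl (ratio n) (ι (suc n))))) (ℚₚ.*-comm (q + ε) (ι (suc n))) (p n N≤n))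

∣-∣-< : ∀ {x ε} → x < ε → - x < ε → ℚ.∣ x ∣ < ε
∣-∣-< {x} p q with ℚₚ.∣p∣≡p∨∣p∣≡-p x
... | inj₁ e = subst (_< _) (sym e) p
... | inj₂ e = subst (_< _) (sym e) q

difference-< : ∀ {c u x y} → 0ℚ < u → x ≤ c + nine u + u → 1ℚ - y ≤ (1ℚ - c) + nine u + u → x - y < five (five u)
difference-< {c} {u} {x} {y} 0<u x≤ y≥ = begin-strict
  x - y ≡⟨ solve 2 (λ a b → a :- b := (a :+ (con 1ℚ :- b)) :- con 1ℚ) refl x y ⟩
  (x + (1ℚ - y)) - 1ℚ ≤⟨ ℚₚ.+-monoˡ-≤ (- 1ℚ) (ℚₚ.+-mono-≤ x≤ y≥) ⟩
  ((c + nine u + u) + ((1ℚ - c) + nine u + u)) - 1ℚ ≡⟨ solve 2 (λ c u → let f = λ x → x :+ (x :+ (x :+ (x :+ x))) ; t = con 1ℚ :+ (con 1ℚ :+ con 1ℚ) ; g = u :+ (u :+ (u :+ (u :+ (u :+ (u :+ t :* u))))) in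
      ((c :+ g :+ u) :+ ((con 1ℚ :- c) :+ g :+ u)) :- con 1ℚ := (f u :+ f u) :+ (f u :+ f u)) refl c u ⟩
  (five u + five u) + (five u + five u) <⟨ <-diff (five u) (five>0 0<u) (solve 1 (λ u → let f = λ x → x :+ (x :+ (x :+ (x :+ x))) in ((f u :+ f u) :+ (f u :+ f u)) :+ f u := f (f u)) refl u) ⟩
  five (five u) ∎
  where open ℚₚ.≤-Reasoning

-- The bound from above at m and the one from below at n refer to the same c, which cancels: what
-- remains is 2 (9 u + u) < 25 u.
ratio-close : ∀ {ε u} → 0ℚ < u → five (five u) ≤ ε → Approximable (nine u) → ∃[ N ] ((m n : ℕ) → N ℕ.≤ m → N ℕ.≤ n → ratio m - ratio n < ε)
ratio-close {ε} {u} 0<u le (c , U , V) =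
  let N₁ , up = ratio-upper U u 0<u
      N₂ , lo = ratio-lower V u 0<u
  in N₁ ℕ.⊔ N₂ , λ m n m≥ n≥ → ℚₚ.<-≤-trans (difference-< {c} {u} {ratio m} {ratio n} 0<u (up m (ℕₚ.≤-trans (ℕₚ.m≤m⊔n N₁ N₂) m≥)) (lo n (ℕₚ.≤-trans (ℕₚ.m≤n⊔m N₁ N₂) n≥))) le

ratio-cauchy : (ε : ℚ) → 0ℚ < ε → ∃[ N ] ((m n : ℕ) → N ℕ.≤ m → N ℕ.≤ n → ℚ.∣ ratio m - ratio n ∣ < ε)
ratio-cauchy ε 0<ε =
  let k , 0<k , 1≤kε = recip ε 0<ε
      0<5k = ℕₚ.*-mono-< {0} {5} ℕ.z<s 0<k
      0<25k = ℕₚ.*-mono-< {0} {5} ℕ.z<s 0<5k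
      25u≤ε = subst (_≤ ε) (sym (trans (cong five (five-inv 0<5k)) (five-inv 0<k))) (subst (_≤ ε) (ℚₚ.*-identityˡ (inv k)) (*inv-≤ 0<k 1≤kε))
      N , p = ratio-close (inv-pos 0<25k) 25u≤ε (approximation (5 ℕ.* (5 ℕ.* k)) 0<25k)
  in N , λ m n m≥ n≥ → ∣-∣-< (p m n m≥ n≥) (subst (_< ε) (solve 2 (λ a b → b :- a := :- (a :- b)) refl (ratio m) (ratio n)) (p n m n≥ m≥))

-- Both bounds have denominator 10 ^ 7, the tables work with 10 ^ 12.
fr-bound : ∀ m → fr (m ℕ.* 100000) ≡ (ℤ.+ m) ℚ./ 10000000
fr-bound m = begin
  fr (m ℕ.* 100000) ≡⟨ fr-def (m ℕ.* 100000) ⟩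
  ι (m ℕ.* 100000) * inv scale ≡⟨ cong₂ _*_ (trans (ι-* m 100000) (cong (_* ι 100000) (sym (/-ι m 9999999)))) (inv-* {10000000} {100000} ℕ.z<s ℕ.z<s) ⟩
  ((q * ι 10000000) * ι 100000) * (inv 10000000 * inv 100000) ≡⟨ solve 5 (λ q a b i j → ((q :* a) :* b) :* (i :* j) := q :* ((i :* a) :* (j :* b))) refl q (ι 10000000) (ι 100000) (inv 10000000) (inv 100000) ⟩
  q * ((inv 10000000 * ι 10000000) * (inv 100000 * ι 100000)) ≡⟨ cong₂ (λ a b → q * (a * b)) (inv-ι 9999999) (inv-ι 99999) ⟩
  q * (1ℚ * 1ℚ) ≡⟨ trans (cong (q *_) (ℚₚ.*-identityˡ 1ℚ)) (ℚₚ.*-identityʳ q) ⟩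
  q ∎
  where
  open ≡-Reasoning
  q = (ℤ.+ m) ℚ./ 10000000

fr-complement : 1ℚ - fr 946082900000 ≡ lowerBound
fr-complement = trans (cong (_- fr 946082900000) (trans (sym fr-scale) (fr-+ (539171 ℕ.* 100000) 946082900000)))
  (trans (solve 2 (λ a b → (a :+ b) :- b := a) refl (fr (539171 ℕ.* 100000)) (fr 946082900000)) (fr-bound 539171))

ratio-bounds : (ε : ℚ) → 0ℚ < ε → ∃[ N ] ((n : ℕ) → N ℕ.≤ n → (lowerBound - ε) ≤ ratio n × ratio n ≤ (upperBound + ε))
ratio-bounds ε 0<ε =
  let N₁ , up = ratio-upper upper-B ε 0<ε
      N₂ , lo = ratio-lower upper-¬B ε 0<ε
  in N₁ ℕ.⊔ N₂ , λ n n≥ →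
  subst (λ b → b - ε ≤ ratio n) fr-complement (≤-diff ((w + ε) - (1ℚ - ratio n)) (diff-≥0 (lo n (ℕₚ.≤-trans (ℕₚ.m≤n⊔m N₁ N₂) n≥)))
    (solve 3 (λ w e r → ((con 1ℚ :- w) :- e) :+ ((w :+ e) :- (con 1ℚ :- r)) := r) refl w ε (ratio n))) ,
  subst (λ b → ratio n ≤ b + ε) (fr-bound 549445) (up n (ℕₚ.≤-trans (ℕₚ.m≤m⊔n N₁ N₂) n≥))
  where w = fr 946082900000

theorem1 : ((ε : ℚ) → 0ℚ < ε → ∃[ N ] ((m n : ℕ) → N ℕ.≤ m → N ℕ.≤ n → ℚ.∣ ratio m - ratio n ∣ < ε))
    × ((ε : ℚ) → 0ℚ < ε → ∃[ N ] ((n : ℕ) → N ℕ.≤ n → (lowerBound - ε) ≤ ratio n × ratio n ≤ (upperBound + ε)))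
theorem1 = ratio-cauchy , ratio-bounds
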